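{- Let $G=(V,E)$ be a finite simple graph whose vertex set carries a fixed total order $<$, and let $\lambda=(\lambda_1\ge\dots\ge\lambda_{\ell})$ be any partition. Then $(-1)^{|\lambda|-\ell(\lambda)}[\overline{p}'_\lambda]\overline{X}_G$ equals the number of multisets $\{L_1,\dots,L_{\ell}\}$ of Lyndon heaps on $G$, where $L_i$ is associated to the part $\lambda_i$ (assignments $i\mapsto L_i$ identified up to permutations of indices carrying equal parts), such that: (i) every vertex of $V$ is used by at least one $L_i$; (ii) for each $i$, either $|L_i|=\lambda_i$, or $\lambda_i/2$ is an odd integer and $|L_i|=\lambda_i/2$; (iii) whenever $i\neq i'$ and $\lambda_i=\lambda_{i'}$ is odd, $L_i\neq L_{i'}$.
   Context: Kromatic symmetric function: a proper set coloring of $G$ is a map $\kappa$ from $V$ to nonempty subsets of $\mathbb{Z}_{>0}$ with $\kappa(u)\cap\kappa(v)=\varnothing$ whenever $uv\in E$; $\overline{X}_G(x_1,x_2,\dots)=\sum_{\kappa}\prod_{v\in V}\prod_{i\in\kappa(v)}x_i$, a symmetric formal power series (of unbounded degree). For $k\ge1$ define $\overline{p}'_k$ by $1+\overline{p}'_k=\prod_{i\ge1}\frac{1}{1-x_i^k}$, and $\overline{p}'_\lambda=\overline{p}'_{\lambda_1}\cdots\overline{p}'_{\lambda_{\ell(\lambda)}}$. Since the lowest-degree part of $\overline{p}'_\lambda$ is the power sum $p_\lambda$, every symmetric formal power series $F$ has a unique (degreewise finite) expansion $F=\sum_\lambda c_\lambda\overline{p}'_\lambda$; write $[\overline{p}'_\lambda]F=c_\lambda$.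 $|\lambda|$ is the sum of the parts and $\ell(\lambda)$ the number of parts. Heaps: consider finite words over the alphabet $V$; two words are equivalent if one is obtained from the other by repeatedly swapping two consecutive letters that are distinct and non-adjacent in $G$. A heap on $G$ is an equivalence class; its size $|H|$ is the word length, its pieces are the letter occurrences, and $H$ uses $v$ if $v$ occurs in its words. The pieces form a poset generated by position $a$ preceding $b$ whenever $a<b$ and $w_a,w_b$ are equal or adjacent in $G$ (for any word $w_1\cdots w_n$ of $H$). Composition $H\circ K$ is the class of concatenation. $H$ is a pyramid if its poset of pieces has a unique minimal element; $H$ is periodic if $H=K\circ\cdots\circ K$ ($m\ge2$ copies), aperiodic otherwise. Rotation: for a pyramid $H$ and piece $p$, let $V$ be the subheap on the pieces $\ge p$ and $U$ the subheap on the rest, so $H=U\circ V$; set $A_p(H)=V\circ U$. By Lalonde, iterating $A_p$ stabilizes to a pyramid $A_p^\infty(H)$ with unique minimal piece $p$; the rotation class of $H$ is $\{A_p^\infty(H)\}_p$, an equivalence relation on pyramids. The standard word of a heap is its lexicographically largest word (letters ordered by $<$); heaps are compared via their standard words lexicographically. A Lyndon heap is an aperiodic pyramid that is minimal in its rotation class. -}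

module Defs where

open import Data.Bool using (Bool; true; false; _∧_; _∨_; not; if_then_else_)
open import Data.Nat using (ℕ; zero; suc; _+_; _*_; _∸_; _≤_; _≡ᵇ_; _≤ᵇ_)
open import Data.Fin using (Fin; toℕ) renaming (_<_ to _<ᶠ_)
open import Data.Fin.Properties using () renaming (_≟_ to _≟ᶠ_)
open import Data.Fin.Permutation using (Permutation′; _⟨$⟩ʳ_)
open import Data.List using (List; []; _∷_; _++_; length; map; concatMap; filterᵇ; foldr;
  upTo; allFin; zipWith; replicate; concat; lookup)
open import Data.Bool.ListAction using (all; any)
open import Data.Nat.ListAction using (sum)
open import Data.List.Membership.Propositional using (_∈_)
open import Data.List.Relation.Unary.All using (All)
open import Data.List.Relation.Unary.Linked using (Linked)
open import Data.Vec using (Vec; fromList) renaming (lookup to vlookup; [] to v[]; _∷_ to _v∷_)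
open import Data.Integer using (+_)
open import Data.Rational using (ℚ; _/_; 1ℚ; 0ℚ) renaming (_+_ to _+ℚ_; _*_ to _*ℚ_; -_ to -ℚ_)
open import Data.Product using (Σ; ∃; ∃-syntax; _×_; _,_)
open import Data.Sum using (_⊎_)
open import Relation.Nullary using (¬_; does)
open import Relation.Binary.PropositionalEquality using (_≡_; _≢_)
open import Relation.Binary.Construct.Closure.ReflexiveTransitive using (Star)

-- Finite simple graphs on the totally ordered vertex set Fin n
-- (the fixed total order on V is the order of Fin n).

record SimpleGraph (n : ℕ) : Set where
  field
    adj    : Fin n → Fin n → Bool
    sym    : ∀ u v → adj u v ≡ adj v u
    irrefl : ∀ v → adj v v ≡ false
open SimpleGraph public

IsPartition : List ℕ → Set
IsPartition λ′ = All (1 ≤_) λ′ × Linked (λ a b → b ≤ a) λ′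

-- all partitions of d with parts ≤ m (fuel f ≥ d)
partsF : ℕ → ℕ → ℕ → List (List ℕ)
partsF _       zero    m = [] ∷ []
partsF zero    (suc d) m = []
partsF (suc f) (suc d) m =
  concatMap (λ k → if (suc k ≤ᵇ m) then map (suc k ∷_) (partsF f (d ∸ k) (suc k)) else [])
            (upTo (suc d))

partitionsOf : ℕ → List (List ℕ)
partitionsOf d = partsF d d d

partitionsUpTo : ℕ → List (List ℕ)
partitionsUpTo d = concatMap partitionsOf (upTo (suc d))

-- Monomials x^α in the variables x_1, x_2, ... are encoded by finite
-- exponent lists α = (α_1, ..., α_k) (exponent 0 for x_j, j > k).

allVecs : {A : Set} → List A → (m : ℕ) → List (Vec A m)
allVecs xs zero    = v[] ∷ []
allVecs xs (suc m) = concatMap (λ x → map (x v∷_) (allVecs xs m)) xs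

countB : {A : Set} → (A → Bool) → List A → ℕ
countB p xs = length (filterᵇ p xs)

-- Coefficient of x^α in the kromatic symmetric function X̄_G:
-- number of proper set colorings κ : V → nonempty subsets of {1..k}
-- (k = length α; a color j > k would contribute x_j with positive
-- exponent) with ∏_v ∏_{i ∈ κ(v)} x_i = x^α.
-- A subset of {1..k} is a Vec Bool k.
coefX : ∀ {n} → SimpleGraph n → List ℕ → ℕ
coefX {n} G α = countB valid (allVecs (allVecs (true ∷ false ∷ []) k) n)
  where
  k = length α
  αv = fromList α
  nonempty : Vec Bool k → Bool
  nonempty s = any (vlookup s) (allFin k)
  disjoint : Vec Bool k → Vec Bool k → Bool
  disjoint s t = all (λ i → not (vlookup s i ∧ vlookup t i)) (allFin k)
  valid : Vec (Vec Bool k) n → Bool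
  valid κ =
    all (λ v → nonempty (vlookup κ v)) (allFin n)
    ∧ all (λ u → all (λ v → not (adj G u v) ∨ disjoint (vlookup κ u) (vlookup κ v)) (allFin n)) (allFin n)
    ∧ all (λ i → countB (λ v → vlookup (vlookup κ v) i) (allFin n) ≡ᵇ vlookup αv i) (allFin k)

boxes : List ℕ → List (List ℕ)
boxes []       = [] ∷ []
boxes (a ∷ as) = concatMap (λ b → map (b ∷_) (boxes as)) (upTo (suc a))

-- Coefficient of x^α in p̄'_μ = p̄'_{μ_1} ⋯ p̄'_{μ_ℓ}, where
-- p̄'_l = ∏_i 1/(1 - x_i^l) - 1 = Σ_{β ≠ 0} x^{lβ}.
coefP : List ℕ → List ℕ → ℕ
coefP []      α = if all (_≡ᵇ 0) α then 1 else 0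
coefP (l ∷ μ) α =
  sum (map (λ β → coefP μ (zipWith _∸_ α (map (l *_) β))) (filterᵇ ok (boxes α)))
  where
  ok : List ℕ → Bool
  ok β = any (λ b → not (b ≡ᵇ 0)) β
         ∧ all (λ p → p) (zipWith (λ b a → (l * b) ≤ᵇ a) β α)

ℕtoℚ : ℕ → ℚ
ℕtoℚ m = (+ m) / 1

sumℚ : List ℚ → ℚ
sumℚ = foldr _+ℚ_ 0ℚ

-- c : (partitions) → ℚ is the p̄'-expansion of X̄_G:
-- X̄_G = Σ_λ c_λ p̄'_λ, compared coefficientwise on every monomial x^α.
-- (Only partitions λ with |λ| ≤ |α| can contribute to x^α.)
IsPbarExpansion : ∀ {n} → SimpleGraph n → (List ℕ → ℚ) → Set
IsPbarExpansion G c =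
  ∀ (α : List ℕ) →
    ℕtoℚ (coefX G α) ≡ sumℚ (map (λ μ → c μ *ℚ ℕtoℚ (coefP μ α)) (partitionsUpTo (sum α)))

sgn : ℕ → ℚ
sgn zero    = 1ℚ
sgn (suc k) = -ℚ (sgn k)

-- Heaps on G: words over Fin n modulo commutation of consecutive
-- distinct non-adjacent letters.

Word : ℕ → Set
Word n = List (Fin n)

module _ {n : ℕ} (G : SimpleGraph n) where

  data Swap : Word n → Word n → Set where
    here  : ∀ {x y w} → x ≢ y → adj G x y ≡ false → Swap (x ∷ y ∷ w) (y ∷ x ∷ w)
    there : ∀ {z w w′} → Swap w w′ → Swap (z ∷ w) (z ∷ w′)

  _~_ : Word n → Word n → Set
  _~_ = Star Swap

  conn : Fin n → Fin n → Bool
  conn x y = does (x ≟ᶠ y) ∨ adj G x y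

  numMinAux : Word n → Word n → ℕ
  numMinAux seen []      = 0
  numMinAux seen (y ∷ w) =
    (if any (λ x → conn x y) seen then 0 else 1) + numMinAux (y ∷ seen) w

  IsPyramid : Word n → Set
  IsPyramid w = numMinAux [] w ≡ 1

  IsPeriodic : Word n → Set
  IsPeriodic w = ∃[ k ] ∃[ m ] (2 ≤ m × concat (replicate m k) ~ w)

  -- Given the letters already known to be ≥ p (in V) and the remaining
  -- suffix, split the suffix into (V-part, U-part): a piece is ≥ p iff it
  -- is equal/adjacent to some earlier piece ≥ p.
  splitUp : Word n → Word n → Word n × Word n
  splitUp vs []      = [] , []
  splitUp vs (y ∷ w) with any (λ x → conn x y) vs
  ... | true  = let r = splitUp (y ∷ vs) w in (y ∷ Data.Product.proj₁ r) , Data.Product.proj₂ r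
  ... | false = let r = splitUp vs w in Data.Product.proj₁ r , (y ∷ Data.Product.proj₂ r)

  -- A_p for the word pre ++ x ∷ post with p the piece x:
  -- V = pieces ≥ p, U = the rest, result V ∘ U (p is first afterwards)
  rotate : Word n → Fin n → Word n → Word n
  rotate pre x post =
    let r = splitUp (x ∷ []) post in
    (x ∷ Data.Product.proj₁ r) ++ (pre ++ Data.Product.proj₂ r)

  rotate₀ : Word n → Word n
  rotate₀ []       = []
  rotate₀ (x ∷ w) = rotate [] x w

  iter : ℕ → (Word n → Word n) → Word n → Word n
  iter zero    f w = w
  iter (suc m) f w = f (iter m f w)

  -- stable: the first piece is the unique minimal piece (U is empty)
  IsStable : Word n → Set
  IsStable []      = Data.Empty.⊥  where import Data.Empty
  IsStable (x ∷ w) = Data.Product.proj₂ (splitUp (x ∷ []) w) ≡ []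

  -- K represents A_p^∞(H), H represented by w = pre ++ x ∷ post, p = x
  RotatesTo : Word n → Fin n → Word n → Word n → Set
  RotatesTo pre x post K =
    ∃[ m ] (IsStable (iter m rotate₀ (rotate pre x post))
            × (iter m rotate₀ (rotate pre x post) ~ K))

  InRotClass : Word n → Word n → Set
  InRotClass w K = ∃[ pre ] ∃[ x ] ∃[ post ] (w ≡ pre ++ x ∷ post × RotatesTo pre x post K)

  data _≤lex_ : Word n → Word n → Set where
    []≤  : ∀ {w} → [] ≤lex w
    <≤   : ∀ {x y w w′} → x <ᶠ y → (x ∷ w) ≤lex (y ∷ w′)
    ≡≤   : ∀ {x w w′} → w ≤lex w′ → (x ∷ w) ≤lex (x ∷ w′)

  IsStandardWord : Word n → Word n → Set
  IsStandardWord s w = s ~ w × (∀ w′ → w′ ~ w → w′ ≤lex s)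

  _≤heap_ : Word n → Word n → Set
  w ≤heap w′ = ∀ s s′ → IsStandardWord s w → IsStandardWord s′ w′ → s ≤lex s′

  IsLyndon : Word n → Set
  IsLyndon w = IsPyramid w × ¬ IsPeriodic w × (∀ K → InRotClass w K → w ≤heap K)

-- Counting equivalence classes: N is the number of ≈-classes of
-- elements of A satisfying P (P assumed ≈-invariant).

HasClassCount : (A : Set) → (A → Set) → (A → A → Set) → ℕ → Set
HasClassCount A P _≈_ N =
  Σ (Fin N → A) λ f →
      (∀ i → P (f i))
    × (∀ i j → f i ≈ f j → i ≡ j)
    × (∀ a → P a → ∃[ i ] (a ≈ f i))

Odd : ℕ → Set
Odd m = ∃[ j ] m ≡ suc (2 * j)

module _ {n : ℕ} (G : SimpleGraph n) (λ′ : List ℕ) where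

  part : Fin (length λ′) → ℕ
  part = lookup λ′

  -- assignments i ↦ L_i (each L_i given by a word representing the heap)
  Assignment : Set
  Assignment = Fin (length λ′) → Word n

  SameMultiset : Assignment → Assignment → Set
  SameMultiset L L′ =
    Σ (Permutation′ (length λ′)) λ σ →
      (∀ i → part (σ ⟨$⟩ʳ i) ≡ part i) × (∀ i → _~_ G (L i) (L′ (σ ⟨$⟩ʳ i)))

  Good : Assignment → Set
  Good L =
      (∀ i → IsLyndon G (L i))
    × (∀ (v : Fin n) → ∃[ i ] (v ∈ L i))
    × (∀ i → length (L i) ≡ part i ⊎ (Odd (length (L i)) × part i ≡ 2 * length (L i)))
    × (∀ i i′ → i ≢ i′ → part i ≡ part i′ → Odd (part i) → ¬ _~_ G (L i) (L i′))

{-# OPTIONS --safe #-}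
-- For W ⊆ V let I_W(t) = Σ t^|S|, the sum over the stable sets S ⊆ W. Reading a colouring one colour
-- at a time, and using inclusion-exclusion to force every vertex to receive a colour,
--   X̄_G = Σ_W (−1)^|V∖W| ∏ᵢ I_W(xᵢ).
-- By Cartier and Foata I_W(−t) is inverse to the generating series of the heaps on W. Represented by
-- their lexicographically largest (standard) words, the heaps are the nonincreasing products of
-- standard Lyndon words, so I_W(t) = ∏_L (1 − (−t)^|L|) over the Lyndon heaps L on W. Since
-- 1 + p̄'_l = ∏ᵢ 1/(1 − xᵢˡ), a heap L with l = |L| contributes 1/(1 + p̄'_l) if l is even, and
-- (1 + p̄'_l)/(1 + p̄'_2l) if l is odd, because 1 + tˡ = (1 − t²ˡ)/(1 − tˡ). Expanding these factors
-- yields the multisets satisfying (ii) and (iii), with one sign for each even part, and the sum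
-- over W imposes (i). The coefficients are determined by X̄_G because [x^μ] p̄'_ν ≠ 0 with ν ≠ μ
-- forces |ν| < |μ|, or |ν| = |μ| and ℓ(ν) > ℓ(μ).
--
-- A Lyndon heap is a heap whose standard word w is a Lyndon word. If w is one, each heap K of the
-- rotation class satisfies w T = T K for some heap T, and comparing the standard words of wᵐ T and
-- T Kᵐ for large m shows that the word of K is at least w. Conversely, if w = u v is the standard
-- word of a Lyndon heap with least suffix v, then v u is the standard word of a rotation, so
-- u v ≤ v u, which makes u a power of v; as w is aperiodic, u is empty.
module Submission where

open import Defs hiding (sym)
open import Algebra.Bundles using (CommutativeRing; CommutativeMonoid)
import Algebra.Properties.CommutativeMonoid.Sum as FinSum
import Algebra.Properties.CommutativeSemigroup as CSProps
import Algebra.Properties.Ring as RingProps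
import Data.Bool as Bool
open import Data.Bool using (Bool; true; false; _∨_; _∧_; not; if_then_else_)
open import Data.Bool.ListAction using (any; all)
open import Data.Bool.Properties using (T?)
import Data.Bool.Properties as Boolₚ
open import Data.Empty using (⊥; ⊥-elim)
open import Data.Fin using (Fin; zero; suc; toℕ; cast) renaming (_<_ to _<ᶠ_; _≤_ to _≤ᶠ_)
open import Data.Fin.Permutation using (Permutation; Permutation′; _⟨$⟩ʳ_; _∘ₚ_; cast-id)
open import Data.Fin.Properties using () renaming (_≟_ to _≟ᶠ_)
import Data.Fin.Properties as Finₚ
open import Data.Integer using (+_) renaming (_+_ to _ℤ+_)
import Data.Integer.Properties as ℤₚ
open import Data.List using (List; []; _∷_; _++_; length; replicate; concat; foldl; map; concatMap; filter;
  filterᵇ; upTo; zipWith; applyUpTo; allFin; tabulate; take; cartesianProductWith; cartesianProduct; downFrom;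
  lookup)
open import Data.List.Membership.DecPropositional using () renaming (_∈?_ to mem?)
open import Data.List.Membership.Propositional using (_∈_; _∉_; lose; find)
open import Data.List.Membership.Propositional.Properties using (∈-++⁺ˡ; ∈-++⁺ʳ; ∈-++⁻; ∈-∃++; ∈-map⁺; ∈-map⁻;
  ∈-filter⁺; ∈-filter⁻; ∈-upTo⁺; ∈-upTo⁻; ∈-concatMap⁻; ∈-applyUpTo⁻; ∈-cartesianProductWith⁺;
  ∈-cartesianProductWith⁻; ∈-allFin; ∈-downFrom⁺; ∈-cartesianProduct⁺; ∈-cartesianProduct⁻; ∈-concatMap⁺;
  ∈-lookup; ∈-tabulate⁺; ∈-tabulate⁻)
open import Data.List.Membership.Propositional.Properties.WithK using (unique∧set⇒bag)
import Data.List.Properties as Listₚ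
open import Data.List.Relation.Binary.BagAndSetEquality using (∼bag⇒↭)
import Data.List.Relation.Binary.Permutation.Homogeneous as PermSetoid
open import Data.List.Relation.Binary.Permutation.Propositional using (_↭_; ↭-refl; ↭-trans; ↭-sym; prep;
  swap; ↭⇒↭ₛ; ↭-reflexive)
import Data.List.Relation.Binary.Permutation.Propositional.Properties as Permₚ
import Data.List.Relation.Binary.Permutation.Setoid.Properties as PermSetoidₚ
import Data.List.Relation.Binary.Pointwise as Pointwise
open import Data.List.Relation.Unary.All using (All; []; _∷_)
import Data.List.Relation.Unary.All as All
import Data.List.Relation.Unary.All.Properties as Allₚ
open import Data.List.Relation.Unary.AllPairs using (AllPairs; []; _∷_)
import Data.List.Relation.Unary.AllPairs as AllPairs
import Data.List.Relation.Unary.AllPairs.Properties as AllPairsₚ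
open import Data.List.Relation.Unary.Any using (here; there; satisfied; Any; any?; index)
import Data.List.Relation.Unary.Any as Any
import Data.List.Relation.Unary.Any.Properties as Anyₚ
open import Data.List.Relation.Unary.Linked using (Linked; []; [-]; _∷_)
open import Data.List.Relation.Unary.Linked.Properties using (Linked⇒AllPairs; AllPairs⇒Linked)
import Data.List.Relation.Unary.Sorted.TotalOrder.Properties as Sortedₚ
open import Data.List.Relation.Unary.Unique.Propositional using (Unique)
import Data.List.Relation.Unary.Unique.Propositional.Properties as Uniqueₚ
import Data.List.Sort as Sort
open import Data.Nat using (ℕ; zero; suc; z≤n; s≤s; _∸_; _≡ᵇ_; _≤ᵇ_; _⊓_) renaming (_≤_ to _≤ℕ_; _<_ to _<ℕ_;
  _+_ to _+ℕ_; _*_ to _*ℕ_; _≤?_ to _≤ℕ?_)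
import Data.Nat.DivMod as DivMod
open import Data.Nat.Divisibility using (_∣?_)
import Data.Nat.Divisibility as Divₚ
open import Data.Nat.ListAction using (sum)
import Data.Nat.Properties as ℕₚ
open import Data.Product using (∃-syntax; _×_; _,_; proj₁; proj₂)
open import Data.Rational using (ℚ; 0ℚ; 1ℚ; toℚᵘ; 1/_; NonZero; ≢-nonZero) renaming (_+_ to _+ℚ_; _*_ to _*ℚ_;
  -_ to -ℚ_)
import Data.Rational.Properties as ℚₚ
open import Data.Rational.Unnormalised using (mkℚᵘ; *≡*)
import Data.Rational.Unnormalised.Properties as ℚᵘₚ
open import Data.Sum using (_⊎_; inj₁; inj₂)
open import Data.Unit using (⊤; tt)
open import Data.Vec using (Vec; fromList) renaming ([] to v[]; _∷_ to _v∷_; lookup to vlookup; map to vmap;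
  zipWith to vzipWith)
import Data.Vec.Properties as Vecₚ
open import Function using (_∘_; id; case_of_; mk⇔; Equivalence)
open import Level using (0ℓ)
open import Relation.Binary.Bundles using (DecTotalOrder)
open import Relation.Binary.Construct.Closure.ReflexiveTransitive using (ε; _◅_; _◅◅_; gmap; reverse)
open import Relation.Binary.Construct.Flip.EqAndOrd using () renaming (totalOrder to flipOrder)
open import Relation.Binary.Definitions using (tri<; tri≈; tri>)
import Relation.Binary.PropositionalEquality as ≡
open import Relation.Binary.PropositionalEquality using (_≡_; _≢_; refl; sym; trans; cong; cong₂; subst;
  subst₂)
import Relation.Binary.Reasoning.Setoid as SetoidReasoning
open import Relation.Binary.Structures using (IsEquivalence)
open import Relation.Nullary using (¬_; Dec; yes; no; does)
open import Relation.Nullary.Decidable using (_×-dec_; _→-dec_; ¬?; _⊎-dec_; does-⇔; dec-true; dec-false)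
open import Relation.Unary using (Decidable)

-- Infinite products over Lyndon heaps never occur. A coefficient of degree at most `d` is computed
-- in the quotient `truncRing k d` of the power series in `k` variables, where Lyndon words of
-- length at most `d` suffice and the inverse of `1 + p̄'_l` is a finite geometric sum; at the end
-- `d` is the size of the partition. Heaps are handled through words alone. `Std` is a decidable
-- local test for standard words, and adding a maximal piece is the explicit insertion `ins`, so the
-- heaps of a given size form a finite duplicate-free list, and the recursions for their series are
-- bijections of lists. One weight serves all subsets `W`: a letter weighs `-1` inside `W` and `0`
-- outside, which replaces `t` by `-t` and restricts to the heaps on `W` at once. The Lyndon words
-- are thus taken once, on all of `V`, and `W` enters only through the coefficient of each multiset.
-- Rotation classes are defined by iterated rotations. That the iteration stabilizes is proved here
-- too; it serves the converse half, where rotations to every letter have to be produced.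

-- Heaps through words: commutation, minimal and maximal pieces, standard words.

module HeapWords {n : ℕ} (G : SimpleGraph n) where

  infix 4 _≈ʰ_ _⊑_ _∥_ _∥*_

  _≈ʰ_ : Word n → Word n → Set
  _≈ʰ_ = _~_ G

  _⊑_ : Word n → Word n → Set
  _⊑_ = _≤lex_ G

  _∥_ : Fin n → Fin n → Set
  x ∥ y = conn G x y ≡ false

  _∥*_ : Fin n → Word n → Set
  x ∥* w = All (x ∥_) w

  conn-refl : ∀ x → conn G x x ≡ true
  conn-refl x with x ≟ᶠ x
  ... | yes _ = refl
  ... | no x≢x = ⊥-elim (x≢x refl)

  conn-sym : ∀ x y → conn G x y ≡ conn G y x
  conn-sym x y with x ≟ᶠ y | y ≟ᶠ x
  ... | yes _ | yes _ = refl
  ... | no _ | no _ = SimpleGraph.sym G x y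
  ... | yes p | no q = ⊥-elim (q (sym p))
  ... | no p | yes q = ⊥-elim (p (sym q))

  ∥-sym : ∀ {x y} → x ∥ y → y ∥ x
  ∥-sym {x} {y} p = trans (conn-sym y x) p

  ∥-irrefl : ∀ {x} → ¬ (x ∥ x)
  ∥-irrefl {x} p = case trans (sym (conn-refl x)) p of λ ()

  ∥⇒≢ : ∀ {x y} → x ∥ y → x ≢ y
  ∥⇒≢ p refl = ∥-irrefl p

  ∥⇒¬adj : ∀ {x y} → x ∥ y → adj G x y ≡ false
  ∥⇒¬adj {x} {y} p with x ≟ᶠ y
  ∥⇒¬adj () | yes _
  ... | no _ = p

  ¬adj⇒∥ : ∀ {x y} → x ≢ y → adj G x y ≡ false → x ∥ y
  ¬adj⇒∥ {x} {y} x≢y p with x ≟ᶠ y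
  ... | yes q = ⊥-elim (x≢y q)
  ... | no _ = p

  _∥?_ : ∀ x y → Dec (x ∥ y)
  x ∥? y with conn G x y
  ... | true = no λ ()
  ... | false = yes refl

  _∥*?_ : ∀ x w → Dec (x ∥* w)
  x ∥*? w = All.all? (x ∥?_) w

  swap-∥ : ∀ {x y w} → x ∥ y → Swap G (x ∷ y ∷ w) (y ∷ x ∷ w)
  swap-∥ p = here (∥⇒≢ p) (∥⇒¬adj p)

  swap-sym : ∀ {w v} → Swap G w v → Swap G v w
  swap-sym (here x≢y p) = here (x≢y ∘ sym) (trans (SimpleGraph.sym G _ _) p)
  swap-sym (there s) = there (swap-sym s)

  ~-sym : ∀ {w v} → w ≈ʰ v → v ≈ʰ w
  ~-sym = reverse swap-sym

  ~-reflexive : ∀ {w v} → w ≡ v → w ≈ʰ v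
  ~-reflexive refl = ε

  ~-∷ : ∀ {x w v} → w ≈ʰ v → x ∷ w ≈ʰ x ∷ v
  ~-∷ = gmap (_ ∷_) there

  ~-++ˡ : ∀ u {w v} → w ≈ʰ v → u ++ w ≈ʰ u ++ v
  ~-++ˡ [] p = p
  ~-++ˡ (x ∷ u) p = ~-∷ (~-++ˡ u p)

  swap-++ʳ : ∀ u {w v} → Swap G w v → Swap G (w ++ u) (v ++ u)
  swap-++ʳ u (here x≢y p) = here x≢y p
  swap-++ʳ u (there s) = there (swap-++ʳ u s)

  ~-++ʳ : ∀ u {w v} → w ≈ʰ v → w ++ u ≈ʰ v ++ u
  ~-++ʳ u = gmap (_++ u) (swap-++ʳ u)

  ~-++ : ∀ {w v w′ v′} → w ≈ʰ v → w′ ≈ʰ v′ → w ++ w′ ≈ʰ v ++ v′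
  ~-++ {v = v} {w′ = w′} p q = ~-++ʳ w′ p ◅◅ ~-++ˡ v q

  ∷-move : ∀ {b} u {z} → b ∥* u → b ∷ u ++ z ≈ʰ u ++ b ∷ z
  ∷-move [] [] = ε
  ∷-move (c ∷ u) (p ∷ ps) = swap-∥ p ◅ ~-∷ (∷-move u ps)

  swap⇒↭ : ∀ {w v} → Swap G w v → w ↭ v
  swap⇒↭ (here _ _) = swap _ _ ↭-refl
  swap⇒↭ (there s) = prep _ (swap⇒↭ s)

  ≈⇒↭ : ∀ {w v} → w ≈ʰ v → w ↭ v
  ≈⇒↭ ε = ↭-refl
  ≈⇒↭ (s ◅ p) = ↭-trans (swap⇒↭ s) (≈⇒↭ p)

  ~-length : ∀ {w v} → w ≈ʰ v → length w ≡ length v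
  ~-length p = Permₚ.↭-length (≈⇒↭ p)

  ~-∈ : ∀ {w v x} → w ≈ʰ v → x ∈ w → x ∈ v
  ~-∈ p = Permₚ.∈-resp-↭ (≈⇒↭ p)

  ⊑-refl : ∀ {w} → w ⊑ w
  ⊑-refl {[]} = []≤
  ⊑-refl {x ∷ w} = ≡≤ ⊑-refl

  ⊑-reflexive : ∀ {w v} → w ≡ v → w ⊑ v
  ⊑-reflexive refl = ⊑-refl

  ⊑-trans : ∀ {u v w} → u ⊑ v → v ⊑ w → u ⊑ w
  ⊑-trans []≤ _ = []≤
  ⊑-trans (<≤ p) (<≤ q) = <≤ (ℕₚ.<-trans p q)
  ⊑-trans (<≤ p) (≡≤ q) = <≤ p
  ⊑-trans (≡≤ p) (<≤ q) = <≤ q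
  ⊑-trans (≡≤ p) (≡≤ q) = ≡≤ (⊑-trans p q)

  ⊑-antisym : ∀ {u v} → u ⊑ v → v ⊑ u → u ≡ v
  ⊑-antisym []≤ []≤ = refl
  ⊑-antisym (<≤ p) (<≤ q) = ⊥-elim (ℕₚ.<-asym p q)
  ⊑-antisym (<≤ p) (≡≤ q) = ⊥-elim (ℕₚ.<-irrefl refl p)
  ⊑-antisym (≡≤ p) (<≤ q) = ⊥-elim (ℕₚ.<-irrefl refl q)
  ⊑-antisym (≡≤ p) (≡≤ q) = cong (_ ∷_) (⊑-antisym p q)

  ⊑-total : ∀ u v → u ⊑ v ⊎ v ⊑ u
  ⊑-total [] v = inj₁ []≤
  ⊑-total (x ∷ u) [] = inj₂ []≤
  ⊑-total (x ∷ u) (y ∷ v) with Finₚ.<-cmp x y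
  ... | tri< p _ _ = inj₁ (<≤ p)
  ... | tri> _ _ p = inj₂ (<≤ p)
  ... | tri≈ _ refl _ with ⊑-total u v
  ...   | inj₁ p = inj₁ (≡≤ p)
  ...   | inj₂ p = inj₂ (≡≤ p)

  _≟ʷ_ : (u v : Word n) → Dec (u ≡ v)
  _≟ʷ_ = Listₚ.≡-dec _≟ᶠ_

  _⊑?_ : ∀ u v → Dec (u ⊑ v)
  u ⊑? v with ⊑-total u v
  ... | inj₁ p = yes p
  ... | inj₂ p with u ≟ʷ v
  ...   | yes refl = yes p
  ...   | no u≢v = no λ q → u≢v (⊑-antisym q p)

  ⊑-++ : ∀ u v → u ⊑ u ++ v
  ⊑-++ [] v = []≤
  ⊑-++ (x ∷ u) v = ≡≤ (⊑-++ u v)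

  ++-⊑⁻ : ∀ u {v w} → u ++ v ⊑ u ++ w → v ⊑ w
  ++-⊑⁻ [] p = p
  ++-⊑⁻ (x ∷ u) (<≤ p) = ⊥-elim (ℕₚ.<-irrefl refl p)
  ++-⊑⁻ (x ∷ u) (≡≤ p) = ++-⊑⁻ u p

  ⊑-head : ∀ {x y u v} → x ∷ u ⊑ y ∷ v → x ≤ᶠ y
  ⊑-head (<≤ p) = ℕₚ.<⇒≤ p
  ⊑-head (≡≤ p) = ℕₚ.≤-refl

  ⊑-trunc : ∀ {u v} w → length u ≡ length v → u ⊑ v ++ w → u ⊑ v
  ⊑-trunc {[]} w e p = []≤
  ⊑-trunc {x ∷ u} {y ∷ v} w e (<≤ p) = <≤ p
  ⊑-trunc {x ∷ u} {y ∷ v} w e (≡≤ p) = ≡≤ (⊑-trunc w (ℕₚ.suc-injective e) p)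

  -- Front b w w′: some occurrence of b is a minimal piece of w, and w′ is w without it.
  data Front (b : Fin n) : Word n → Word n → Set where
    fhere  : ∀ {w} → Front b (b ∷ w) w
    fthere : ∀ {c w w′} → b ∥ c → Front b w w′ → Front b (c ∷ w) (c ∷ w′)

  Front⇒∈ : ∀ {b w w′} → Front b w w′ → b ∈ w
  Front⇒∈ fhere = here refl
  Front⇒∈ (fthere p f) = there (Front⇒∈ f)

  -- Minimal pieces belong to the heap, not to the word: a swap either moves the chosen occurrence
  -- past an independent letter or happens among the other letters.
  Front-swap : ∀ {b w v w′} → Swap G w v → Front b w w′ → ∃[ v′ ] (Front b v v′ × w′ ≈ʰ v′)
  Front-swap (here x≢y p) fhere = _ , fthere (¬adj⇒∥ x≢y p) fhere , ε
  Front-swap (here x≢y p) (fthere q fhere) = _ , fhere , ε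
  Front-swap (here x≢y p) (fthere q (fthere r f)) = _ , fthere r (fthere q f) , (here x≢y p ◅ ε)
  Front-swap (there s) fhere = _ , fhere , (s ◅ ε)
  Front-swap (there s) (fthere q f) with Front-swap s f
  ... | v′ , g , e = _ , fthere q g , ~-∷ e

  Front-≈ : ∀ {b w v w′} → w ≈ʰ v → Front b w w′ → ∃[ v′ ] (Front b v v′ × w′ ≈ʰ v′)
  Front-≈ ε f = _ , f , ε
  Front-≈ (s ◅ p) f with Front-swap s f
  ... | _ , g , e with Front-≈ p g
  ...   | v′ , h , e′ = v′ , h , e ◅◅ e′

  Front-++ˡ : ∀ {b w w′} u → Front b w w′ → Front b (w ++ u) (w′ ++ u)
  Front-++ˡ u fhere = fhere
  Front-++ˡ u (fthere p f) = fthere p (Front-++ˡ u f)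

  Front-++⁻ : ∀ {b w′} u {v} → Front b (u ++ v) w′ → (∃[ u′ ] Front b u u′) ⊎ (b ∥* u × ∃[ v′ ] Front b v v′)
  Front-++⁻ [] f = inj₂ ([] , _ , f)
  Front-++⁻ (x ∷ u) fhere = inj₁ (_ , fhere)
  Front-++⁻ (x ∷ u) (fthere p f) with Front-++⁻ u f
  ... | inj₁ (_ , g) = inj₁ (_ , fthere p g)
  ... | inj₂ (ps , g) = inj₂ (p ∷ ps , g)

  front? : ∀ b w → Dec (∃[ w′ ] Front b w w′)
  front? b [] = no λ ()
  front? b (c ∷ w) with b ≟ᶠ c
  ... | yes refl = yes (w , fhere)
  ... | no b≢c with b ∥? c | front? b w
  ...   | yes p | yes (w′ , f) = yes (c ∷ w′ , fthere p f)
  ...   | no ¬p | _ = no λ { (_ , fhere) → b≢c refl ; (_ , fthere p f) → ¬p p }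
  ...   | yes p | no ¬f = no λ { (_ , fhere) → b≢c refl ; (_ , fthere p f) → ¬f (_ , f) }

  -- Local form of being the lexicographically largest word of a heap.
  Std : Word n → Set
  Std [] = ⊤
  Std (a ∷ w) = (∀ b → (∃[ w′ ] Front b (a ∷ w) w′) → b ≤ᶠ a) × Std w

  Std? : ∀ w → Dec (Std w)
  Std? [] = yes tt
  Std? (a ∷ w) = Finₚ.all? (λ b → front? b (a ∷ w) →-dec (b Finₚ.≤? a)) ×-dec Std? w

  -- A word of the heap starts with the letter of some minimal piece, which is at most the first
  -- letter of `s`. If the two letters agree, so do the pieces, and the comparison goes on with the
  -- rest.
  Std⇒max : ∀ s {w} → Std s → w ≈ʰ s → w ⊑ s
  Std⇒max s {[]} S e = []≤
  Std⇒max [] {x ∷ w} S e = case ~-length e of λ ()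
  Std⇒max (y ∷ s) {x ∷ w} (m , S) e with Front-≈ e fhere
  ... | s′ , f , e′ with Finₚ.<-cmp x y
  ...   | tri< p _ _ = <≤ p
  ...   | tri> _ _ p = ⊥-elim (ℕₚ.<⇒≱ p (m x (s′ , f)))
  Std⇒max (y ∷ s) {x ∷ w} (m , S) e | s′ , fhere , e′ | tri≈ _ refl _ = ≡≤ (Std⇒max s S e′)
  Std⇒max (y ∷ s) {x ∷ w} (m , S) e | s′ , fthere p f , e′ | tri≈ _ refl _ = ⊥-elim (∥-irrefl p)

  Std-unique : ∀ {s t} → Std s → Std t → s ≈ʰ t → s ≡ t
  Std-unique {s} {t} S S′ e = ⊑-antisym (Std⇒max t S′ e) (Std⇒max s S (~-sym e))

  Std⇒IsStandard : ∀ {s w} → Std s → s ≈ʰ w → IsStandardWord G s w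
  Std⇒IsStandard S e = e , λ w′ e′ → Std⇒max _ S (e′ ◅◅ ~-sym e)

  Std-++⁻ˡ : ∀ u v → Std (u ++ v) → Std u
  Std-++⁻ˡ [] v S = tt
  Std-++⁻ˡ (x ∷ u) v (m , S) = (λ { b (_ , f) → m b (_ , Front-++ˡ v f) }) , Std-++⁻ˡ u v S

  Std-++⁻ʳ : ∀ u v → Std (u ++ v) → Std v
  Std-++⁻ʳ [] v S = S
  Std-++⁻ʳ (x ∷ u) v (m , S) = Std-++⁻ʳ u v S

  -- A heap whose minimal pieces all carry the letter a; for a nonempty heap, a pyramid.
  OneMin : Fin n → Word n → Set
  OneMin a w = ∀ b → (∃[ w′ ] Front b w w′) → b ≡ a

  OneMin-[] : ∀ {a} → OneMin a []
  OneMin-[] b (_ , ())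

  OneMin-≈ : ∀ {a w v} → w ≈ʰ v → OneMin a w → OneMin a v
  OneMin-≈ e o b (_ , f) with Front-≈ (~-sym e) f
  ... | _ , g , _ = o b (_ , g)

  OneMin-++⁻ : ∀ {a} u v → OneMin a (u ++ v) → OneMin a u
  OneMin-++⁻ u v o b (_ , f) = o b (_ , Front-++ˡ v f)

  OneMin-++⁺ : ∀ {a} u v → OneMin a u → OneMin a v → OneMin a (u ++ v)
  OneMin-++⁺ u v o o′ b (_ , f) with Front-++⁻ u f
  ... | inj₁ g = o b g
  ... | inj₂ (_ , g) = o′ b g

  -- A minimal piece of a suffix of `u` followed by `v` comes from `u`, where it is bounded already,
  -- or from `v`, where its letter `a` is at most every letter of `u`.
  Std-++⁺ : ∀ {a} u v → Std u → Std v → OneMin a v → All (a ≤ᶠ_) u → Std (u ++ v)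
  Std-++⁺ [] v S S′ o l = S′
  Std-++⁺ {a} (c ∷ u) v (m , S) S′ o (a≤c ∷ l) = bound , Std-++⁺ u v S S′ o l
    where
    bound : ∀ b → (∃[ w′ ] Front b (c ∷ u ++ v) w′) → b ≤ᶠ c
    bound b (_ , f) with Front-++⁻ (c ∷ u) f
    ... | inj₁ g = m b g
    ... | inj₂ (_ , g) rewrite o b g = a≤c

  infixr 8 _^ʷ_
  _^ʷ_ : Word n → ℕ → Word n
  w ^ʷ m = concat (replicate m w)

  OneMin-^ : ∀ {a} w m → OneMin a w → OneMin a (w ^ʷ m)
  OneMin-^ w zero o = OneMin-[]
  OneMin-^ w (suc m) o = OneMin-++⁺ w (w ^ʷ m) o (OneMin-^ w m o)

  Std-^ : ∀ {a} w m → Std w → OneMin a w → All (a ≤ᶠ_) w → Std (w ^ʷ m)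
  Std-^ w zero S o l = tt
  Std-^ w (suc m) S o l = Std-++⁺ w (w ^ʷ m) S (Std-^ w m S o l) (OneMin-^ w m o) l

  ~-^ : ∀ {w v} m → w ≈ʰ v → w ^ʷ m ≈ʰ v ^ʷ m
  ~-^ zero e = ε
  ~-^ (suc m) e = ~-++ e (~-^ m e)

  -- Back v w K: the last v of w is a maximal piece, and K is w without it.
  data Back (v : Fin n) : Word n → Word n → Set where
    bhere  : ∀ {w} → v ∥* w → Back v (v ∷ w) w
    bthere : ∀ {c w K} → Back v w K → Back v (c ∷ w) (c ∷ K)

  -- The new maximal piece goes to the first position where it commutes with the whole remainder and
  -- exceeds the next letter; any later position would violate `Std` at that letter.
  ins : Fin n → Word n → Word n
  ins v [] = v ∷ []
  ins v (c ∷ K) with (c Finₚ.<? v) ×-dec (v ∥*? (c ∷ K))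
  ... | yes _ = v ∷ c ∷ K
  ... | no _ = c ∷ ins v K

  Back-ins : ∀ v K → Back v (ins v K) K
  Back-ins v [] = bhere []
  Back-ins v (c ∷ K) with (c Finₚ.<? v) ×-dec (v ∥*? (c ∷ K))
  ... | yes (_ , p) = bhere p
  ... | no _ = bthere (Back-ins v K)

  Back⇒≈ : ∀ {v w K} → Back v w K → w ≈ʰ K ++ v ∷ []
  Back⇒≈ {v} {_} {K} (bhere p) = subst (λ z → v ∷ z ≈ʰ K ++ v ∷ []) (Listₚ.++-identityʳ K) (∷-move K p)
  Back⇒≈ (bthere b) = ~-∷ (Back⇒≈ b)

  Front-Back⁺ : ∀ {v w K b K′} → Back v w K → Front b K K′ → ∃[ w′ ] Front b w w′
  Front-Back⁺ (bhere ps) f = _ , fthere (∥-sym (All.lookup ps (Front⇒∈ f))) f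
  Front-Back⁺ (bthere B) fhere = _ , fhere
  Front-Back⁺ (bthere B) (fthere p f) = _ , fthere p (proj₂ (Front-Back⁺ B f))

  Front-Back⁻ : ∀ {v w K b w′} → Back v w K → Front b w w′ → (∃[ K′ ] Front b K K′) ⊎ (b ≡ v × v ∥* K)
  Front-Back⁻ (bhere ps) fhere = inj₂ (refl , ps)
  Front-Back⁻ (bhere ps) (fthere p f) = inj₁ (_ , f)
  Front-Back⁻ (bthere B) fhere = inj₁ (_ , fhere)
  Front-Back⁻ (bthere B) (fthere p f) with Front-Back⁻ B f
  ... | inj₁ (_ , g) = inj₁ (_ , fthere p g)
  ... | inj₂ (refl , ps) = inj₂ (refl , p ∷ ps)

  Back-Front : ∀ {v w K} → Back v w K → v ∥* K → ∃[ w′ ] Front v w w′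
  Back-Front (bhere _) ps = _ , fhere
  Back-Front (bthere B) (p ∷ ps) = _ , fthere p (proj₂ (Back-Front B ps))

  Std-Back : ∀ {v w K} → Std w → Back v w K → Std K
  Std-Back (m , S) (bhere _) = S
  Std-Back (m , S) (bthere B) = (λ { b (_ , f) → m b (Front-Back⁺ (bthere B) f) }) , Std-Back S B

  Std-ins : ∀ v K → Std K → Std (ins v K)
  Std-ins v [] S = (λ { b (_ , fhere) → ℕₚ.≤-refl }) , tt
  Std-ins v (c ∷ K) (m , S) with (c Finₚ.<? v) ×-dec (v ∥*? (c ∷ K))
  ... | yes (c<v , p) = (λ { b (_ , fhere) → ℕₚ.≤-refl ; b (_ , fthere _ f) → ℕₚ.≤-trans (m b (_ , f)) (ℕₚ.<⇒≤ c<v) }) , m , S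
  ... | no q = bound , Std-ins v K S
    where
    bound : ∀ b → (∃[ w′ ] Front b (c ∷ ins v K) w′) → b ≤ᶠ c
    bound b (_ , f) with Front-Back⁻ (bthere (Back-ins v K)) f
    ... | inj₁ g = m b g
    ... | inj₂ (refl , ps) = ℕₚ.≮⇒≥ λ c<v → q (c<v , ps)

  -- Standardness forces the last `v` to the position that `ins` chooses. With `Back-ins`, insertion
  -- and removal are therefore inverse to each other on standard words.
  ins-unique : ∀ {v w K} → Std w → Back v w K → w ≡ ins v K
  ins-unique {K = []} S (bhere []) = refl
  ins-unique {v} {K = c ∷ K} (m , S) (bhere (p ∷ ps)) with (c Finₚ.<? v) ×-dec (v ∥*? (c ∷ K))
  ... | yes _ = refl
  ... | no q = ⊥-elim (q (Finₚ.≤∧≢⇒< (m c (_ , fthere (∥-sym p) fhere)) (∥⇒≢ p ∘ sym) , p ∷ ps))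
  ins-unique {v} {K = c ∷ K} (m , S) (bthere B) with (c Finₚ.<? v) ×-dec (v ∥*? (c ∷ K))
  ... | yes (c<v , ps) = ⊥-elim (ℕₚ.<⇒≱ c<v (m v (Back-Front (bthere B) ps)))
  ... | no _ = cong (c ∷_) (ins-unique S B)

  -- `v` does not commute with its own occurrence in `B`, hence never moves into `A`.
  ins-++ : ∀ {v} A {B} → v ∈ B → ins v (A ++ B) ≡ A ++ ins v B
  ins-++ [] v∈ = refl
  ins-++ {v} (c ∷ A) {B} v∈ with (c Finₚ.<? v) ×-dec (v ∥*? (c ∷ A ++ B))
  ... | yes (_ , ps) = ⊥-elim (∥-irrefl (All.lookup ps (there (∈-++⁺ʳ A v∈))))
  ... | no _ = cong (c ∷_) (ins-++ A v∈)

  stdAcc : Word n → Word n → Word n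
  stdAcc = foldl (λ K v → ins v K)

  std : Word n → Word n
  std = stdAcc []

  Std-stdAcc : ∀ K w → Std K → Std (stdAcc K w)
  Std-stdAcc K [] S = S
  Std-stdAcc K (v ∷ w) S = Std-stdAcc (ins v K) w (Std-ins v K S)

  stdAcc-≈ : ∀ K w → stdAcc K w ≈ʰ K ++ w
  stdAcc-≈ K [] = ~-reflexive (sym (Listₚ.++-identityʳ K))
  stdAcc-≈ K (v ∷ w) = stdAcc-≈ (ins v K) w ◅◅ ~-++ʳ w (Back⇒≈ (Back-ins v K))
    ◅◅ ~-reflexive (Listₚ.++-assoc K (v ∷ []) w)

  Std-std : ∀ w → Std (std w)
  Std-std w = Std-stdAcc [] w tt

  std-≈ : ∀ w → std w ≈ʰ w
  std-≈ = stdAcc-≈ []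

  -- As every added letter already occurs in `B`, nothing moves into `A`. This keeps a power of a
  -- Lyndon word intact when further pieces are stacked on it.
  stdAcc-++ : ∀ A B w → All (_∈ B) w → stdAcc (A ++ B) w ≡ A ++ stdAcc B w
  stdAcc-++ A B [] [] = refl
  stdAcc-++ A B (v ∷ w) (v∈ ∷ ps) rewrite ins-++ A v∈ =
    stdAcc-++ A (ins v B) w (All.map (λ x∈ → ~-∈ (~-sym (Back⇒≈ (Back-ins v B))) (∈-++⁺ˡ x∈)) ps)

-- Lyndon heaps and Lyndon standard words.

module LyndonHeaps {n : ℕ} (G : SimpleGraph n) where
  open HeapWords G

  AllSuf : (Word n → Set) → Word n → Set
  AllSuf P [] = ⊤
  AllSuf P (x ∷ w) = P (x ∷ w) × AllSuf P w

  AllSuf-map : ∀ {P Q : Word n → Set} → (∀ {w} → P w → Q w) → ∀ w → AllSuf P w → AllSuf Q w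
  AllSuf-map f [] p = tt
  AllSuf-map f (x ∷ w) (p , ps) = f p , AllSuf-map f w ps

  AllSuf? : ∀ {P : Word n → Set} → (∀ w → Dec (P w)) → ∀ w → Dec (AllSuf P w)
  AllSuf? P? [] = yes tt
  AllSuf? P? (x ∷ w) = P? (x ∷ w) ×-dec AllSuf? P? w

  AllSuf-++ʳ : ∀ {P : Word n → Set} u v → AllSuf P (u ++ v) → AllSuf P v
  AllSuf-++ʳ [] v p = p
  AllSuf-++ʳ (x ∷ u) v (_ , p) = AllSuf-++ʳ u v p

  AllSuf-head : ∀ {P : Word n → Set} w → w ≢ [] → AllSuf P w → P w
  AllSuf-head [] w≢[] p = ⊥-elim (w≢[] refl)
  AllSuf-head (x ∷ w) _ (p , _) = p

  AllSuf-lookup : ∀ {P : Word n → Set} u v → v ≢ [] → AllSuf P (u ++ v) → P v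
  AllSuf-lookup u v v≢[] p = AllSuf-head v v≢[] (AllSuf-++ʳ u v p)

  -- Standard words that are Lyndon words; they represent the Lyndon heaps.
  LW : Word n → Set
  LW w = w ≢ [] × Std w × AllSuf (w ⊑_) w

  LW? : ∀ w → Dec (LW w)
  LW? [] = no λ p → proj₁ p refl
  LW? (x ∷ w) with Std? (x ∷ w) ×-dec AllSuf? ((x ∷ w) ⊑?_) (x ∷ w)
  ... | yes p = yes ((λ ()) , p)
  ... | no ¬p = no λ p → ¬p (proj₂ p)

  -- The least suffix is the last Lyndon factor; it is found by comparing the whole word with the
  -- least suffix of its tail.
  min-suffix : ∀ x w → ∃[ u ] ∃[ v ] (x ∷ w ≡ u ++ v × v ≢ [] × AllSuf (v ⊑_) (x ∷ w))
  min-suffix x [] = [] , x ∷ [] , refl , (λ ()) , ⊑-refl , tt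
  min-suffix x (y ∷ w) with min-suffix y w
  ... | u , v , e , v≢[] , p with ⊑-total (x ∷ y ∷ w) v
  ...   | inj₁ q = [] , x ∷ y ∷ w , refl , (λ ()) , ⊑-refl , AllSuf-map (⊑-trans q) (y ∷ w) p
  ...   | inj₂ q = x ∷ u , v , cong (x ∷_) e , v≢[] , q , p

  AllSuf⇒≥head : ∀ {a v} w → AllSuf ((a ∷ v) ⊑_) w → All (a ≤ᶠ_) w
  AllSuf⇒≥head [] p = []
  AllSuf⇒≥head (x ∷ w) (p , ps) = ⊑-head p ∷ AllSuf⇒≥head w ps

  -- Standardness bounds the letter of a minimal piece by `a` from above, and the Lyndon property
  -- bounds every letter by `a` from below, since each letter starts a suffix.
  LW-OneMin : ∀ {a w} → LW (a ∷ w) → OneMin a (a ∷ w)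
  LW-OneMin {a} {w} (_ , (m , _) , p) b (_ , f) =
    Finₚ.≤-antisym (m b (_ , f)) (All.lookup (AllSuf⇒≥head (a ∷ w) p) (Front⇒∈ f))

  suffix-LW : ∀ u v → v ≢ [] → Std (u ++ v) → AllSuf (v ⊑_) (u ++ v) → LW v
  suffix-LW u v v≢[] S p = v≢[] , Std-++⁻ʳ u v S , AllSuf-++ʳ u v p

  -- A comparison is decided either by exhausting `s` or at a strict inequality of letters, which
  -- survives every extension of both words.
  ⊑-prefix : ∀ {s v} → s ⊑ v → (∃[ r ] v ≡ s ++ r) ⊎ (∀ X Y → s ++ X ⊑ v ++ Y × s ++ X ≢ v ++ Y)
  ⊑-prefix {v = v} []≤ = inj₁ (v , refl)
  ⊑-prefix (<≤ p) = inj₂ λ X Y → <≤ p , λ e → ℕₚ.<-irrefl (cong toℕ (Listₚ.∷-injectiveˡ e)) p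
  ⊑-prefix (≡≤ p) with ⊑-prefix p
  ... | inj₁ (r , e) = inj₁ (r , cong (_ ∷_) e)
  ... | inj₂ q = inj₂ λ X Y → ≡≤ (proj₁ (q X Y)) , λ e → proj₂ (q X Y) (Listₚ.∷-injectiveʳ e)

  ++-≢ʳ : ∀ {s : Word n} v → s ≢ [] → v ≢ s ++ v
  ++-≢ʳ {[]} v s≢[] _ = s≢[] refl
  ++-≢ʳ {x ∷ s} v _ e = ℕₚ.m≢1+n+m (length v) (trans (cong length e) (cong suc (Listₚ.length-++ s)))

  -- The critical case is `v = s r` with `r` nonempty: cancelling `s` gives `r ⊑ v`, and minimality
  -- of `v` among its suffixes gives `r = v = s r`, which is impossible.
  ⊑-++-cancel : ∀ {v} s → s ≢ [] → AllSuf (v ⊑_) v → v ⊑ s ++ v → v ⊑ s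
  ⊑-++-cancel {v} s s≢[] p q with ⊑-total v s
  ... | inj₁ v⊑s = v⊑s
  ... | inj₂ s⊑v with ⊑-prefix s⊑v
  ...   | inj₁ ([] , refl) = ⊑-reflexive (Listₚ.++-identityʳ s)
  ...   | inj₁ (y ∷ r , refl) = ⊥-elim (++-≢ʳ (y ∷ r) s≢[]
            (⊑-antisym (++-⊑⁻ s q) (AllSuf-lookup s (y ∷ r) (λ ()) p)))
  ...   | inj₂ m = ⊥-elim (++-≢ʳ v s≢[] (⊑-antisym q
            (subst (s ++ v ⊑_) (Listₚ.++-identityʳ v) (proj₁ (m v [])))))

  AllSuf-++ˡ : ∀ {v} u → v ≢ [] → AllSuf (v ⊑_) (u ++ v) → AllSuf (v ⊑_) u
  AllSuf-++ˡ [] _ p = tt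
  AllSuf-++ˡ {v} (x ∷ u) v≢[] (p , ps) =
    ⊑-++-cancel (x ∷ u) (λ ()) (AllSuf-++ʳ u v ps) p , AllSuf-++ˡ u v≢[] ps

  AllSuf-++⁺ : ∀ {v} u → AllSuf (v ⊑_) u → AllSuf (v ⊑_) v → AllSuf (v ⊑_) (u ++ v)
  AllSuf-++⁺ [] p q = q
  AllSuf-++⁺ {v} (x ∷ u) (p , ps) q = ⊑-trans p (⊑-++ (x ∷ u) v) , AllSuf-++⁺ u ps q

  -- `v ⊑ u` because `u` is a suffix of itself. If this is decided at a letter, `v u` strictly
  -- precedes `u v`, against the hypothesis; otherwise `u = v r`, and cancelling `v` returns the
  -- same situation for `r`. `k` bounds the recursion.
  power-of-commuting : ∀ k {v} u → length u ≤ℕ k → v ≢ [] → AllSuf (v ⊑_) u → u ++ v ⊑ v ++ u → ∃[ i ] u ≡ v ^ʷ i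
  power-of-commuting k [] _ _ _ _ = 0 , refl
  power-of-commuting k {[]} (x ∷ u) _ v≢[] _ _ = ⊥-elim (v≢[] refl)
  power-of-commuting (suc k) {b ∷ v} (x ∷ u) (s≤s l) v≢[] (p , ps) q with ⊑-prefix p
  ... | inj₂ m = ⊥-elim (proj₂ (m (x ∷ u) (b ∷ v)) (⊑-antisym (proj₁ (m (x ∷ u) (b ∷ v))) q))
  ... | inj₁ (r , refl) with power-of-commuting k r
          (ℕₚ.≤-trans (subst (length r ≤ℕ_) (sym (Listₚ.length-++ v)) (ℕₚ.m≤n+m _ _)) l) v≢[]
          (AllSuf-++ʳ v r ps)
          (++-⊑⁻ (b ∷ v) (subst (_⊑ (b ∷ v) ++ (b ∷ v) ++ r) (Listₚ.++-assoc (b ∷ v) r (b ∷ v)) q))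
  ...   | i , e = suc i , cong ((b ∷ v) ++_) e

  ^ʷ-snoc : ∀ v i → v ^ʷ i ++ v ≡ v ^ʷ suc i
  ^ʷ-snoc v zero = sym (Listₚ.++-identityʳ v)
  ^ʷ-snoc v (suc i) = trans (Listₚ.++-assoc v (v ^ʷ i) v) (cong (v ++_) (^ʷ-snoc v i))

  any-false : ∀ {y} vs → any (λ x → conn G x y) vs ≡ false → y ∥* vs
  any-false [] _ = []
  any-false {y} (v ∷ vs) e with conn G v y in c
  ... | false = ∥-sym c ∷ any-false vs e

  any-false⁺ : ∀ {y vs} → y ∥* vs → any (λ x → conn G x y) vs ≡ false
  any-false⁺ [] = refl
  any-false⁺ {y} {v ∷ vs} (p ∷ ps) rewrite ∥-sym p = any-false⁺ ps

  any-true : ∀ {y} vs → any (λ x → conn G x y) vs ≡ true → ¬ (y ∥* vs)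
  any-true vs e p = case trans (sym e) (any-false⁺ p) of λ ()

  -- `seen` holds the letters already read, so the counter stays zero exactly when no piece of `w`
  -- is minimal once `seen` is put underneath.
  numMin≡0⇒ : ∀ {b w′} seen w → numMinAux G seen w ≡ 0 → Front b w w′ → ¬ (b ∥* seen)
  numMin≡0⇒ seen (y ∷ w) e f with any (λ x → conn G x y) seen in c
  numMin≡0⇒ seen (y ∷ w) e fhere | true = any-true seen c
  numMin≡0⇒ seen (y ∷ w) e (fthere p f) | true = λ ps → numMin≡0⇒ (y ∷ seen) w e f (p ∷ ps)

  numMin≡0⁺ : ∀ seen w → (∀ b → (∃[ w′ ] Front b w w′) → ¬ (b ∥* seen)) → numMinAux G seen w ≡ 0
  numMin≡0⁺ seen [] h = refl
  numMin≡0⁺ seen (y ∷ w) h with any (λ x → conn G x y) seen in c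
  ... | false = ⊥-elim (h y (_ , fhere) (any-false seen c))
  ... | true = numMin≡0⁺ (y ∷ seen) w λ { b (_ , f) (p ∷ ps) → h b (_ , fthere p f) ps }

  pyramid⇒OneMin : ∀ {a w} → IsPyramid G (a ∷ w) → OneMin a (a ∷ w)
  pyramid⇒OneMin e b (_ , fhere) = refl
  pyramid⇒OneMin {a} {w} e b (_ , fthere p f) = ⊥-elim (numMin≡0⇒ (a ∷ []) w (ℕₚ.suc-injective e) f (p ∷ []))

  OneMin⇒attached : ∀ {a w} → OneMin a (a ∷ w) → ∀ b → (∃[ w′ ] Front b w w′) → ¬ (b ∥* (a ∷ []))
  OneMin⇒attached o b (_ , f) (p ∷ []) with refl ← o b (_ , fthere p f) = ∥-irrefl p

  OneMin⇒pyramid : ∀ {a w} → OneMin a (a ∷ w) → IsPyramid G (a ∷ w)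
  OneMin⇒pyramid {a} {w} o = cong suc (numMin≡0⁺ (a ∷ []) w (OneMin⇒attached o))

  -- Spl vs w V U: V collects the pieces of w lying above some piece of vs, U the other pieces.
  data Spl : Word n → Word n → Word n → Word n → Set where
    snil : ∀ {vs} → Spl vs [] [] []
    sin  : ∀ {vs y w V U} → ¬ (y ∥* vs) → Spl (y ∷ vs) w V U → Spl vs (y ∷ w) (y ∷ V) U
    sout : ∀ {vs y w V U} → y ∥* vs → Spl vs w V U → Spl vs (y ∷ w) V (y ∷ U)

  splitUp-Spl : ∀ vs w → Spl vs w (proj₁ (splitUp G vs w)) (proj₂ (splitUp G vs w))
  splitUp-Spl vs [] = snil
  splitUp-Spl vs (y ∷ w) with any (λ x → conn G x y) vs in c
  ... | true = sin (any-true vs c) (splitUp-Spl (y ∷ vs) w)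
  ... | false = sout (any-false vs c) (splitUp-Spl vs w)

  Spl-unique : ∀ {vs w V U V′ U′} → Spl vs w V U → Spl vs w V′ U′ → V ≡ V′ × U ≡ U′
  Spl-unique snil snil = refl , refl
  Spl-unique (sin _ s) (sin _ t) with Spl-unique s t
  ... | refl , refl = refl , refl
  Spl-unique (sout _ s) (sout _ t) with Spl-unique s t
  ... | refl , refl = refl , refl
  Spl-unique (sin p _) (sout q _) = ⊥-elim (p q)
  Spl-unique (sout q _) (sin p _) = ⊥-elim (p q)

  Spl-above : ∀ {vs w V U} → Spl vs w V U → ∀ b → (∃[ V′ ] Front b V V′) → ¬ (b ∥* vs)
  Spl-above (sin p s) b (_ , fhere) = p
  Spl-above (sin p s) b (_ , fthere q f) = λ ps → Spl-above s b (_ , f) (q ∷ ps)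
  Spl-above (sout p s) b f = Spl-above s b f

  Spl-below : ∀ {vs w V U} → Spl vs w V U → All (_∥* vs) U
  Spl-below snil = []
  Spl-below (sin p s) = All.map All.tail (Spl-below s)
  Spl-below (sout p s) = p ∷ Spl-below s

  -- A piece of `U` is independent of all pieces of `V` to its left, so it can be moved in front of
  -- them.
  Spl-≈ : ∀ {vs w V U} → Spl vs w V U → w ≈ʰ U ++ V
  Spl-≈ snil = ε
  Spl-≈ (sin {U = U} p s) = ~-∷ (Spl-≈ s) ◅◅ ∷-move U (All.map (∥-sym ∘ All.head) (Spl-below s))
  Spl-≈ (sout p s) = ~-∷ (Spl-≈ s)

  Spl-all : ∀ {vs w} → (∀ b → (∃[ w′ ] Front b w w′) → ¬ (b ∥* vs)) → Spl vs w w []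
  Spl-all {w = []} h = snil
  Spl-all {w = y ∷ w} h = sin (h y (_ , fhere)) (Spl-all λ { b (_ , f) (p ∷ ps) → h b (_ , fthere p f) ps })

  -- Only the set of letters independent of `vs` matters; this is needed because a swap reorders the
  -- pieces collected so far.
  Spl-resp : ∀ {vs vs′ w V U} → (∀ {y} → y ∥* vs → y ∥* vs′) → (∀ {y} → y ∥* vs′ → y ∥* vs) → Spl vs w V U → Spl vs′ w V U
  Spl-resp h k snil = snil
  Spl-resp h k (sin p s) = sin (p ∘ k) (Spl-resp (λ { (q ∷ qs) → q ∷ h qs }) (λ { (q ∷ qs) → q ∷ k qs }) s)
  Spl-resp h k (sout p s) = sout (h p) (Spl-resp h k s)

  Spl-swap : ∀ {vs w w′ V U} → Swap G w w′ → Spl vs w V U → ∃[ V′ ] ∃[ U′ ] (Spl vs w′ V′ U′ × V ≈ʰ V′ × U ≈ʰ U′)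
  Spl-swap (here x≢y q) (sin p (sin p′ s)) = _ , _
    , sin (λ r → p′ (∥-sym (¬adj⇒∥ x≢y q) ∷ r))
        (sin (λ r → p (All.tail r)) (Spl-resp (λ { (a ∷ b ∷ c) → b ∷ a ∷ c }) (λ { (a ∷ b ∷ c) → b ∷ a ∷ c }) s))
    , (here x≢y q ◅ ε) , ε
  Spl-swap (here x≢y q) (sin p (sout (_ ∷ p′) s)) = _ , _ , sout p′ (sin p s) , ε , ε
  Spl-swap (here x≢y q) (sout p (sin p′ s)) = _ , _ , sin p′ (sout (¬adj⇒∥ x≢y q ∷ p) s) , ε , ε
  Spl-swap (here x≢y q) (sout p (sout p′ s)) = _ , _ , sout p′ (sout p s) , ε , (here x≢y q ◅ ε)
  Spl-swap (there t) (sin p s) with Spl-swap t s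
  ... | _ , _ , s′ , e , e′ = _ , _ , sin p s′ , ~-∷ e , e′
  Spl-swap (there t) (sout p s) with Spl-swap t s
  ... | _ , _ , s′ , e , e′ = _ , _ , sout p s′ , e , ~-∷ e′

  -- UpSet p w V U: for some occurrence of p in w, V is the word of the pieces above it and U that of the others.
  data UpSet (p : Fin n) : Word n → Word n → Word n → Set where
    uhere  : ∀ {w V U} → Spl (p ∷ []) w V U → UpSet p (p ∷ w) (p ∷ V) U
    uthere : ∀ {c w V U} → UpSet p w V U → UpSet p (c ∷ w) V (c ∷ U)

  UpSet-swap : ∀ {p w w′ V U} → Swap G w w′ → UpSet p w V U → ∃[ V′ ] ∃[ U′ ] (UpSet p w′ V′ U′ × V ≈ʰ V′ × U ≈ʰ U′)
  UpSet-swap (there t) (uhere s) with Spl-swap t s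
  ... | _ , _ , s′ , e , e′ = _ , _ , uhere s′ , ~-∷ e , e′
  UpSet-swap (there t) (uthere s) with UpSet-swap t s
  ... | _ , _ , s′ , e , e′ = _ , _ , uthere s′ , e , ~-∷ e′
  UpSet-swap (here x≢y q) (uthere (uthere s)) = _ , _ , uthere (uthere s) , ε , (here x≢y q ◅ ε)
  UpSet-swap (here x≢y q) (uthere (uhere s)) = _ , _ , uhere (sout (¬adj⇒∥ x≢y q ∷ []) s) , ε , ε
  UpSet-swap (here x≢y q) (uhere (sout p s)) = _ , _ , uthere (uhere s) , ε , ε
  UpSet-swap (here x≢y q) (uhere (sin p s)) = ⊥-elim (p (∥-sym (¬adj⇒∥ x≢y q) ∷ []))

  -- Rotation at a piece depends only on the heap. This carries a rotation read off the standard
  -- word over to the given representative, to which `InRotClass` refers.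
  UpSet-≈ : ∀ {p w w′ V U} → w ≈ʰ w′ → UpSet p w V U → ∃[ V′ ] ∃[ U′ ] (UpSet p w′ V′ U′ × V ≈ʰ V′ × U ≈ʰ U′)
  UpSet-≈ ε s = _ , _ , s , ε , ε
  UpSet-≈ (t ◅ ts) s with UpSet-swap t s
  ... | _ , _ , s′ , e , e′ with UpSet-≈ ts s′
  ...   | _ , _ , s″ , d , d′ = _ , _ , s″ , e ◅◅ d , e′ ◅◅ d′

  -- A suffix that is a pyramid consists of the pieces above its first letter, hence rotating there
  -- exchanges the two factors of the word.
  UpSet-suffix : ∀ {p v} u → OneMin p (p ∷ v) → UpSet p (u ++ p ∷ v) (p ∷ v) u
  UpSet-suffix [] o = uhere (Spl-all (OneMin⇒attached o))
  UpSet-suffix (x ∷ u) o = uthere (UpSet-suffix u o)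

  UpSet⇒rotate : ∀ {p w V U} → UpSet p w V U → ∃[ pre ] ∃[ post ] (w ≡ pre ++ p ∷ post × rotate G pre p post ≡ V ++ U)
  UpSet⇒rotate {p} s with decompose s
    where
    decompose : ∀ {p w V U} → UpSet p w V U →
      ∃[ pre ] ∃[ post ] ∃[ V₀ ] ∃[ U₀ ] (w ≡ pre ++ p ∷ post × V ≡ p ∷ V₀ × U ≡ pre ++ U₀ × Spl (p ∷ []) post V₀ U₀)
    decompose (uhere s) = [] , _ , _ , _ , refl , refl , refl , s
    decompose (uthere s) with decompose s
    ... | _ , _ , _ , _ , refl , refl , refl , s′ = _ ∷ _ , _ , _ , _ , refl , refl , refl , s′
  ... | pre , post , V₀ , U₀ , refl , refl , refl , s′ with Spl-unique s′ (splitUp-Spl (p ∷ []) post)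
  ...   | refl , refl = pre , post , refl , refl

  rotate-conjugate : ∀ pre x post → ∃[ V ] ∃[ U ] (pre ++ x ∷ post ≈ʰ U ++ x ∷ V × rotate G pre x post ≡ x ∷ V ++ U)
  rotate-conjugate pre x post with splitUp-Spl (x ∷ []) post
  ... | s with splitUp G (x ∷ []) post
  ...   | V , U = V , pre ++ U , split , refl
    where
    split : pre ++ x ∷ post ≈ʰ (pre ++ U) ++ x ∷ V
    split = ~-++ˡ pre (~-∷ (Spl-≈ s) ◅◅ ∷-move U (All.map (∥-sym ∘ All.head) (Spl-below s)))
      ◅◅ ~-reflexive (sym (Listₚ.++-assoc pre U (x ∷ V)))

  -- Conjugacy in the heap monoid in the form `w T = T K`, which composes along iterated rotations.
  -- `T⊆w` later allows `T` to be stacked on a power of `w` without disturbing it.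
  record Conj (w K₀ : Word n) : Set where
    field
      T     : Word n
      T⊆w   : All (_∈ w) T
      perm  : w ↭ K₀
      twist : w ++ T ≈ʰ T ++ K₀

  Conj-trans : ∀ {u v w} → Conj u v → Conj v w → Conj u w
  Conj-trans {u} {v} {w} c d = record
    { T = C.T ++ D.T
    ; T⊆w = Allₚ.++⁺ C.T⊆w (All.map (Permₚ.∈-resp-↭ (↭-sym C.perm)) D.T⊆w)
    ; perm = ↭-trans C.perm D.perm
    ; twist = ~-reflexive (sym (Listₚ.++-assoc u C.T D.T)) ◅◅ ~-++ʳ D.T C.twist
        ◅◅ ~-reflexive (Listₚ.++-assoc C.T v D.T) ◅◅ ~-++ˡ C.T D.twist ◅◅ ~-reflexive (sym (Listₚ.++-assoc C.T D.T w))
    }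
    where
    module C = Conj c
    module D = Conj d

  -- With `w = U V` and `K = V U`, the twist is `U V U` bracketed in two ways, so `T = U`.
  Conj-rotate : ∀ pre x post → Conj (pre ++ x ∷ post) (rotate G pre x post)
  Conj-rotate pre x post with rotate G pre x post | rotate-conjugate pre x post
  ... | _ | V , U , e , refl = record
    { T = U
    ; T⊆w = All.tabulate (λ y∈ → ~-∈ (~-sym e) (∈-++⁺ˡ y∈))
    ; perm = ↭-trans (≈⇒↭ e) (Permₚ.++-comm U (x ∷ V))
    ; twist = ~-++ʳ U e ◅◅ ~-reflexive (Listₚ.++-assoc U (x ∷ V) U)
    }

  iter-rotate : ∀ m x k → ∃[ k′ ] (iter G m (rotate₀ G) (x ∷ k) ≡ x ∷ k′ × Conj (x ∷ k) (x ∷ k′))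
  iter-rotate zero x k = k , refl , record { T = [] ; T⊆w = [] ; perm = ↭-refl ; twist = ~-reflexive (Listₚ.++-identityʳ (x ∷ k)) }
  iter-rotate (suc m) x k with iter G m (rotate₀ G) (x ∷ k) | iter-rotate m x k
  ... | _ | k′ , refl , c = _ , refl , Conj-trans c (Conj-rotate [] x k′)

  rotates-Conj : ∀ pre x post m → ∃[ k ] (iter G m (rotate₀ G) (rotate G pre x post) ≡ x ∷ k × Conj (pre ++ x ∷ post) (x ∷ k))
  rotates-Conj pre x post m with iter-rotate m x (proj₁ (splitUp G (x ∷ []) post) ++ pre ++ proj₂ (splitUp G (x ∷ []) post))
  ... | k , e , c = k , e , Conj-trans (Conj-rotate pre x post) c

  stable⇒OneMin : ∀ x k → IsStable G (x ∷ k) → OneMin x (x ∷ k)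
  stable⇒OneMin x k st b (_ , fhere) = refl
  stable⇒OneMin x k st b (_ , fthere p f) with splitUp G (x ∷ []) k | splitUp-Spl (x ∷ []) k | st
  ... | V , _ | s | refl = ⊥-elim (Spl-above s b (subst (λ z → ∃[ w′ ] Front b z w′) (all-above s) (_ , f)) (p ∷ []))
    where
    all-above : ∀ {vs w V} → Spl vs w V [] → w ≡ V
    all-above snil = refl
    all-above (sin _ s) = cong (_ ∷_) (all-above s)

  OneMin⇒stable : ∀ {x k} → OneMin x (x ∷ k) → IsStable G (x ∷ k)
  OneMin⇒stable {x} {k} o = sym (proj₂ (Spl-unique (Spl-all (OneMin⇒attached o)) (splitUp-Spl (x ∷ []) k)))

  -- The letters of `A` are read off from the left. Each finished copy of `w` uses up at least one
  -- of them, so `m` further copies suffice for `A` to end with a nonempty suffix of `w` still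
  -- ahead.
  peel : ∀ {w z X} A u v m → v ≢ [] → w ≡ u ++ v → length A ≤ℕ m → A ++ X ≡ v ++ w ^ʷ m ++ z →
    ∃[ u′ ] ∃[ v′ ] ∃[ Y ] (v′ ≢ [] × w ≡ u′ ++ v′ × X ≡ v′ ++ Y)
  peel [] u v m v≢[] e l q = u , v , _ , v≢[] , e , q
  peel A u [] m v≢[] e l q = ⊥-elim (v≢[] refl)
  peel {w} (c ∷ A) u (b ∷ b′ ∷ v) m v≢[] e l q =
    peel A (u ++ b ∷ []) (b′ ∷ v) m (λ ()) (trans e (sym (Listₚ.++-assoc u (b ∷ []) (b′ ∷ v)))) (ℕₚ.<⇒≤ l) (Listₚ.∷-injectiveʳ q)
  peel {w} {z} {X} (c ∷ A) u (b ∷ []) (suc m) v≢[] e (s≤s l) q =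
    peel A [] w m (λ w≡[] → case trans (sym w≡[]) e of λ p → ++∷≢[] u p) refl l
      (trans (Listₚ.∷-injectiveʳ q) (Listₚ.++-assoc w (w ^ʷ m) z))
    where
    ++∷≢[] : ∀ u {b : Fin n} → [] ≢ u ++ b ∷ []
    ++∷≢[] [] ()
    ++∷≢[] (x ∷ u) ()

  ^-twist : ∀ {w T K} m → w ++ T ≈ʰ T ++ K → w ^ʷ m ++ T ≈ʰ T ++ K ^ʷ m
  ^-twist {T = T} zero e = ~-reflexive (sym (Listₚ.++-identityʳ T))
  ^-twist {w} {T} {K} (suc m) e = ~-reflexive (Listₚ.++-assoc w (w ^ʷ m) T) ◅◅ ~-++ˡ w (^-twist m e)
    ◅◅ ~-reflexive (sym (Listₚ.++-assoc w T (K ^ʷ m))) ◅◅ ~-++ʳ (K ^ʷ m) e ◅◅ ~-reflexive (Listₚ.++-assoc T K (K ^ʷ m))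

  -- If κ starts with the least letter a, then the standard word of T κᵐ⁺¹ = wᵐ⁺¹ T is both
  -- T̂ κᵐ⁺¹ and wᵐ followed by something, so κ starts inside a long power of w.
  LW-minimal-in-conjugates : ∀ {a w K} → LW (a ∷ w) → Conj (a ∷ w) K → ∀ {b κ} → Std (b ∷ κ) → K ≈ʰ b ∷ κ →
    OneMin b (b ∷ κ) → a ∷ w ⊑ b ∷ κ
  LW-minimal-in-conjugates {a} {w} {K} L@(_ , S , P) c {b} {κ} S′ e o with Finₚ.<-cmp a b
  ... | tri< a<b _ _ = <≤ a<b
  ... | tri> _ _ b<a = ⊥-elim (ℕₚ.<⇒≱ b<a (All.lookup (AllSuf⇒≥head (a ∷ w) P)
          (Permₚ.∈-resp-↭ (↭-sym (Conj.perm c)) (~-∈ (~-sym e) (here refl)))))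
  ... | tri≈ _ refl _ = result
    where
    open Conj c
    W κ′ T̂ : Word n
    W = a ∷ w
    κ′ = a ∷ κ
    T̂ = std T
    -- One copy of `W` starts `peel`, and `length T̂` further copies cover the letters of `T̂`.
    -- Another copy after these `m` carries the letters on which `T` is stacked.
    m : ℕ
    m = suc (length T̂)
    letters : All (a ≤ᶠ_) W
    letters = AllSuf⇒≥head W P
    oW : OneMin a W
    oW = LW-OneMin L
    T̂-letters : All (a ≤ᶠ_) T̂
    T̂-letters = All.tabulate λ x∈ → All.lookup letters (All.lookup T⊆w (~-∈ (std-≈ T) x∈))
    κ-letters : All (a ≤ᶠ_) κ′
    κ-letters = All.tabulate λ x∈ → All.lookup letters (Permₚ.∈-resp-↭ (↭-sym perm) (~-∈ (~-sym e) x∈))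
    X : Word n
    X = κ′ ^ʷ suc m
    same-heap : T̂ ++ X ≈ʰ (W ^ʷ m ++ W) ++ T
    same-heap = ~-++ (std-≈ T) (~-^ {κ′} {K} (suc m) (~-sym e)) ◅◅ ~-sym (^-twist {W} {T} {K} (suc m) twist)
      ◅◅ ~-reflexive (cong (_++ T) (sym (^ʷ-snoc W m)))
    same-word : T̂ ++ X ≡ W ++ W ^ʷ length T̂ ++ stdAcc W T
    same-word = trans
      (Std-unique (Std-++⁺ T̂ X (Std-std T) (Std-^ κ′ (suc m) S′ o κ-letters) (OneMin-^ κ′ (suc m) o) T̂-letters)
        (Std-stdAcc (W ^ʷ m ++ W) T (subst Std (sym (^ʷ-snoc W m)) (Std-^ W (suc m) S oW letters)))
        (same-heap ◅◅ ~-sym (stdAcc-≈ (W ^ʷ m ++ W) T)))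
      (trans (stdAcc-++ (W ^ʷ m) W T T⊆w) (Listₚ.++-assoc W (W ^ʷ length T̂) (stdAcc W T)))
    lengths : length W ≡ length κ′
    lengths = trans (Permₚ.↭-length perm) (~-length e)
    result : W ⊑ κ′
    -- `X` begins with a nonempty suffix `v` of `W`, and `W ⊑ v`. As `κ′` has the length of `W`, the
    -- comparison is settled within the first copy of `κ′`.
    result with peel T̂ [] W (length T̂) (λ ()) refl ℕₚ.≤-refl same-word
    ... | u , v , Y , v≢[] , d , q = ⊑-trunc (κ′ ^ʷ m) lengths
      (⊑-trans (AllSuf-lookup u v v≢[] (subst (AllSuf (W ⊑_)) d P))
        (⊑-trans (⊑-++ v Y) (⊑-reflexive (sym q))))

  ^-strictly-increases : ∀ {b} κ i → ¬ ((b ∷ κ) ^ʷ suc i ⊑ (b ∷ κ) ^ʷ i)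
  ^-strictly-increases κ zero ()
  ^-strictly-increases {b} κ (suc i) p = ^-strictly-increases κ i (++-⊑⁻ (b ∷ κ) p)

  []-^ : ∀ m → [] ^ʷ m ≡ []
  []-^ zero = refl
  []-^ (suc m) = []-^ m

  -- The standard word `κ` of a root has standard powers, because its minimal pieces carry the least
  -- letter; so `w` is literally a power of `κ`. Dropping one `κ` leaves a suffix that is also a
  -- proper prefix of `w`, hence smaller.
  LW⇒aperiodic : ∀ {w} → LW w → ¬ IsPeriodic G w
  LW⇒aperiodic {[]} (w≢[] , _) _ = w≢[] refl
  LW⇒aperiodic {a ∷ w} L (k , zero , () , _)
  LW⇒aperiodic {a ∷ w} L (k , suc zero , s≤s () , _)
  LW⇒aperiodic {a ∷ w} L@(_ , S , P) (k , suc (suc i) , _ , e) with std k | Std-std k | std-≈ k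
  ... | [] | _ | e′ = case ~-length (~-reflexive (sym ([]-^ (suc (suc i)))) ◅◅ ~-^ (suc (suc i)) e′ ◅◅ e) of λ ()
  ... | b ∷ κ | S′ | e′ = ^-strictly-increases κ (suc i)
      (subst (_⊑ κ′ ^ʷ suc i) w≡ (AllSuf-lookup κ′ (κ′ ^ʷ suc i) (λ ()) (subst (AllSuf ((a ∷ w) ⊑_)) w≡ P)))
    where
    κ′ : Word n
    κ′ = b ∷ κ
    e″ : κ′ ^ʷ suc (suc i) ≈ʰ a ∷ w
    e″ = ~-^ (suc (suc i)) e′ ◅◅ e
    o : OneMin a κ′
    o = OneMin-++⁻ κ′ (κ′ ^ʷ suc i) (OneMin-≈ (~-sym e″) (LW-OneMin L))
    w≡ : a ∷ w ≡ κ′ ^ʷ suc (suc i)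
    w≡ = Std-unique S (Std-^ κ′ (suc (suc i)) S′ o
      (All.tabulate λ x∈ → All.lookup (AllSuf⇒≥head (a ∷ w) P) (~-∈ e″ (∈-++⁺ˡ x∈)))) (~-sym e″)

  LW⇒IsLyndon : ∀ {w} → LW w → IsLyndon G w
  LW⇒IsLyndon {[]} (w≢[] , _) = ⊥-elim (w≢[] refl)
  LW⇒IsLyndon {a ∷ w} L@(_ , S , P) = OneMin⇒pyramid (LW-OneMin L) , LW⇒aperiodic L , minimal
    where
    minimal : ∀ K → InRotClass G (a ∷ w) K → _≤heap_ G (a ∷ w) K
    minimal K (pre , x , post , w≡ , m , st , e) s s′ (s≈ , _) (_ , s′-max)
      with iter G m (rotate₀ G) (rotate G pre x post) | rotates-Conj pre x post m
    ... | _ | k , refl , c with std (x ∷ k) | Std-std (x ∷ k) | std-≈ (x ∷ k)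
    ...   | [] | _ | e′ = case ~-length e′ of λ ()
    ...   | b ∷ κ | S′ | e′ = ⊑-trans (Std⇒max (a ∷ w) S s≈) (⊑-trans
              (LW-minimal-in-conjugates L (subst (λ z → Conj z (x ∷ k)) (sym w≡) c) S′ (~-sym e′) ob)
              (s′-max (b ∷ κ) (e′ ◅◅ e)))
      where
      ox : OneMin x (b ∷ κ)
      ox = OneMin-≈ (~-sym e′) (stable⇒OneMin x k st)
      ob : OneMin b (b ∷ κ)
      ob = subst (λ y → OneMin y (b ∷ κ)) (sym (ox b (_ , fhere))) ox

  -- Phrased through rearrangements of the letters, so that rotations preserve it for free.
  Connected : Word n → Set
  Connected k = ∀ A B → k ↭ A ++ B → All (_∥* B) A → A ≡ [] ⊎ B ≡ []

  -- Each letter of `v` depends on an earlier one, and a letter of `B` is independent of `A`; so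
  -- membership in `A` spreads from left to right.
  absorb : ∀ {A B} → All (_∥* B) A → ∀ seen v → numMinAux G seen v ≡ 0 → All (_∈ A) seen →
    (∀ {x} → x ∈ v → x ∈ A ⊎ x ∈ B) → ∀ {x} → x ∈ v → x ∈ A
  absorb ind seen (y ∷ v) e s c with any (λ x → conn G x y) seen in q
  ... | true with c (here refl)
  ...   | inj₁ y∈A = λ { (here refl) → y∈A ; (there x∈) → absorb ind (y ∷ seen) v e (y∈A ∷ s) (c ∘ there) x∈ }
  ...   | inj₂ y∈B = ⊥-elim (any-true seen q (All.map (λ z∈A → ∥-sym (All.lookup (All.lookup ind z∈A) y∈B)) s))

  pyramid-inseparable : ∀ {a w} A B → IsPyramid G (a ∷ w) → a ∷ w ↭ A ++ B → All (_∥* B) A → a ∈ A → B ≡ []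
  pyramid-inseparable A [] pyr p ind a∈A = refl
  pyramid-inseparable {a} {w} A (b ∷ B) pyr p ind a∈A = ⊥-elim (∥-irrefl (All.lookup (All.lookup ind b∈A) (here refl)))
    where
    b∈A : b ∈ A
    b∈A with Permₚ.∈-resp-↭ (↭-sym p) (∈-++⁺ʳ A (here refl))
    ... | here refl = a∈A
    ... | there b∈w = absorb ind (a ∷ []) w (ℕₚ.suc-injective pyr) (a∈A ∷ [])
            (λ x∈ → ∈-++⁻ A (Permₚ.∈-resp-↭ p (there x∈))) b∈w

  pyramid⇒Connected : ∀ {a w} → IsPyramid G (a ∷ w) → Connected (a ∷ w)
  pyramid⇒Connected pyr A B p ind with ∈-++⁻ A (Permₚ.∈-resp-↭ p (here refl))
  ... | inj₁ a∈A = inj₂ (pyramid-inseparable A B pyr p ind a∈A)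
  ... | inj₂ a∈B = inj₁ (pyramid-inseparable B A pyr (↭-trans p (Permₚ.++-comm A B))
      (All.tabulate λ b∈ → All.tabulate λ a∈ → ∥-sym (All.lookup (All.lookup ind a∈) b∈)) a∈B)

  Spl-length : ∀ {vs w V U} → Spl vs w V U → length U ≤ℕ length w
  Spl-length snil = z≤n
  Spl-length (sin _ s) = ℕₚ.m≤n⇒m≤1+n (Spl-length s)
  Spl-length (sout _ s) = s≤s (Spl-length s)

  Spl-progress : ∀ {vs w V U} → Spl vs w V U → length U <ℕ length w ⊎ All (_∥* vs) w
  Spl-progress snil = inj₂ []
  Spl-progress (sin _ s) = inj₁ (s≤s (Spl-length s))
  Spl-progress (sout p s) with Spl-progress s
  ... | inj₁ q = inj₁ (s≤s q)
  ... | inj₂ q = inj₂ (p ∷ q)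

  -- Splitting `V ++ X` again absorbs all of `V`, so only `X` is divided afresh, against a list that
  -- contains `V` in addition to `vs`.
  Spl-again : ∀ {vs w V U A B X} → Spl vs w V U → Spl vs (V ++ X) A B →
    ∃[ vs′ ] ∃[ A′ ] (Spl vs′ X A′ B × (∀ {y} → y ∥* vs′ → y ∥* vs × y ∥* V))
  Spl-again {vs} snil t = vs , _ , t , λ p → p , []
  Spl-again (sout _ s) t = Spl-again s t
  Spl-again (sin p s) (sout q t) = ⊥-elim (p q)
  Spl-again (sin p s) (sin q t) with Spl-again s t
  ... | vs′ , A′ , t′ , h = vs′ , A′ , t′ , λ r → All.tail (proj₁ (h r)) , All.head (proj₁ (h r)) ∷ proj₂ (h r)

  iter-shift : ∀ m (f : Word n → Word n) k → iter G m f (f k) ≡ iter G (suc m) f k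
  iter-shift zero f k = refl
  iter-shift (suc m) f k = cong f (iter-shift m f k)

  -- Lalonde's stabilization. A rotation keeps `V` above `x` and lets some piece of `U` join it,
  -- unless `U` is independent of `x` and `V`, which connectedness excludes. `d` bounds the size of
  -- `U`.
  stabilizes : ∀ d x k {V U} → Spl (x ∷ []) k V U → length U ≤ℕ d → Connected (x ∷ k) →
    ∃[ m ] IsStable G (iter G m (rotate₀ G) (x ∷ k))
  stabilizes d x k {V} {[]} s l cn = 0 , sym (proj₂ (Spl-unique s (splitUp-Spl (x ∷ []) k)))
  stabilizes (suc d) x k {V} {u ∷ U} s (s≤s l) cn with splitUp-Spl (x ∷ []) (V ++ u ∷ U)
  ... | s′ with Spl-again s s′
  ...   | vs′ , A′ , s″ , h with Spl-progress s″
  ...     | inj₁ (s≤s l′) with stabilizes d x (V ++ u ∷ U) s′ (ℕₚ.≤-trans l′ l)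
              (λ A B p ind → cn A B (↭-trans (prep x (↭-trans (≈⇒↭ (Spl-≈ s)) (Permₚ.++-comm (u ∷ U) V))) p) ind)
  ...       | m , st = suc m , subst (IsStable G) (trans (cong (iter G m (rotate₀ G)) (sym next)) (iter-shift m (rotate₀ G) (x ∷ k))) st
    where
    next : rotate₀ G (x ∷ k) ≡ x ∷ V ++ u ∷ U
    next with Spl-unique s (splitUp-Spl (x ∷ []) k)
    ... | e , e′ = cong (x ∷_) (sym (cong₂ _++_ e e′))
  stabilizes (suc d) x k {V} {u ∷ U} s (s≤s l) cn | s′ | vs′ , A′ , s″ , h | inj₂ ind
    with cn (u ∷ U) (x ∷ V) (↭-trans (prep x (≈⇒↭ (Spl-≈ s))) (↭-sym (Permₚ.shift x (u ∷ U) V)))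
           (All.map (λ p → All.head (proj₁ (h p)) ∷ proj₂ (h p)) ind)
  ... | inj₁ ()
  ... | inj₂ ()

  Connected-↭ : ∀ {k k′} → k ↭ k′ → Connected k → Connected k′
  Connected-↭ q c A B p = c A B (↭-trans q p)

  rotation-exists : ∀ pre x post → Connected (pre ++ x ∷ post) → ∃[ k ] (OneMin x (x ∷ k) × InRotClass G (pre ++ x ∷ post) (x ∷ k))
  rotation-exists pre x post cn
    with stabilizes _ x (proj₁ s ++ pre ++ proj₂ s) (splitUp-Spl (x ∷ []) _) ℕₚ.≤-refl (Connected-↭ (Conj.perm (Conj-rotate pre x post)) cn)
    where
    s : Word n × Word n
    s = splitUp G (x ∷ []) post
  ... | m , st with rotates-Conj pre x post m
  ...   | k , e , _ = k , stable⇒OneMin x k (subst (IsStable G) e st) , pre , x , post , refl , m , st , ~-reflexive e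

  ≤heap⇒⊑ : ∀ {w w′ K} → _≤heap_ G w′ K → Std w → w ≈ʰ w′ → w ⊑ std K
  ≤heap⇒⊑ {w} {w′} {K} h S e = h w (std K) (Std⇒IsStandard S e) (Std⇒IsStandard (Std-std K) (std-≈ K))

  IsLyndon⇒LW : ∀ {w′} → IsLyndon G w′ → LW (std w′)
  IsLyndon⇒LW {[]} (() , _)
  IsLyndon⇒LW {a ∷ w₁} (pyr , aper , minimal) with std (a ∷ w₁) | Std-std (a ∷ w₁) | std-≈ (a ∷ w₁)
  ... | [] | _ | e = case ~-length e of λ ()
  ... | p ∷ w₀ | S | e with min-suffix p w₀
  ...   | u₀ , v₀ , e₀ , v₀≢[] , min₀ = result u₀ v₀ e₀ v₀≢[] min₀
    where
    w w′ : Word n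
    w = p ∷ w₀
    w′ = a ∷ w₁
    o : OneMin p w
    o = subst (λ y → OneMin y w) (sym (oa p (_ , fhere))) oa
      where
      oa : OneMin a w
      oa = OneMin-≈ (~-sym e) (pyramid⇒OneMin pyr)
    -- The rotation to `x` is a pyramid whose standard word starts with `x`, and minimality in the
    -- class compares the first letters.
    p-least : ∀ {x} → x ∈ w′ → p ≤ᶠ x
    p-least {x} x∈ with ∈-∃++ x∈
    ... | pre , post , d with rotation-exists pre x post (subst Connected d (pyramid⇒Connected pyr))
    ...   | k , ox , r with std (x ∷ k) | std-≈ (x ∷ k) | ≤heap⇒⊑ (minimal (x ∷ k) (subst (λ z → InRotClass G z (x ∷ k)) (sym d) r)) S e
    ...     | b ∷ κ | e′ | q with refl ← OneMin-≈ (~-sym e′) ox b (_ , fhere) = ⊑-head q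
    result : ∀ u v → w ≡ u ++ v → v ≢ [] → AllSuf (v ⊑_) w → LW w
    result [] v w≡ v≢[] min = (λ ()) , S , subst (λ z → AllSuf (z ⊑_) w) (sym w≡) min
    result (c ∷ u) [] w≡ v≢[] min = ⊥-elim (v≢[] refl)
    result (c ∷ u) (b ∷ v) w≡ v≢[] min = ⊥-elim (aper (V , suc (suc (proj₁ i)) , s≤s (s≤s z≤n) , periodic))
      where
      U V : Word n
      U = c ∷ u
      V = b ∷ v
      -- As the least suffix, `V` starts with a letter at most `p`, which is the least letter. Hence
      -- the minimal pieces of `V` and of `U` carry the same letter, and `V U` is a pyramid.
      b≡p : b ≡ p
      b≡p = Finₚ.≤-antisym (⊑-head (proj₁ min)) (p-least (~-∈ e (subst (b ∈_) (sym w≡) (∈-++⁺ʳ U (here refl)))))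
      Vlw : LW V
      Vlw = suffix-LW U V v≢[] (subst Std w≡ S) (subst (AllSuf (V ⊑_)) w≡ min)
      oV : OneMin p V
      oV = subst (λ y → OneMin y V) b≡p (LW-OneMin Vlw)
      oU : OneMin p U
      oU = OneMin-++⁻ U V (subst (OneMin p) w≡ o)
      SU : Std U
      SU = Std-++⁻ˡ U V (subst Std w≡ S)
      SVU : Std (V ++ U)
      SVU = Std-++⁺ V U (proj₁ (proj₂ Vlw)) SU oU
        (All.tabulate λ {x} x∈ → p-least (~-∈ e (subst (x ∈_) (sym w≡) (∈-++⁺ʳ U x∈))))
      inClass : InRotClass G w′ (V ++ U)
      inClass with UpSet-≈ e (subst (λ z → UpSet b z V U) (sym w≡) (UpSet-suffix U (LW-OneMin Vlw)))
      ... | V′ , U′ , s , e₁ , e₂ with UpSet⇒rotate s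
      -- A single rotation already gives a pyramid, so the number of iterations is `0`.
      ...   | pre , post , d , r = pre , b , post , d , 0 , stable , ~-sym rot
        where
        rot : V ++ U ≈ʰ rotate G pre b post
        rot = ~-++ e₁ e₂ ◅◅ ~-reflexive (sym r)
        stable : IsStable G (rotate G pre b post)
        stable = OneMin⇒stable (OneMin-≈ rot (subst (λ y → OneMin y (V ++ U)) (sym b≡p) (OneMin-++⁺ V U oV oU)))
      UV⊑VU : U ++ V ⊑ V ++ U
      UV⊑VU = subst (_⊑ V ++ U) w≡ (subst (w ⊑_) (Std-unique (Std-std (V ++ U)) SVU (std-≈ (V ++ U)))
        (≤heap⇒⊑ (minimal (V ++ U) inClass) S e))
      i : ∃[ j ] U ≡ V ^ʷ suc j
      i = positive (power-of-commuting (length U) U ℕₚ.≤-refl v≢[] (AllSuf-++ˡ U v≢[] (subst (AllSuf (V ⊑_)) w≡ min)) UV⊑VU)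
        where
        positive : ∃[ j ] U ≡ V ^ʷ j → ∃[ j ] U ≡ V ^ʷ suc j
        positive (zero , ())
        positive (suc j , d) = j , d
      periodic : V ^ʷ suc (suc (proj₁ i)) ≈ʰ w′
      periodic = ~-reflexive (trans (sym (^ʷ-snoc V (suc (proj₁ i)))) (trans (cong (_++ V) (sym (proj₂ i))) (sym w≡))) ◅◅ e

-- Finite sums and products in commutative monoids and rings.

module BigOperator (M : CommutativeMonoid 0ℓ 0ℓ) where
  open CommutativeMonoid M renaming (ε to unit; refl to ≈-refl; sym to ≈-sym; trans to ≈-trans)
  open CSProps commutativeSemigroup using (interchange; x∙yz≈y∙xz)

  big : ∀ {X : Set} → List X → (X → Carrier) → Carrier
  big [] f = unit
  big (x ∷ xs) f = f x ∙ big xs f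

  big-cong : ∀ {X : Set} (xs : List X) {f g : X → Carrier} → (∀ {x} → x ∈ xs → f x ≈ g x) → big xs f ≈ big xs g
  big-cong [] h = ≈-refl
  big-cong (x ∷ xs) h = ∙-cong (h (here refl)) (big-cong xs (h ∘ there))

  big-ε : ∀ {X : Set} (xs : List X) {f : X → Carrier} → (∀ {x} → x ∈ xs → f x ≈ unit) → big xs f ≈ unit
  big-ε [] h = ≈-refl
  big-ε (x ∷ xs) h = ≈-trans (∙-cong (h (here refl)) (big-ε xs (h ∘ there))) (identityˡ unit)

  big-++ : ∀ {X : Set} (xs ys : List X) (f : X → Carrier) → big (xs ++ ys) f ≈ big xs f ∙ big ys f
  big-++ [] ys f = ≈-sym (identityˡ _)
  big-++ (x ∷ xs) ys f = ≈-trans (∙-congˡ (big-++ xs ys f)) (≈-sym (assoc _ _ _))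

  big-map : ∀ {X Y : Set} (h : X → Y) xs (f : Y → Carrier) → big (map h xs) f ≈ big xs (f ∘ h)
  big-map h [] f = ≈-refl
  big-map h (x ∷ xs) f = ∙-congˡ (big-map h xs f)

  big-concatMap : ∀ {X Y : Set} (h : X → List Y) xs (f : Y → Carrier) → big (concatMap h xs) f ≈ big xs (λ x → big (h x) f)
  big-concatMap h [] f = ≈-refl
  big-concatMap h (x ∷ xs) f = ≈-trans (big-++ (h x) (concatMap h xs) f) (∙-congˡ (big-concatMap h xs f))

  big-∙ : ∀ {X : Set} (xs : List X) (f g : X → Carrier) → big xs (λ x → f x ∙ g x) ≈ big xs f ∙ big xs g
  big-∙ [] f g = ≈-sym (identityˡ unit)
  big-∙ (x ∷ xs) f g = ≈-trans (∙-congˡ (big-∙ xs f g)) (interchange _ _ _ _)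

  big-swap : ∀ {X Y : Set} (xs : List X) (ys : List Y) (f : X → Y → Carrier) →
    big xs (λ x → big ys (f x)) ≈ big ys (λ y → big xs (λ x → f x y))
  big-swap [] ys f = ≈-sym (big-ε ys (λ _ → ≈-refl))
  big-swap (x ∷ xs) ys f = ≈-trans (∙-congˡ (big-swap xs ys f)) (≈-sym (big-∙ ys (f x) _))

  big-↭ : ∀ {X : Set} {xs ys : List X} (f : X → Carrier) → xs ↭ ys → big xs f ≈ big ys f
  big-↭ f _↭_.refl = ≈-refl
  big-↭ f (prep x p) = ∙-congˡ (big-↭ f p)
  big-↭ f (swap x y p) = ≈-trans (x∙yz≈y∙xz _ _ _) (∙-congˡ (∙-congˡ (big-↭ f p)))
  big-↭ f (_↭_.trans p q) = ≈-trans (big-↭ f p) (big-↭ f q)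

  map-unique : ∀ {X Y : Set} (φ : X → Y) {xs} → (∀ {x y} → x ∈ xs → y ∈ xs → φ x ≡ φ y → x ≡ y) →
    Unique xs → Unique (map φ xs)
  map-unique φ {[]} inj [] = []
  map-unique φ {x ∷ xs} inj (p ∷ u) = All.tabulate (λ y∈ e → fresh (∈-map⁻ φ y∈) e) ∷ map-unique φ (λ a b → inj (there a) (there b)) u
    where
    fresh : ∀ {y} → ∃[ z ] (z ∈ xs × y ≡ φ z) → ¬ (φ x ≡ y)
    fresh (z , z∈ , refl) e = All.lookup p z∈ (inj (here refl) (there z∈) e)

  -- Two duplicate-free lists matched by maps that are inverse on them are permutations of each
  -- other up to relabelling. The bijections on standard words enter the sums this way.
  big-bij : ∀ {X Y : Set} {xs : List X} {ys : List Y} (φ : X → Y) (ψ : Y → X) {f : X → Carrier} {g : Y → Carrier} →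
    Unique xs → Unique ys →
    (∀ {x} → x ∈ xs → φ x ∈ ys × ψ (φ x) ≡ x) → (∀ {y} → y ∈ ys → ψ y ∈ xs × φ (ψ y) ≡ y) →
    (∀ {x} → x ∈ xs → f x ≈ g (φ x)) → big xs f ≈ big ys g
  big-bij {xs = xs} {ys} φ ψ {f} {g} ux uy to from h =
    ≈-trans (big-cong xs h) (≈-trans (≈-sym (big-map φ xs g)) (big-↭ g (∼bag⇒↭ (unique∧set⇒bag
      (map-unique φ (λ x∈ y∈ e → trans (sym (proj₂ (to x∈))) (trans (cong ψ e) (proj₂ (to y∈)))) ux) uy
      (mk⇔ (λ y∈ → mapped (∈-map⁻ φ y∈))
           covered)))))
    where
    mapped : ∀ {y} → ∃[ x ] (x ∈ xs × y ≡ φ x) → y ∈ ys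
    mapped (x , x∈ , refl) = proj₁ (to x∈)
    covered : ∀ {y} → y ∈ ys → y ∈ map φ xs
    covered y∈ = subst (_∈ map φ xs) (proj₂ (from y∈)) (∈-map⁺ φ (proj₁ (from y∈)))

module Sums (R : CommutativeRing 0ℓ 0ℓ) where
  open CommutativeRing R renaming (refl to ≈-refl; sym to ≈-sym; trans to ≈-trans)
  open RingProps ring using (-0#≈0#; -‿+-comm)
  open BigOperator +-commutativeMonoid public using () renaming
    (big to ∑; big-cong to ∑-cong; big-ε to ∑-0; big-++ to ∑-++; big-map to ∑-map; big-concatMap to ∑-concatMap;
     big-∙ to ∑-+; big-swap to ∑-swap; big-↭ to ∑-↭; big-bij to ∑-bij)
  open BigOperator *-commutativeMonoid public using () renaming
    (big to ∏; big-cong to ∏-cong; big-ε to ∏-1; big-++ to ∏-++; big-map to ∏-map; big-concatMap to ∏-concatMap;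
     big-∙ to ∏-*; big-swap to ∏-swap; big-↭ to ∏-↭)

  ∑-*ˡ : ∀ {X : Set} c (xs : List X) (f : X → Carrier) → c * ∑ xs f ≈ ∑ xs (λ x → c * f x)
  ∑-*ˡ c [] f = zeroʳ c
  ∑-*ˡ c (x ∷ xs) f = ≈-trans (distribˡ c _ _) (+-congˡ (∑-*ˡ c xs f))

  ∑-*ʳ : ∀ {X : Set} c (xs : List X) (f : X → Carrier) → ∑ xs f * c ≈ ∑ xs (λ x → f x * c)
  ∑-*ʳ c xs f = ≈-trans (*-comm _ c) (≈-trans (∑-*ˡ c xs f) (∑-cong xs (λ _ → *-comm c _)))

  ⟦_⟧ : Bool → Carrier
  ⟦ true ⟧ = 1#
  ⟦ false ⟧ = 0#

  ⟦⟧-∧ : ∀ a b → ⟦ a ∧ b ⟧ ≈ ⟦ a ⟧ * ⟦ b ⟧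
  ⟦⟧-∧ true b = ≈-sym (*-identityˡ _)
  ⟦⟧-∧ false b = ≈-sym (zeroˡ _)

  ∑-filter : ∀ {X : Set} {P : X → Set} (P? : Decidable P) xs (f : X → Carrier) →
    ∑ (filter P? xs) f ≈ ∑ xs (λ x → ⟦ does (P? x) ⟧ * f x)
  ∑-filter P? [] f = ≈-refl
  ∑-filter P? (x ∷ xs) f with P? x
  ... | yes _ = +-cong (≈-sym (*-identityˡ _)) (∑-filter P? xs f)
  ... | no _ = ≈-trans (∑-filter P? xs f) (≈-trans (≈-sym (+-identityˡ _)) (+-congʳ (≈-sym (zeroˡ _))))

  ∑-filterᵇ : ∀ {X : Set} (p : X → Bool) xs (f : X → Carrier) → ∑ (filterᵇ p xs) f ≈ ∑ xs (λ x → ⟦ p x ⟧ * f x)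
  ∑-filterᵇ p [] f = ≈-refl
  ∑-filterᵇ p (x ∷ xs) f with p x
  ... | true = +-cong (≈-sym (*-identityˡ _)) (∑-filterᵇ p xs f)
  ... | false = ≈-trans (∑-filterᵇ p xs f) (≈-trans (≈-sym (+-identityˡ _)) (+-congʳ (≈-sym (zeroˡ _))))

  ∑-filter-split : ∀ {X : Set} {P Q Q′ : X → Set} (P? : Decidable P) (Q? : Decidable Q) (Q′? : Decidable Q′) xs (f : X → Carrier) →
    (∀ {x} → x ∈ xs → P x → Q x ⊎ Q′ x) → (∀ {x} → x ∈ xs → Q x → P x × ¬ Q′ x) → (∀ {x} → x ∈ xs → Q′ x → P x) →
    ∑ (filter P? xs) f ≈ ∑ (filter Q? xs) f + ∑ (filter Q′? xs) f
  ∑-filter-split P? Q? Q′? [] f a b c = ≈-sym (+-identityˡ 0#)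
  ∑-filter-split P? Q? Q′? (x ∷ xs) f a b c with ∑-filter-split P? Q? Q′? xs f (a ∘ there) (b ∘ there) (c ∘ there)
  ... | ih with P? x | Q? x | Q′? x
  ...   | _ | yes q | yes q′ = ⊥-elim (proj₂ (b (here refl) q) q′)
  ...   | yes p | yes q | no _ = ≈-trans (+-congˡ ih) (≈-sym (+-assoc _ _ _))
  ...   | yes p | no _ | yes _ = ≈-trans (+-congˡ ih) (CSProps.x∙yz≈y∙xz +-commutativeSemigroup _ _ _)
  ...   | yes p | no ¬q | no ¬q′ with a (here refl) p
  ...     | inj₁ q = ⊥-elim (¬q q)
  ...     | inj₂ q = ⊥-elim (¬q′ q)
  ∑-filter-split P? Q? Q′? (x ∷ xs) f a b c | ih | no ¬p | yes q | no _ = ⊥-elim (¬p (proj₁ (b (here refl) q)))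
  ∑-filter-split P? Q? Q′? (x ∷ xs) f a b c | ih | no ¬p | no _ | yes q = ⊥-elim (¬p (c (here refl) q))
  ∑-filter-split P? Q? Q′? (x ∷ xs) f a b c | ih | no _ | no _ | no _ = ih

  ∑-filter-⇔ : ∀ {X : Set} {P Q : X → Set} (P? : Decidable P) (Q? : Decidable Q) xs (f : X → Carrier) →
    (∀ {x} → x ∈ xs → P x → Q x) → (∀ {x} → x ∈ xs → Q x → P x) → ∑ (filter P? xs) f ≈ ∑ (filter Q? xs) f
  ∑-filter-⇔ P? Q? [] f a b = ≈-refl
  ∑-filter-⇔ P? Q? (x ∷ xs) f a b with ∑-filter-⇔ P? Q? xs f (a ∘ there) (b ∘ there) | P? x | Q? x
  ... | ih | yes _ | yes _ = +-congˡ ih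
  ... | ih | no _ | no _ = ih
  ... | ih | yes p | no ¬q = ⊥-elim (¬q (a (here refl) p))
  ... | ih | no ¬p | yes q = ⊥-elim (¬p (b (here refl) q))

  ∑-delta : ∀ {X : Set} (_≟_ : (x y : X) → Dec (x ≡ y)) {xs} → Unique xs → ∀ {a} → a ∈ xs → (f : X → Carrier) →
    ∑ xs (λ x → ⟦ does (x ≟ a) ⟧ * f x) ≈ f a
  ∑-delta _≟_ {x ∷ xs} (p ∷ u) {a} a∈ f with x ≟ a | a∈
  ... | yes refl | _ = ≈-trans (+-cong (*-identityˡ _) (∑-0 xs absent)) (+-identityʳ _)
    where
    absent : ∀ {y} → y ∈ xs → ⟦ does (y ≟ x) ⟧ * f y ≈ 0#
    absent {y} y∈ with y ≟ x
    ... | yes refl = ⊥-elim (All.lookup p y∈ refl)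
    ... | no _ = zeroˡ _
  ... | no x≢a | here e = ⊥-elim (x≢a (sym e))
  ... | no x≢a | there a∈xs = ≈-trans (+-cong (zeroˡ _) (∑-delta _≟_ u a∈xs f)) (+-identityˡ _)

  natR : ℕ → Carrier
  natR zero = 0#
  natR (suc m) = 1# + natR m

  natR-+ : ∀ a b → natR (a +ℕ b) ≈ natR a + natR b
  natR-+ zero b = ≈-sym (+-identityˡ _)
  natR-+ (suc a) b = ≈-trans (+-congˡ (natR-+ a b)) (≈-sym (+-assoc _ _ _))

  natR-length : ∀ {X : Set} (xs : List X) → natR (length xs) ≈ ∑ xs (λ _ → 1#)
  natR-length [] = ≈-refl
  natR-length (x ∷ xs) = +-congˡ (natR-length xs)

  infixr 8 _^_
  _^_ : Carrier → ℕ → Carrier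
  x ^ zero = 1#
  x ^ suc m = x * x ^ m

-- One-sided axioms, whose mirror images follow from commutativity; they serve both the power series
-- and the truncated power series.
record RingLaws : Set₁ where
  field
    C : Set
    _≈_ : C → C → Set
    _+_ _*_ : C → C → C
    -_ : C → C
    0# 1# : C
    isEquivalence : IsEquivalence _≈_
    +-cong : ∀ {a b c d} → a ≈ b → c ≈ d → (a + c) ≈ (b + d)
    *-cong : ∀ {a b c d} → a ≈ b → c ≈ d → (a * c) ≈ (b * d)
    -‿cong : ∀ {a b} → a ≈ b → (- a) ≈ (- b)
    +-assoc : ∀ a b c → ((a + b) + c) ≈ (a + (b + c))
    +-comm : ∀ a b → (a + b) ≈ (b + a)
    +-identityˡ : ∀ a → (0# + a) ≈ a
    -‿inverseˡ : ∀ a → ((- a) + a) ≈ 0#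
    *-assoc : ∀ a b c → ((a * b) * c) ≈ (a * (b * c))
    *-comm : ∀ a b → (a * b) ≈ (b * a)
    *-identityˡ : ∀ a → (1# * a) ≈ a
    distribʳ : ∀ a b c → ((b + c) * a) ≈ ((b * a) + (c * a))

commutativeRing : RingLaws → CommutativeRing 0ℓ 0ℓ
commutativeRing L = record
  { Carrier = C ; _≈_ = _≈_ ; _+_ = _+_ ; _*_ = _*_ ; -_ = -_ ; 0# = 0# ; 1# = 1#
  ; isCommutativeRing = record
    { isRing = record
      { +-isAbelianGroup = record
        { isGroup = record
          { isMonoid = record
            { isSemigroup = record
              { isMagma = record { isEquivalence = isEquivalence ; ∙-cong = +-cong }
              ; assoc = +-assoc }
            ; identity = +-identityˡ , λ a → E.trans (+-comm a 0#) (+-identityˡ a) }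
          ; inverse = -‿inverseˡ , λ a → E.trans (+-comm a (- a)) (-‿inverseˡ a)
          ; ⁻¹-cong = -‿cong }
        ; comm = +-comm }
      ; *-cong = *-cong
      ; *-assoc = *-assoc
      ; *-identity = *-identityˡ , λ a → E.trans (*-comm a 1#) (*-identityˡ a)
      ; distrib = (λ a b c → E.trans (*-comm a (b + c)) (E.trans (distribʳ a b c) (+-cong (*-comm b a) (*-comm c a)))) , distribʳ }
    ; *-comm = *-comm } }
  where
  open RingLaws L
  module E = IsEquivalence isEquivalence

-- Power series in one variable and, by iteration, in several; truncation by total degree.

module PowerSeries (R : CommutativeRing 0ℓ 0ℓ) where
  open CommutativeRing R renaming (refl to ≈-refl; sym to ≈-sym; trans to ≈-trans)
  open CSProps +-commutativeSemigroup using (interchange; x∙yz≈y∙xz)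
  open SetoidReasoning setoid

  Series : Set
  Series = ℕ → Carrier

  infix 4 _≋_
  infixl 7 _⊛_

  _≋_ : Series → Series → Set
  f ≋ g = ∀ m → f m ≈ g m

  tail : Series → Series
  tail f m = f (suc m)

  -- The Cauchy product through `f = f₀ + t · tail f`, so that proofs are inductions on the degree;
  -- `⊛-sum` recovers the usual convolution.
  _⊛_ : Series → Series → Series
  (f ⊛ g) zero = f 0 * g 0
  (f ⊛ g) (suc m) = f 0 * g (suc m) + (tail f ⊛ g) m

  one : Series
  one zero = 1#
  one (suc m) = 0#

  ⊛-cong : ∀ {f f′ g g′} → f ≋ f′ → g ≋ g′ → f ⊛ g ≋ f′ ⊛ g′
  ⊛-cong p q zero = *-cong (p 0) (q 0)
  ⊛-cong p q (suc m) = +-cong (*-cong (p 0) (q (suc m))) (⊛-cong (p ∘ suc) q m)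

  ⊛-distribʳ : ∀ h f g → (λ i → f i + g i) ⊛ h ≋ (λ i → (f ⊛ h) i + (g ⊛ h) i)
  ⊛-distribʳ h f g zero = distribʳ _ _ _
  ⊛-distribʳ h f g (suc m) = ≈-trans (+-cong (distribʳ _ _ _) (⊛-distribʳ h (tail f) (tail g) m)) (interchange _ _ _ _)

  ⊛-scaleˡ : ∀ c f g → (λ i → c * f i) ⊛ g ≋ (λ i → c * (f ⊛ g) i)
  ⊛-scaleˡ c f g zero = *-assoc _ _ _
  ⊛-scaleˡ c f g (suc m) = ≈-trans (+-cong (*-assoc _ _ _) (⊛-scaleˡ c (tail f) g m)) (≈-sym (distribˡ _ _ _))

  ⊛-zeroˡ : ∀ g → (λ _ → 0#) ⊛ g ≋ (λ _ → 0#)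
  ⊛-zeroˡ g zero = zeroˡ _
  ⊛-zeroˡ g (suc m) = ≈-trans (+-cong (zeroˡ _) (⊛-zeroˡ g m)) (+-identityˡ _)

  -- The mirrored recursion, on the right factor; having both makes commutativity an induction.
  ⊛-sucʳ : ∀ f g m → (f ⊛ g) (suc m) ≈ f (suc m) * g 0 + (f ⊛ tail g) m
  ⊛-sucʳ f g zero = +-comm _ _
  ⊛-sucʳ f g (suc m) = ≈-trans (+-congˡ (⊛-sucʳ (tail f) g m)) (x∙yz≈y∙xz _ _ _)

  ⊛-comm : ∀ f g → f ⊛ g ≋ g ⊛ f
  ⊛-comm f g zero = *-comm _ _
  ⊛-comm f g (suc m) = ≈-trans (+-cong (*-comm _ _) (⊛-comm (tail f) g m)) (≈-sym (⊛-sucʳ g f m))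

  ⊛-assoc : ∀ f g h → (f ⊛ g) ⊛ h ≋ f ⊛ (g ⊛ h)
  ⊛-assoc f g h zero = *-assoc _ _ _
  ⊛-assoc f g h (suc m) = begin
    f 0 * g 0 * h (suc m) + (tail (f ⊛ g) ⊛ h) m
      ≈⟨ +-cong (*-assoc _ _ _) (⊛-distribʳ h (λ i → f 0 * tail g i) (tail f ⊛ g) m) ⟩
    f 0 * (g 0 * h (suc m)) + (((λ i → f 0 * tail g i) ⊛ h) m + ((tail f ⊛ g) ⊛ h) m)
      ≈⟨ +-congˡ (+-cong (⊛-scaleˡ (f 0) (tail g) h m) (⊛-assoc (tail f) g h m)) ⟩
    f 0 * (g 0 * h (suc m)) + (f 0 * (tail g ⊛ h) m + (tail f ⊛ (g ⊛ h)) m)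
      ≈⟨ +-assoc _ _ _ ⟨
    f 0 * (g 0 * h (suc m)) + f 0 * (tail g ⊛ h) m + (tail f ⊛ (g ⊛ h)) m
      ≈⟨ +-congʳ (distribˡ _ _ _) ⟨
    f 0 * (g 0 * h (suc m) + (tail g ⊛ h) m) + (tail f ⊛ (g ⊛ h)) m ∎

  ⊛-identityˡ : ∀ f → one ⊛ f ≋ f
  ⊛-identityˡ f zero = *-identityˡ _
  ⊛-identityˡ f (suc m) = ≈-trans (+-cong (*-identityˡ _) (⊛-zeroˡ f m)) (+-identityʳ _)

  seriesRing : CommutativeRing 0ℓ 0ℓ
  seriesRing = commutativeRing record
    { C = Series ; _≈_ = _≋_ ; _+_ = λ f g m → f m + g m ; _*_ = _⊛_ ; -_ = λ f m → - f m ; 0# = λ _ → 0# ; 1# = one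
    ; isEquivalence = record { refl = λ m → ≈-refl ; sym = λ p m → ≈-sym (p m) ; trans = λ p q m → ≈-trans (p m) (q m) }
    ; +-cong = λ p q m → +-cong (p m) (q m)
    ; *-cong = λ p q → ⊛-cong p q
    ; -‿cong = λ p m → -‿cong (p m)
    ; +-assoc = λ f g h m → +-assoc _ _ _
    ; +-comm = λ f g m → +-comm _ _
    ; +-identityˡ = λ f m → +-identityˡ _
    ; -‿inverseˡ = λ f m → -‿inverseˡ _
    ; *-assoc = ⊛-assoc
    ; *-comm = ⊛-comm
    ; *-identityˡ = ⊛-identityˡ
    ; distribʳ = ⊛-distribʳ
    }

  open Sums R

  ⊛-sum : ∀ f g m → (f ⊛ g) m ≈ ∑ (upTo (suc m)) (λ i → f i * g (m ∸ i))
  ⊛-sum f g zero = ≈-sym (+-identityʳ _)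
  ⊛-sum f g (suc m) = +-congˡ (≈-trans (⊛-sum (tail f) g m) (≈-trans (≈-sym (∑-map suc (upTo (suc m)) _))
    (reflexive (cong (λ l → ∑ l (λ i → f i * g (suc m ∸ i))) (Listₚ.map-upTo suc (suc m))))))

  mono : Carrier → ℕ → Series
  mono c zero zero = c
  mono c zero (suc m) = 0#
  mono c (suc L) zero = 0#
  mono c (suc L) (suc m) = mono c L m

  mono-⊛-≥ : ∀ c L f m → (mono c L ⊛ f) (L +ℕ m) ≈ c * f m
  mono-⊛-≥ c zero f zero = ≈-refl
  mono-⊛-≥ c zero f (suc m) = ≈-trans (+-congˡ (⊛-zeroˡ f m)) (+-identityʳ _)
  mono-⊛-≥ c (suc L) f m = ≈-trans (+-cong (zeroˡ _) (mono-⊛-≥ c L f m)) (+-identityˡ _)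

  mono-⊛-< : ∀ c L f m → m <ℕ L → (mono c L ⊛ f) m ≈ 0#
  mono-⊛-< c (suc L) f zero _ = zeroˡ _
  mono-⊛-< c (suc L) f (suc m) (s≤s l) = ≈-trans (+-cong (zeroˡ _) (mono-⊛-< c L f m l)) (+-identityˡ _)

module ExponentVectors where

  -- Verbatim the test inside `coefP`, so that statements about `fits`, `nonzero` and the
  -- subtraction below apply to `coefP` by computation.
  fits : ℕ → List ℕ → List ℕ → Bool
  fits l α β = all (λ p → p) (zipWith (λ b a → (l *ℕ b) ≤ᵇ a) β α)

  _∸⟨_⟩_ : List ℕ → ℕ → List ℕ → List ℕ
  α ∸⟨ l ⟩ β = zipWith _∸_ α (map (l *ℕ_) β)

  nonzero : List ℕ → Bool
  nonzero = any (λ b → not (b ≡ᵇ 0))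

module MultiSeries (R : CommutativeRing 0ℓ 0ℓ) where
  open Sums R
  open ExponentVectors

  Ring : ℕ → CommutativeRing 0ℓ 0ℓ
  Ring zero = R
  Ring (suc k) = PowerSeries.seriesRing (Ring k)

  ⟨_⟩ : ℕ → Set
  ⟨ k ⟩ = CommutativeRing.Carrier (Ring k)

  private
    module R = CommutativeRing R

  -- Total order at least `e`: fixing the exponent `i` of the first variable leaves order `e ∸ i`
  -- for the rest, and truncated subtraction makes the condition empty once `i` reaches `e`.
  Ord≥ : ∀ k → ℕ → ⟨ k ⟩ → Set
  Ord≥ zero e F = 1 ≤ℕ e → F R.≈ R.0#
  Ord≥ (suc k) e F = ∀ i → Ord≥ k (e ∸ i) (F i)

  Ord≥-resp : ∀ k {e F G} → CommutativeRing._≈_ (Ring k) F G → Ord≥ k e F → Ord≥ k e G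
  Ord≥-resp zero p v l = R.trans (R.sym p) (v l)
  Ord≥-resp (suc k) p v i = Ord≥-resp k (p i) (v i)

  Ord≥-0# : ∀ k e → Ord≥ k e (CommutativeRing.0# (Ring k))
  Ord≥-0# zero e l = R.refl
  Ord≥-0# (suc k) e i = Ord≥-0# k (e ∸ i)

  Ord≥-+ : ∀ k {e F G} → Ord≥ k e F → Ord≥ k e G → Ord≥ k e (CommutativeRing._+_ (Ring k) F G)
  Ord≥-+ zero p q l = R.trans (R.+-cong (p l) (q l)) (R.+-identityˡ _)
  Ord≥-+ (suc k) p q i = Ord≥-+ k (p i) (q i)

  Ord≥-neg : ∀ k {e F} → Ord≥ k e F → Ord≥ k e (CommutativeRing.-_ (Ring k) F)
  Ord≥-neg zero p l = R.trans (R.-‿cong (p l)) (RingProps.-0#≈0# R.ring)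
  Ord≥-neg (suc k) p i = Ord≥-neg k (p i)

  Ord≥-≤ : ∀ k {e e′ F} → e′ ≤ℕ e → Ord≥ k e F → Ord≥ k e′ F
  Ord≥-≤ zero q p l = p (ℕₚ.≤-trans l q)
  Ord≥-≤ (suc k) q p i = Ord≥-≤ k (ℕₚ.∸-monoˡ-≤ i q) (p i)

  Ord≥0 : ∀ k F → Ord≥ k 0 F
  Ord≥0 zero F ()
  Ord≥0 (suc k) F i = subst (λ e → Ord≥ k e (F i)) (sym (ℕₚ.0∸n≡0 i)) (Ord≥0 k (F i))

  -- Induction along the recursion of the product: its first term lowers `b`, its tail lowers `a` by
  -- one.
  Ord≥-* : ∀ k a b {F G} → Ord≥ k a F → Ord≥ k b G → Ord≥ k (a +ℕ b) (CommutativeRing._*_ (Ring k) F G)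
  Ord≥-* zero zero b {F} p q l = R.trans (R.*-congˡ (q l)) (R.zeroʳ F)
  Ord≥-* zero (suc a) b {F} {G} p q l = R.trans (R.*-congʳ (p (s≤s z≤n))) (R.zeroˡ G)
  Ord≥-* (suc k) a b p q zero = Ord≥-* k a b (p 0) (q 0)
  Ord≥-* (suc k) a b {F} {G} p q (suc i) = Ord≥-+ k
    (Ord≥-≤ k (bound₁ a) (Ord≥-* k a (b ∸ suc i) (p 0) (q (suc i))))
    (Ord≥-≤ k (bound₂ a) (Ord≥-* (suc k) (a ∸ 1) b {λ j → F (suc j)} (λ j → subst (λ e → Ord≥ k e (F (suc j))) (sym (ℕₚ.∸-+-assoc a 1 j)) (p (suc j))) q i))
    where
    bound₁ : ∀ a → a +ℕ b ∸ suc i ≤ℕ a +ℕ (b ∸ suc i)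
    bound₁ a = ℕₚ.≤-trans (ℕₚ.∸-monoˡ-≤ (suc i) (ℕₚ.+-monoʳ-≤ a (ℕₚ.m≤n+m∸n b (suc i))))
      (ℕₚ.≤-reflexive (trans (cong (_∸ suc i) (trans (sym (ℕₚ.+-assoc a (suc i) _)) (trans (cong (_+ℕ (b ∸ suc i)) (ℕₚ.+-comm a (suc i))) (ℕₚ.+-assoc (suc i) a _)))) (ℕₚ.m+n∸m≡n (suc i) _)))
    bound₂ : ∀ a → a +ℕ b ∸ suc i ≤ℕ (a ∸ 1) +ℕ b ∸ i
    bound₂ zero = ℕₚ.∸-monoʳ-≤ b (ℕₚ.n≤1+n i)
    bound₂ (suc a) = ℕₚ.≤-refl

  -- Ring k modulo the ideal of the series of order greater than d.
  truncRing : ℕ → ℕ → CommutativeRing 0ℓ 0ℓ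
  truncRing k d = commutativeRing record
    { C = Carrier ; _≈_ = λ x y → Ord≥ k (suc d) (x - y) ; _+_ = _+_ ; _*_ = _*_ ; -_ = -_ ; 0# = 0# ; 1# = 1#
    ; isEquivalence = record
      { refl = exact ≈-refl
      ; sym = λ {x} {y} p → Ord≥-resp k (⁻¹-anti-homo-// x y) (Ord≥-neg k p)
      ; trans = λ {x} {y} {z} p q → Ord≥-resp k (telescope x y z) (Ord≥-+ k p q)
      }
    ; +-cong = λ {a} {b} {c} {d} p q → Ord≥-resp k (≈-trans (interchange a (- b) c (- d)) (+-congˡ (-‿+-comm b d))) (Ord≥-+ k p q)
    -- `a c - b e = (a - b) c + b (c - e)`, and the ideal absorbs products.
    ; *-cong = λ {a} {b} {c} {e} p q → Ord≥-resp k (product a b c e)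
        (Ord≥-+ k (Ord≥-≤ k (ℕₚ.m≤m+n _ _) (Ord≥-* k (suc d) 0 p (Ord≥0 k c))) (Ord≥-* k 0 (suc d) (Ord≥0 k b) q))
    ; -‿cong = λ {a} {b} p → Ord≥-resp k (≈-sym (-‿+-comm a (- b))) (Ord≥-neg k p)
    ; +-assoc = λ a b c → exact (+-assoc a b c)
    ; +-comm = λ a b → exact (+-comm a b)
    ; +-identityˡ = λ a → exact (+-identityˡ a)
    ; -‿inverseˡ = λ a → exact (-‿inverseˡ a)
    ; *-assoc = λ a b c → exact (*-assoc a b c)
    ; *-comm = λ a b → exact (*-comm a b)
    ; *-identityˡ = λ a → exact (*-identityˡ a)
    ; distribʳ = λ a b c → exact (distribʳ a b c)
    }
    where
    open CommutativeRing (Ring k) renaming (refl to ≈-refl; sym to ≈-sym; trans to ≈-trans)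
    open RingProps ring using (-‿+-comm; ⁻¹-anti-homo-//; -‿distribˡ-*; -‿distribʳ-*; x[y-z]≈xy-xz; [y-z]x≈yx-zx)
    open CSProps +-commutativeSemigroup using (interchange)
    exact : ∀ {x y} → x ≈ y → Ord≥ k (suc d) (x - y)
    exact {x} {y} p = Ord≥-resp k (≈-sym (≈-trans (+-congʳ p) (-‿inverseʳ y))) (Ord≥-0# k (suc d))
    telescope : ∀ x y z → (x - y) + (y - z) ≈ x - z
    telescope x y z = ≈-trans (+-assoc x (- y) (y - z)) (+-congˡ (≈-trans (≈-sym (+-assoc (- y) y (- z)))
      (≈-trans (+-congʳ (-‿inverseˡ y)) (+-identityˡ (- z)))))
    product : ∀ a b c e → (a - b) * c + b * (c - e) ≈ a * c - b * e
    product a b c e = ≈-trans (+-cong ([y-z]x≈yx-zx c a b) (x[y-z]≈xy-xz b c e)) (telescope (a * c) (b * c) (b * e))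

  exact⇒trunc : ∀ k d {x y} → CommutativeRing._≈_ (Ring k) x y → CommutativeRing._≈_ (truncRing k d) x y
  exact⇒trunc k d {x} {y} p = Ord≥-resp k (≈-sym (≈-trans (+-congʳ p) (-‿inverseʳ y))) (Ord≥-0# k (suc d))
    where open CommutativeRing (Ring k) renaming (sym to ≈-sym; trans to ≈-trans)

  coeff : ∀ k → ⟨ k ⟩ → List ℕ → R.Carrier
  coeff zero F _ = F
  coeff (suc k) F [] = R.0#
  coeff (suc k) F (a ∷ α) = coeff k (F a) α

  coeff-cong : ∀ k {F G} α → CommutativeRing._≈_ (Ring k) F G → coeff k F α R.≈ coeff k G α
  coeff-cong zero α p = p
  coeff-cong (suc k) [] p = R.refl
  coeff-cong (suc k) (a ∷ α) p = coeff-cong k α (p a)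

  coeff-+ : ∀ k F G α → coeff k (CommutativeRing._+_ (Ring k) F G) α R.≈ coeff k F α R.+ coeff k G α
  coeff-+ zero F G α = R.refl
  coeff-+ (suc k) F G [] = R.sym (R.+-identityˡ _)
  coeff-+ (suc k) F G (a ∷ α) = coeff-+ k (F a) (G a) α

  coeff-neg : ∀ k F α → coeff k (CommutativeRing.-_ (Ring k) F) α R.≈ R.- coeff k F α
  coeff-neg zero F α = R.refl
  coeff-neg (suc k) F [] = R.sym (RingProps.-0#≈0# R.ring)
  coeff-neg (suc k) F (a ∷ α) = coeff-neg k (F a) α

  coeff-0 : ∀ k α → coeff k (CommutativeRing.0# (Ring k)) α R.≈ R.0#
  coeff-0 zero α = R.refl
  coeff-0 (suc k) [] = R.refl
  coeff-0 (suc k) (a ∷ α) = coeff-0 k α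

  coeff-∑ : ∀ k {X : Set} (xs : List X) (f : X → ⟨ k ⟩) α → coeff k (Sums.∑ (Ring k) xs f) α R.≈ ∑ xs (λ x → coeff k (f x) α)
  coeff-∑ k [] f α = coeff-0 k α
  coeff-∑ k (x ∷ xs) f α = R.trans (coeff-+ k (f x) _ α) (R.+-congˡ (coeff-∑ k xs f α))

  coeff-Ord≥ : ∀ k {e F} α → Ord≥ k e F → sum α <ℕ e → coeff k F α R.≈ R.0#
  coeff-Ord≥ zero {suc e} α v l = v (s≤s z≤n)
  coeff-Ord≥ (suc k) [] v l = R.refl
  coeff-Ord≥ (suc k) {e} (a ∷ α) v l = coeff-Ord≥ k α (v a)
    (ℕₚ.m+n≤o⇒m≤o∸n (suc (sum α)) (subst (_≤ℕ e) (cong suc (ℕₚ.+-comm a (sum α))) l))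

  -- The quotient forgets only coefficients of degree above `d`.
  coeff-trunc : ∀ k {d F G} α → CommutativeRing._≈_ (truncRing k d) F G → sum α ≤ℕ d → coeff k F α R.≈ coeff k G α
  coeff-trunc k {d} {F} {G} α p l = RingProps.x∙y⁻¹≈ε⇒x≈y R.ring _ _
    (R.trans (R.+-congˡ (R.sym (coeff-neg k G α))) (R.trans (R.sym (coeff-+ k F _ α)) (coeff-Ord≥ k α p (s≤s l))))

  infixr 7 _•_
  _•_ : ∀ {k} → R.Carrier → ⟨ k ⟩ → ⟨ k ⟩
  _•_ {zero} c F = c R.* F
  _•_ {suc k} c F = λ i → _•_ {k} c (F i)

  module _ where
    open CommutativeRing using (_≈_)

    •-cong : ∀ k {a b F G} → a R.≈ b → _≈_ (Ring k) F G → _≈_ (Ring k) (_•_ {k} a F) (_•_ {k} b G)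
    •-cong zero p q = R.*-cong p q
    •-cong (suc k) p q i = •-cong k p (q i)

    •-+ʳ : ∀ k c F G → _≈_ (Ring k) (_•_ {k} c (CommutativeRing._+_ (Ring k) F G)) (CommutativeRing._+_ (Ring k) (_•_ {k} c F) (_•_ {k} c G))
    •-+ʳ zero c F G = R.distribˡ c F G
    •-+ʳ (suc k) c F G i = •-+ʳ k c (F i) (G i)

    •-+ˡ : ∀ k a b F → _≈_ (Ring k) (_•_ {k} (a R.+ b) F) (CommutativeRing._+_ (Ring k) (_•_ {k} a F) (_•_ {k} b F))
    •-+ˡ zero a b F = R.distribʳ F a b
    •-+ˡ (suc k) a b F i = •-+ˡ k a b (F i)

    •-1 : ∀ k F → _≈_ (Ring k) (_•_ {k} R.1# F) F
    •-1 zero F = R.*-identityˡ F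
    •-1 (suc k) F i = •-1 k (F i)

    •-0 : ∀ k F → _≈_ (Ring k) (_•_ {k} R.0# F) (CommutativeRing.0# (Ring k))
    •-0 zero F = R.zeroˡ F
    •-0 (suc k) F i = •-0 k (F i)

    •-* : ∀ k a b F G → _≈_ (Ring k) (CommutativeRing._*_ (Ring k) (_•_ {k} a F) (_•_ {k} b G)) (_•_ {k} (a R.* b) (CommutativeRing._*_ (Ring k) F G))
    •-* zero a b F G = CSProps.interchange R.*-commutativeSemigroup a F b G
    •-* (suc k) a b F G zero = •-* k a b (F 0) (G 0)
    •-* (suc k) a b F G (suc i) = Rk.trans (Rk.+-cong (•-* k a b (F 0) (G (suc i))) (•-* (suc k) a b (λ j → F (suc j)) G i))
      (Rk.sym (•-+ʳ k _ _ _))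
      where module Rk = CommutativeRing (Ring k)

    •-⊛ : ∀ k f g U V i → _≈_ (Ring k) (PowerSeries._⊛_ (Ring k) (λ j → _•_ {k} (f j) U) (λ j → _•_ {k} (g j) V) i)
      (_•_ {k} (PowerSeries._⊛_ R f g i) (CommutativeRing._*_ (Ring k) U V))
    •-⊛ k f g U V zero = •-* k _ _ U V
    •-⊛ k f g U V (suc i) = Rk.trans (Rk.+-cong (•-* k _ _ U V) (•-⊛ k (λ j → f (suc j)) g U V i)) (Rk.sym (•-+ˡ k _ _ _))
      where module Rk = CommutativeRing (Ring k)

  coeff-• : ∀ k c F α → coeff k (_•_ {k} c F) α R.≈ c R.* coeff k F α
  coeff-• zero c F α = R.refl
  coeff-• (suc k) c F [] = R.sym (R.zeroʳ c)
  coeff-• (suc k) c F (a ∷ α) = coeff-• k c (F a) α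

  Ord≥-• : ∀ k {e} c F → Ord≥ k e F → Ord≥ k e (_•_ {k} c F)
  Ord≥-• zero c F v l = R.trans (R.*-congˡ (v l)) (R.zeroʳ c)
  Ord≥-• (suc k) c F v i = Ord≥-• k c (F i) (v i)

  -- ev k f = ∏ f(xᵢ) over the k variables xᵢ.
  ev : ∀ k → (ℕ → R.Carrier) → ⟨ k ⟩
  ev zero f = R.1#
  ev (suc k) f i = _•_ {k} (f i) (ev k f)

  ev-cong : ∀ k {f g} → (∀ i → f i R.≈ g i) → CommutativeRing._≈_ (Ring k) (ev k f) (ev k g)
  ev-cong zero p = R.refl
  ev-cong (suc k) p i = •-cong k (p i) (ev-cong k p)

  -- This turns an identity between products of series in one variable into one in `k` variables.
  ev-* : ∀ k f g → CommutativeRing._≈_ (Ring k) (ev k (PowerSeries._⊛_ R f g)) (CommutativeRing._*_ (Ring k) (ev k f) (ev k g))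
  ev-* zero f g = R.sym (R.*-identityˡ R.1#)
  ev-* (suc k) f g i = Rk.trans (•-cong k R.refl (ev-* k f g)) (Rk.sym (•-⊛ k f g (ev k f) (ev k g) i))
    where module Rk = CommutativeRing (Ring k)

  ev-1 : ∀ k → CommutativeRing._≈_ (Ring k) (ev k (PowerSeries.one R)) (CommutativeRing.1# (Ring k))
  ev-1 zero = R.refl
  ev-1 (suc k) zero = CommutativeRing.trans (Ring k) (•-1 k _) (ev-1 k)
  ev-1 (suc k) (suc i) = •-0 k _

  -- A monomial of total degree at most `d` involves only the coefficients of `f` up to `d`.
  ev-trunc : ∀ k d {f g} → (∀ i → i ≤ℕ d → f i R.≈ g i) → CommutativeRing._≈_ (truncRing k d) (ev k f) (ev k g)
  ev-trunc zero d p _ = R.-‿inverseʳ R.1#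
  ev-trunc (suc k) d {f} {g} p i with i ℕₚ.≤? d
  ... | yes i≤d = Ord≥-resp k (Rk.trans (•-+ʳ k (f i) _ _) (Rk.+-cong Rk.refl
          (Rk.trans (neg-• k (f i) (ev k g)) (Rk.-‿cong (•-cong k (p i i≤d) Rk.refl)))))
        (Ord≥-• k (f i) _ (Ord≥-≤ k (ℕₚ.m∸n≤m (suc d) i) (ev-trunc k d p)))
    where
    module Rk = CommutativeRing (Ring k)
    neg-• : ∀ k c F → CommutativeRing._≈_ (Ring k) (_•_ {k} c (CommutativeRing.-_ (Ring k) F)) (CommutativeRing.-_ (Ring k) (_•_ {k} c F))
    neg-• zero c F = R.sym (RingProps.-‿distribʳ-* R.ring c F)
    neg-• (suc k) c F i = neg-• k c (F i)
  ... | no i≰d = subst (λ e → Ord≥ k e difference) (sym (ℕₚ.m≤n⇒m∸n≡0 (ℕₚ.≰⇒> i≰d))) (Ord≥0 k difference)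
    where
    difference : ⟨ k ⟩
    difference = CommutativeRing._-_ (Ring k) (_•_ {k} (f i) (ev k f)) (_•_ {k} (g i) (ev k g))

  coeff-ev : ∀ k f α → length α ≡ k → coeff k (ev k f) α R.≈ ∏ α f
  coeff-ev zero f [] _ = R.refl
  coeff-ev (suc k) f (a ∷ α) e = R.trans (coeff-• k (f a) (ev k f) α) (R.*-congˡ (coeff-ev k f α (ℕₚ.suc-injective e)))

  -- The coefficients of `1/(1 - tˡ)`; hence `ev k (geo l)` is `1 + p̄'_l` in `k` variables.
  geo : ℕ → ℕ → R.Carrier
  geo l i = ⟦ does (l ∣? i) ⟧

  ∑-multiples : ∀ l a (Y : ℕ → R.Carrier) → ∑ (upTo (suc a)) (λ i → geo (suc l) i R.* Y (a ∸ i))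
    R.≈ ∑ (upTo (suc a)) (λ b → ⟦ (suc l *ℕ b) ≤ᵇ a ⟧ R.* Y (a ∸ suc l *ℕ b))
  ∑-multiples l a Y = R.trans (R.sym (∑-filter (suc l ∣?_) (upTo (suc a)) (λ i → Y (a ∸ i))))
    (R.trans (∑-bij (DivMod._/ suc l) (suc l *ℕ_)
       (Uniqueₚ.filter⁺ (suc l ∣?_) (Uniqueₚ.upTo⁺ (suc a)))
       (Uniqueₚ.filter⁺ (λ b → T? ((suc l *ℕ b) ≤ᵇ a)) (Uniqueₚ.upTo⁺ (suc a))) to from
       (λ i∈ → R.reflexive (cong (λ j → Y (a ∸ j)) (sym (proj₂ (to i∈))))))
     (∑-filterᵇ (λ b → (suc l *ℕ b) ≤ᵇ a) (upTo (suc a)) (λ b → Y (a ∸ suc l *ℕ b))))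
    where
    to : ∀ {i} → i ∈ filter (suc l ∣?_) (upTo (suc a)) →
      (i DivMod./ suc l) ∈ filterᵇ (λ b → (suc l *ℕ b) ≤ᵇ a) (upTo (suc a)) × suc l *ℕ (i DivMod./ suc l) ≡ i
    to {i} i∈ with ∈-filter⁻ (suc l ∣?_) {xs = upTo (suc a)} i∈
    ... | i∈upTo , l∣i = ∈-filter⁺ (λ b → T? ((suc l *ℕ b) ≤ᵇ a)) (∈-upTo⁺ (ℕₚ.≤-<-trans (DivMod.m/n≤m i (suc l)) (∈-upTo⁻ i∈upTo)))
        (ℕₚ.≤⇒≤ᵇ (subst (_≤ℕ a) (sym e) (ℕₚ.≤-pred (∈-upTo⁻ i∈upTo)))) , e
      where
      e : suc l *ℕ (i DivMod./ suc l) ≡ i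
      e = trans (ℕₚ.*-comm (suc l) _) (DivMod.m/n*n≡m l∣i)
    from : ∀ {b} → b ∈ filterᵇ (λ b → (suc l *ℕ b) ≤ᵇ a) (upTo (suc a)) →
      suc l *ℕ b ∈ filter (suc l ∣?_) (upTo (suc a)) × (suc l *ℕ b) DivMod./ suc l ≡ b
    from {b} b∈ with ∈-filter⁻ (λ b → T? ((suc l *ℕ b) ≤ᵇ a)) {xs = upTo (suc a)} b∈
    ... | _ , p = ∈-filter⁺ (suc l ∣?_) (∈-upTo⁺ (s≤s (ℕₚ.≤ᵇ⇒≤ _ _ p))) (Divₚ.m∣m*n b)
      , trans (cong (DivMod._/ suc l) (ℕₚ.*-comm (suc l) b)) (DivMod.m*n/n≡m b (suc l))

  -- The sum over `β` is the expansion of `∏ 1/(1 - xᵢˡ)` into the monomials `x^(lβ)`; one variable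
  -- is split off at a time.
  coeff-geo-* : ∀ l k F α → length α ≡ k → coeff k (CommutativeRing._*_ (Ring k) (ev k (geo (suc l))) F) α
    R.≈ ∑ (boxes α) (λ β → ⟦ fits (suc l) α β ⟧ R.* coeff k F (α ∸⟨ suc l ⟩ β))
  coeff-geo-* l zero F [] e = R.sym (R.+-identityʳ _)
  coeff-geo-* l (suc k) F (a ∷ α) e = begin
    coeff k (PowerSeries._⊛_ (Ring k) (ev (suc k) (geo (suc l))) F a) α
      ≈⟨ coeff-cong k α (PowerSeries.⊛-sum (Ring k) (ev (suc k) (geo (suc l))) F a) ⟩
    coeff k (Sums.∑ (Ring k) (upTo (suc a)) (λ i → CommutativeRing._*_ (Ring k) (_•_ {k} (geo (suc l) i) U) (F (a ∸ i)))) α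
      ≈⟨ coeff-∑ k (upTo (suc a)) _ α ⟩
    ∑ (upTo (suc a)) (λ i → coeff k (CommutativeRing._*_ (Ring k) (_•_ {k} (geo (suc l) i) U) (F (a ∸ i))) α)
      ≈⟨ ∑-cong (upTo (suc a)) (λ {i} _ → R.trans (coeff-cong k α (•-*ˡ (geo (suc l) i) (F (a ∸ i))))
           (coeff-• k (geo (suc l) i) _ α)) ⟩
    ∑ (upTo (suc a)) (λ i → geo (suc l) i R.* Y (a ∸ i))
      ≈⟨ ∑-multiples l a Y ⟩
    ∑ (upTo (suc a)) (λ b → ⟦ (suc l *ℕ b) ≤ᵇ a ⟧ R.* Y (a ∸ suc l *ℕ b))
      ≈⟨ ∑-cong (upTo (suc a)) (λ {b} _ → R.trans (R.*-congˡ (coeff-geo-* l k (F (a ∸ suc l *ℕ b)) α (ℕₚ.suc-injective e)))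
           (R.trans (∑-*ˡ _ (boxes α) _) (R.sym (R.trans (∑-map (b ∷_) (boxes α) _)
             (∑-cong (boxes α) (λ {β} _ → R.trans (R.*-congʳ (⟦⟧-∧ ((suc l *ℕ b) ≤ᵇ a) (fits (suc l) α β))) (R.*-assoc _ _ _))))))) ⟩
    ∑ (upTo (suc a)) (λ b → ∑ (map (b ∷_) (boxes α)) (λ β → ⟦ fits (suc l) (a ∷ α) β ⟧ R.* coeff (suc k) F ((a ∷ α) ∸⟨ suc l ⟩ β)))
      ≈⟨ ∑-concatMap (λ b → map (b ∷_) (boxes α)) (upTo (suc a)) _ ⟨
    ∑ (boxes (a ∷ α)) (λ β → ⟦ fits (suc l) (a ∷ α) β ⟧ R.* coeff (suc k) F ((a ∷ α) ∸⟨ suc l ⟩ β)) ∎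
    where
    open SetoidReasoning R.setoid
    module Rk = CommutativeRing (Ring k)
    U : ⟨ k ⟩
    U = ev k (geo (suc l))
    Y : ℕ → R.Carrier
    Y j = coeff k (CommutativeRing._*_ (Ring k) U (F j)) α
    •-*ˡ : ∀ c X → CommutativeRing._≈_ (Ring k) (CommutativeRing._*_ (Ring k) (_•_ {k} c U) X) (_•_ {k} c (CommutativeRing._*_ (Ring k) U X))
    •-*ˡ c X = Rk.trans (Rk.*-congˡ (Rk.sym (•-1 k X))) (Rk.trans (•-* k c R.1# U X) (•-cong k (R.*-identityʳ c) Rk.refl))

  -- Only `β = 0` survives, the term that subtracting `1` removes from `1 + p̄'_l`.
  ∑-boxes-zero : ∀ l α (Y : List ℕ → R.Carrier) →
    ∑ (boxes α) (λ β → ⟦ not (nonzero β) ∧ fits l α β ⟧ R.* Y (α ∸⟨ l ⟩ β)) R.≈ Y α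
  ∑-boxes-zero l [] Y = R.trans (R.+-identityʳ _) (R.*-identityˡ _)
  ∑-boxes-zero l (a ∷ α) Y = R.trans (∑-concatMap (λ b → map (b ∷_) (boxes α)) (upTo (suc a)) _)
    (R.trans (R.+-cong first (∑-0 (applyUpTo suc a) (λ b∈ → rest (∈-applyUpTo⁻ suc b∈)))) (R.+-identityʳ _))
    where
    term : List ℕ → R.Carrier
    term β = ⟦ not (nonzero β) ∧ fits l (a ∷ α) β ⟧ R.* Y ((a ∷ α) ∸⟨ l ⟩ β)
    first : ∑ (map (0 ∷_) (boxes α)) term R.≈ Y (a ∷ α)
    first = R.trans (∑-map (0 ∷_) (boxes α) term)
      (R.trans (∑-cong (boxes α) (λ {β} _ → R.reflexive (simplify β))) (∑-boxes-zero l α (λ γ → Y (a ∷ γ))))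
      where
      simplify : ∀ β → term (0 ∷ β) ≡ ⟦ not (nonzero β) ∧ fits l α β ⟧ R.* Y (a ∷ (α ∸⟨ l ⟩ β))
      simplify β rewrite ℕₚ.*-zeroʳ l = refl
    rest : ∀ {b} → ∃[ i ] (i <ℕ a × b ≡ suc i) → ∑ (map (b ∷_) (boxes α)) term R.≈ R.0#
    rest (i , _ , refl) = R.trans (∑-map (suc i ∷_) (boxes α) term) (∑-0 (boxes α) (λ _ → R.zeroˡ _))

  pbar : ∀ k → ℕ → ⟨ k ⟩
  pbar k l = CommutativeRing._-_ (Ring k) (ev k (geo l)) (CommutativeRing.1# (Ring k))

  pbars : ∀ k → List ℕ → ⟨ k ⟩
  pbars k μ = Sums.∏ (Ring k) μ (pbar k)

  coeff-pbar-* : ∀ l k F α → length α ≡ k → coeff k (CommutativeRing._*_ (Ring k) (pbar k (suc l)) F) α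
    R.≈ ∑ (boxes α) (λ β → ⟦ nonzero β ∧ fits (suc l) α β ⟧ R.* coeff k F (α ∸⟨ suc l ⟩ β))
  coeff-pbar-* l k F α e = begin
    coeff k ((U Rk.- Rk.1#) Rk.* F) α
      ≈⟨ coeff-cong k α (Rk.trans ([y-z]x≈yx-zx F U Rk.1#) (Rk.+-congˡ (Rk.-‿cong (Rk.*-identityˡ F)))) ⟩
    coeff k (U Rk.* F Rk.- F) α
      ≈⟨ R.trans (coeff-+ k (U Rk.* F) (Rk.- F) α) (R.+-cong (coeff-geo-* l k F α e) (coeff-neg k F α)) ⟩
    ∑ (boxes α) (λ β → ⟦ fits (suc l) α β ⟧ R.* Y β) R.- coeff k F α
      ≈⟨ R.+-congʳ (R.trans (∑-cong (boxes α) (λ {β} _ → R.trans (R.*-congʳ (split (nonzero β) (fits (suc l) α β))) (R.distribʳ _ _ _)))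
           (∑-+ (boxes α) _ _)) ⟩
    (∑ (boxes α) (λ β → ⟦ nonzero β ∧ fits (suc l) α β ⟧ R.* Y β)
      R.+ ∑ (boxes α) (λ β → ⟦ not (nonzero β) ∧ fits (suc l) α β ⟧ R.* Y β)) R.- coeff k F α
      ≈⟨ R.+-congʳ (R.+-congˡ (∑-boxes-zero (suc l) α (coeff k F))) ⟩
    (∑ (boxes α) (λ β → ⟦ nonzero β ∧ fits (suc l) α β ⟧ R.* Y β) R.+ coeff k F α) R.- coeff k F α
      ≈⟨ R.trans (R.+-assoc _ _ _) (R.trans (R.+-congˡ (R.-‿inverseʳ _)) (R.+-identityʳ _)) ⟩
    ∑ (boxes α) (λ β → ⟦ nonzero β ∧ fits (suc l) α β ⟧ R.* Y β) ∎
    where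
    open SetoidReasoning R.setoid
    module Rk = CommutativeRing (Ring k)
    open RingProps Rk.ring using ([y-z]x≈yx-zx)
    U : ⟨ k ⟩
    U = ev k (geo (suc l))
    Y : List ℕ → R.Carrier
    Y β = coeff k F (α ∸⟨ suc l ⟩ β)
    split : ∀ p q → ⟦ q ⟧ R.≈ ⟦ p ∧ q ⟧ R.+ ⟦ not p ∧ q ⟧
    split true q = R.sym (R.+-identityʳ _)
    split false q = R.sym (R.+-identityˡ _)

  boxes-length : ∀ α {β} → β ∈ boxes α → length β ≡ length α
  boxes-length [] (here refl) = refl
  boxes-length (a ∷ α) β∈ with satisfied (∈-concatMap⁻ (λ b → map (b ∷_) (boxes α)) {xs = upTo (suc a)} β∈)
  ... | b , β∈map with ∈-map⁻ (b ∷_) β∈map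
  ...   | β′ , β′∈ , refl = cong suc (boxes-length α β′∈)

  ∸⟨⟩-length : ∀ l α β → length β ≡ length α → length (α ∸⟨ l ⟩ β) ≡ length α
  ∸⟨⟩-length l α β e = trans (Listₚ.length-zipWith _∸_ α (map (l *ℕ_) β))
    (trans (cong (length α ⊓_) (trans (Listₚ.length-map (l *ℕ_) β) e)) (ℕₚ.⊓-idem (length α)))

  natR-sum : ∀ {X : Set} (h : X → ℕ) xs → natR (sum (map h xs)) R.≈ ∑ xs (λ x → natR (h x))
  natR-sum h [] = R.refl
  natR-sum h (x ∷ xs) = R.trans (natR-+ (h x) _) (R.+-congˡ (natR-sum h xs))

  -- Identifies the recursively defined `coefP` with coefficients of an honest product of series, so
  -- that ring identities can be used.
  coeff-pbars : ∀ k μ → All (1 ≤ℕ_) μ → ∀ α → length α ≡ k → coeff k (pbars k μ) α R.≈ natR (coefP μ α)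
  coeff-pbars k [] [] α e = coeff-1 k α e
    where
    coeff-1 : ∀ k α → length α ≡ k → coeff k (CommutativeRing.1# (Ring k)) α R.≈ natR (coefP [] α)
    coeff-1 zero [] e = R.sym (R.+-identityʳ R.1#)
    coeff-1 (suc k) (zero ∷ α) e = coeff-1 k α (ℕₚ.suc-injective e)
    coeff-1 (suc k) (suc a ∷ α) e = coeff-0 k α
  coeff-pbars k (suc l ∷ μ) (_ ∷ ps) α e = R.trans (coeff-pbar-* l k (pbars k μ) α e)
    (R.trans (R.sym (∑-filterᵇ (λ β → nonzero β ∧ fits (suc l) α β) (boxes α) _))
      (R.trans (∑-cong (filterᵇ _ (boxes α)) (λ {β} β∈ → coeff-pbars k μ ps (α ∸⟨ suc l ⟩ β)
          (trans (∸⟨⟩-length (suc l) α β (boxes-length α (proj₁ (∈-filter⁻ _ {xs = boxes α} β∈)))) e)))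
        (R.sym (natR-sum (λ β → coefP μ (α ∸⟨ suc l ⟩ β)) (filterᵇ _ (boxes α))))))

-- Boolean tests as propositions.

module BooleanReasoning where

  ⇔⇒≡ : ∀ {a b : Bool} → (a ≡ true → b ≡ true) → (b ≡ true → a ≡ true) → a ≡ b
  ⇔⇒≡ {true} {b} f g = sym (f refl)
  ⇔⇒≡ {false} {true} f g = g refl
  ⇔⇒≡ {false} {false} f g = refl

  ∧⁻ : ∀ {a b} → a ∧ b ≡ true → a ≡ true × b ≡ true
  ∧⁻ {true} {true} _ = refl , refl

  ∧⁺ : ∀ {a b} → a ≡ true → b ≡ true → a ∧ b ≡ true
  ∧⁺ refl refl = refl

  ∨-not⁻ : ∀ {a b} → a ∨ not b ≡ true → b ≡ true → a ≡ true
  ∨-not⁻ {true} _ _ = refl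
  ∨-not⁻ {false} {false} _ ()

  ∨-not⁺ : ∀ {a b} → (b ≡ true → a ≡ true) → a ∨ not b ≡ true
  ∨-not⁺ {true} _ = refl
  ∨-not⁺ {false} {false} _ = refl
  ∨-not⁺ {false} {true} f = f refl

  not-∨⁺ : ∀ {a b} → (b ≡ true → a ≡ true) → not b ∨ a ≡ true
  not-∨⁺ {b = true} f = f refl
  not-∨⁺ {b = false} f = refl

  not⁻ : ∀ {a} → not a ≡ true → a ≢ true
  not⁻ {false} _ ()

  not⁺ : ∀ {a} → a ≢ true → not a ≡ true
  not⁺ {true} f = ⊥-elim (f refl)
  not⁺ {false} _ = refl

  module _ {X : Set} (p : X → Bool) where

    all⁻ : ∀ {xs x} → all p xs ≡ true → x ∈ xs → p x ≡ true
    all⁻ e (here refl) = proj₁ (∧⁻ e)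
    all⁻ {x ∷ xs} e (there x∈) = all⁻ (proj₂ (∧⁻ {p x} e)) x∈

    all⁺ : ∀ xs → (∀ {x} → x ∈ xs → p x ≡ true) → all p xs ≡ true
    all⁺ [] h = refl
    all⁺ (x ∷ xs) h = ∧⁺ (h (here refl)) (all⁺ xs (h ∘ there))

    any⁻ : ∀ xs → any p xs ≡ true → ∃[ x ] (x ∈ xs × p x ≡ true)
    any⁻ (x ∷ xs) e with p x in q
    ... | true = x , here refl , q
    ... | false with any⁻ xs e
    ...   | y , y∈ , r = y , there y∈ , r

    any⁺ : ∀ {xs x} → x ∈ xs → p x ≡ true → any p xs ≡ true
    any⁺ (here refl) e rewrite e = refl
    any⁺ {y ∷ xs} (there x∈) e with p y
    ... | true = refl
    ... | false = any⁺ x∈ e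

  allFin⁻ : ∀ {k} (p : Fin k → Bool) → all p (allFin k) ≡ true → ∀ i → p i ≡ true
  allFin⁻ p e i = all⁻ p e (∈-allFin i)

  allFin⁺ : ∀ {k} (p : Fin k → Bool) → (∀ i → p i ≡ true) → all p (allFin k) ≡ true
  allFin⁺ {k} p h = all⁺ p (allFin k) (λ {i} _ → h i)

  does⁻ : ∀ {P : Set} (P? : Dec P) → does P? ≡ true → P
  does⁻ (yes p) _ = p

  does⁺ : ∀ {P : Set} (P? : Dec P) → P → does P? ≡ true
  does⁺ (yes _) _ = refl
  does⁺ (no ¬p) p = ⊥-elim (¬p p)

open BooleanReasoning

-- Enumerations of words, and the removal of maximal pieces.

module WordLists {n : ℕ} (G : SimpleGraph n) where
  open HeapWords G
  open LyndonHeaps G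

  words : ℕ → List (Word n)
  words zero = [] ∷ []
  words (suc m) = cartesianProductWith _∷_ (allFin n) (words m)

  words-unique : ∀ m → Unique (words m)
  words-unique zero = [] ∷ []
  words-unique (suc m) = Uniqueₚ.cartesianProductWith⁺ _∷_ Listₚ.∷-injective (Uniqueₚ.allFin⁺ n) (words-unique m)

  ∈-words : ∀ w → w ∈ words (length w)
  ∈-words [] = here refl
  ∈-words (x ∷ w) = ∈-cartesianProductWith⁺ _∷_ (∈-allFin x) (∈-words w)

  words-length : ∀ m {w} → w ∈ words m → length w ≡ m
  words-length zero (here refl) = refl
  words-length (suc m) w∈ with ∈-cartesianProductWith⁻ _∷_ (allFin n) (words m) w∈
  ... | x , w , _ , w∈′ , refl = cong suc (words-length m w∈′)

  words≤ : ℕ → List (Word n)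
  words≤ zero = [] ∷ []
  words≤ (suc N) = [] ∷ cartesianProductWith _∷_ (allFin n) (words≤ N)

  words≤-unique : ∀ N → Unique (words≤ N)
  words≤-unique zero = [] ∷ []
  words≤-unique (suc N) = All.tabulate (λ w∈ e → nonempty (∈-cartesianProductWith⁻ _∷_ (allFin n) (words≤ N) w∈) e)
    ∷ Uniqueₚ.cartesianProductWith⁺ _∷_ Listₚ.∷-injective (Uniqueₚ.allFin⁺ n) (words≤-unique N)
    where
    nonempty : ∀ {w} → ∃[ x ] ∃[ v ] (x ∈ allFin n × v ∈ words≤ N × w ≡ x ∷ v) → [] ≢ w
    nonempty (_ , _ , _ , _ , refl) ()

  ∈-words≤ : ∀ N w → length w ≤ℕ N → w ∈ words≤ N
  ∈-words≤ zero [] _ = here refl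
  ∈-words≤ (suc N) [] _ = here refl
  ∈-words≤ (suc N) (x ∷ w) (s≤s l) = there (∈-cartesianProductWith⁺ _∷_ (∈-allFin x) (∈-words≤ N w l))

  words≤-length : ∀ N {w} → w ∈ words≤ N → length w ≤ℕ N
  words≤-length zero (here refl) = z≤n
  words≤-length (suc N) (here refl) = z≤n
  words≤-length (suc N) (there w∈) with ∈-cartesianProductWith⁻ _∷_ (allFin n) (words≤ N) w∈
  ... | _ , _ , _ , v∈ , refl = s≤s (words≤-length N v∈)

  lexOrder : DecTotalOrder _ _ _
  lexOrder = record
    { Carrier = Word n ; _≈_ = _≡_ ; _≤_ = _⊑_
    ; isDecTotalOrder = record
      { isTotalOrder = record
        { isPartialOrder = record
          { isPreorder = record { isEquivalence = ≡.isEquivalence ; reflexive = ⊑-reflexive ; trans = ⊑-trans }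
          ; antisym = ⊑-antisym }
        ; total = ⊑-total }
      ; _≟_ = _≟ʷ_ ; _≤?_ = _⊑?_ } }

  open Sort lexOrder using (sort; sort-↭; sort-↗)

  -- Increasing order lets the Lyndon factors be split off starting from the least word.
  lyndonWords : ℕ → List (Word n)
  lyndonWords N = sort (filter LW? (words≤ N))

  lyndonWords-unique : ∀ N → Unique (lyndonWords N)
  lyndonWords-unique N = PermSetoidₚ.Unique-resp-↭ (≡.setoid (Word n)) (↭⇒↭ₛ (↭-sym (sort-↭ (filter LW? (words≤ N)))))
    (Uniqueₚ.filter⁺ LW? (words≤-unique N))

  lyndonWords-sorted : ∀ N → AllPairs (λ u v → u ⊑ v × u ≢ v) (lyndonWords N)
  lyndonWords-sorted N = AllPairs.zip (Linked⇒AllPairs ⊑-trans (sort-↗ (filter LW? (words≤ N))) , lyndonWords-unique N)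

  ∈-lyndonWords⁺ : ∀ N {w} → LW w → length w ≤ℕ N → w ∈ lyndonWords N
  ∈-lyndonWords⁺ N L l = Permₚ.∈-resp-↭ (↭-sym (sort-↭ (filter LW? (words≤ N)))) (∈-filter⁺ LW? (∈-words≤ N _ l) L)

  ∈-lyndonWords⁻ : ∀ N {w} → w ∈ lyndonWords N → LW w × length w ≤ℕ N
  ∈-lyndonWords⁻ N w∈ with ∈-filter⁻ LW? {xs = words≤ N} (Permₚ.∈-resp-↭ (sort-↭ (filter LW? (words≤ N))) w∈)
  ... | w∈′ , L = L , words≤-length N w∈′

  Back⇒∈ : ∀ {v w K} → Back v w K → v ∈ w
  Back⇒∈ (bhere _) = here refl
  Back⇒∈ (bthere b) = there (Back⇒∈ b)

  Back-All⁺ : ∀ {P : Fin n → Set} {v w K} → Back v w K → P v → All P K → All P w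
  Back-All⁺ (bhere _) p ps = p ∷ ps
  Back-All⁺ (bthere b) p (q ∷ ps) = q ∷ Back-All⁺ b p ps

  Back-All⁻ : ∀ {P : Fin n → Set} {v w K} → Back v w K → All P w → All P K
  Back-All⁻ (bhere _) (_ ∷ ps) = ps
  Back-All⁻ (bthere b) (q ∷ ps) = q ∷ Back-All⁻ b ps

  Back-length : ∀ {v w K} → Back v w K → length w ≡ suc (length K)
  Back-length (bhere _) = refl
  Back-length (bthere b) = cong suc (Back-length b)

  Back-unique : ∀ {v w K K′} → Back v w K → Back v w K′ → K ≡ K′
  Back-unique (bhere _) (bhere _) = refl
  Back-unique (bhere p) (bthere b) = ⊥-elim (∥-irrefl (All.lookup p (Back⇒∈ b)))
  Back-unique (bthere b) (bhere p) = ⊥-elim (∥-irrefl (All.lookup p (Back⇒∈ b)))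
  Back-unique (bthere b) (bthere b′) = cong (_ ∷_) (Back-unique b b′)

  Back-lift : ∀ {u v w K K′} → u ∥ v → Back v w K → Back u K K′ → ∃[ w′ ] Back u w w′
  Back-lift p (bhere _) b = _ , bthere b
  Back-lift p (bthere b) (bhere q) = _ , bhere (Back-All⁺ b p q)
  Back-lift p (bthere b) (bthere b′) = _ , bthere (proj₂ (Back-lift p b b′))

  -- Two different maximal pieces are incomparable, so their letters commute and each stays maximal
  -- when the other is removed.
  Back-restrict : ∀ {u v w K w′} → u ≢ v → Back v w K → Back u w w′ → u ∥ v × ∃[ K′ ] Back u K K′
  Back-restrict u≢v (bhere _) (bhere _) = ⊥-elim (u≢v refl)
  Back-restrict u≢v (bhere p) (bthere b) = ∥-sym (All.lookup p (Back⇒∈ b)) , _ , b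
  Back-restrict u≢v (bthere b) (bhere p) = All.lookup p (Back⇒∈ b) , _ , bhere (Back-All⁻ b p)
  Back-restrict u≢v (bthere b) (bthere b′) with Back-restrict u≢v b b′
  ... | p , _ , c = p , _ , bthere c

  back? : ∀ v w → Dec (∃[ K ] Back v w K)
  back? v [] = no λ ()
  back? v (c ∷ w) with back? v w
  ... | yes (K , b) = yes (c ∷ K , bthere b)
  ... | no ¬b with v ≟ᶠ c
  ...   | no v≢c = no λ { (_ , bhere _) → v≢c refl ; (_ , bthere b) → ¬b (_ , b) }
  ...   | yes refl with v ∥*? w
  ...     | yes p = yes (w , bhere p)
  ...     | no ¬p = no λ { (_ , bhere p) → ¬p p ; (_ , bthere b) → ¬b (_ , b) }

  removeBack : Fin n → Word n → Word n
  removeBack v w with back? v w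
  ... | yes (K , _) = K
  ... | no _ = []

  removeBack-≡ : ∀ {v w K} → Back v w K → removeBack v w ≡ K
  removeBack-≡ {v} {w} b with back? v w
  ... | yes (_ , b′) = Back-unique b′ b
  ... | no ¬b = ⊥-elim (¬b (_ , b))

  last-Back : ∀ x w → ∃[ v ] ∃[ K ] Back v (x ∷ w) K
  last-Back x [] = x , [] , bhere []
  last-Back x (y ∷ w) with last-Back y w
  ... | v , K , b = v , x ∷ K , bthere b

  -- `vs` lists the letters under consideration and `B` marks those forbidden as maximal letters.
  -- Below a maximal `v`, letters dependent on `v` are covered by it, so only the independent ones,
  -- kept by `avoid`, still impose a condition.
  NoMax : List (Fin n) → (Fin n → Bool) → Word n → Set
  NoMax vs B w = All (λ v → B v ≡ true → ¬ (∃[ K ] Back v w K)) vs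

  NoMax? : ∀ vs B → Decidable (NoMax vs B)
  NoMax? vs B w = All.all? (λ v → (B v Boolₚ.≟ true) →-dec ¬? (back? v w)) vs

  avoid : Fin n → (Fin n → Bool) → Fin n → Bool
  avoid v B u = B u ∧ not (conn G u v)

  NoMax-restrict : ∀ {vs B v w K} → All (v ≢_) vs → Back v w K → NoMax vs B w → NoMax vs (avoid v B) K
  NoMax-restrict {vs} {B} {v} vs≢ b nm = All.zipWith step (vs≢ , nm)
    where
    step : ∀ {u} → v ≢ u × (B u ≡ true → ¬ (∃[ K ] Back u _ K)) → avoid v B u ≡ true → ¬ (∃[ K ] Back u _ K)
    step {u} (_ , h) e (_ , b′) with ∧⁻ {B u} e
    ... | Bu , c with conn G u v in q
    ...   | false = h Bu (Back-lift q b b′)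

  NoMax-lift : ∀ {vs B v w K} → All (v ≢_) vs → Back v w K → NoMax vs (avoid v B) K → NoMax vs B w
  NoMax-lift {vs} {B} {v} vs≢ b nm = All.zipWith step (vs≢ , nm)
    where
    step : ∀ {u} → v ≢ u × (avoid v B u ≡ true → ¬ (∃[ K ] Back u _ K)) → B u ≡ true → ¬ (∃[ K ] Back u _ K)
    step {u} (v≢u , h) Bu (_ , b′) with Back-restrict (v≢u ∘ sym) b b′
    ... | p , b″ = h (cong₂ _∧_ Bu (cong not p)) b″

-- Cartier-Foata inversion.

module WordSeries {n : ℕ} (G : SimpleGraph n) (R : CommutativeRing 0ℓ 0ℓ) (y : Fin n → CommutativeRing.Carrier R) where
  open HeapWords G
  open LyndonHeaps G
  open WordLists G
  open CommutativeRing R renaming (refl to ≈-refl; sym to ≈-sym; trans to ≈-trans)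
  open Sums R
  open PowerSeries R

  weight : Word n → Carrier
  weight w = ∏ w y

  gf : {P : Word n → Set} → Decidable P → Series
  gf P? m = ∑ (filter P? (words m)) weight

  M? : ∀ vs B → Decidable (λ w → Std w × NoMax vs B w)
  M? vs B w = Std? w ×-dec NoMax? vs B w

  M : List (Fin n) → (Fin n → Bool) → Series
  M vs B = gf (M? vs B)

  H : Series
  H = gf Std?

  weight-Back : ∀ {v w K} → Back v w K → weight w ≈ y v * weight K
  weight-Back (bhere _) = ≈-refl
  weight-Back {v} (bthere {c = c} b) = ≈-trans (*-congˡ (weight-Back b)) (CSProps.x∙yz≈y∙xz *-commutativeSemigroup (y c) (y v) _)

  -- Words with a maximal `v` correspond, by removing it, to words in which no allowed letter of
  -- `vs` independent of `v` is maximal; `ins v` is the inverse.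
  M-step : ∀ v vs B → All (v ≢_) vs → B v ≡ true → ∀ m →
    M vs B m ≈ M (v ∷ vs) B m + (mono (y v) 1 ⊛ M vs (avoid v B)) m
  M-step v vs B vs≢ Bv m = ≈-trans
    (∑-filter-split (M? vs B) (M? (v ∷ vs) B) withMax? (words m) weight split (λ _ → disjoint) (λ _ → proj₁))
    (+-congˡ (last-piece m))
    where
    withMax? : Decidable (λ w → (Std w × NoMax vs B w) × ∃[ K ] Back v w K)
    withMax? w = M? vs B w ×-dec back? v w
    split : ∀ {w} → w ∈ words m → Std w × NoMax vs B w → (Std w × NoMax (v ∷ vs) B w) ⊎ ((Std w × NoMax vs B w) × ∃[ K ] Back v w K)
    split {w} _ (S , nm) with back? v w
    ... | yes b = inj₂ ((S , nm) , b)
    ... | no ¬b = inj₁ (S , (λ _ → ¬b) ∷ nm)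
    disjoint : ∀ {w} → Std w × NoMax (v ∷ vs) B w → (Std w × NoMax vs B w) × ¬ ((Std w × NoMax vs B w) × ∃[ K ] Back v w K)
    disjoint (S , h ∷ nm) = (S , nm) , λ { (_ , b) → h Bv b }
    last-piece : ∀ m → ∑ (filter withMax? (words m)) weight ≈ (mono (y v) 1 ⊛ M vs (avoid v B)) m
    last-piece zero = ≈-trans (∑-0 (filter withMax? (words 0)) (λ w∈ → ⊥-elim (none w∈))) (≈-sym (zeroˡ _))
      where
      none : ∀ {w} → ¬ (w ∈ filter withMax? (words 0))
      none w∈ with ∈-filter⁻ withMax? {xs = words 0} w∈
      ... | here refl , _ , _ , ()
    last-piece (suc m) = ≈-trans
      (∑-bij (removeBack v) (ins v) (Uniqueₚ.filter⁺ withMax? (words-unique (suc m))) (Uniqueₚ.filter⁺ (M? vs (avoid v B)) (words-unique m))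
        to from (λ w∈ → weight-removed w∈))
      (≈-trans (≈-sym (∑-*ˡ (y v) (filter (M? vs (avoid v B)) (words m)) weight)) (≈-sym (mono-⊛-≥ (y v) 1 _ m)))
      where
      to : ∀ {w} → w ∈ filter withMax? (words (suc m)) →
        removeBack v w ∈ filter (M? vs (avoid v B)) (words m) × ins v (removeBack v w) ≡ w
      to {w} w∈ with ∈-filter⁻ withMax? {xs = words (suc m)} w∈
      ... | w∈′ , (S , nm) , K , b rewrite removeBack-≡ b =
        ∈-filter⁺ (M? vs (avoid v B)) (subst (λ j → K ∈ words j) (ℕₚ.suc-injective (trans (sym (Back-length b)) (words-length (suc m) w∈′))) (∈-words K))
          (Std-Back S b , NoMax-restrict vs≢ b nm) , sym (ins-unique S b)
      from : ∀ {K} → K ∈ filter (M? vs (avoid v B)) (words m) → ins v K ∈ filter withMax? (words (suc m)) × removeBack v (ins v K) ≡ K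
      from {K} K∈ with ∈-filter⁻ (M? vs (avoid v B)) {xs = words m} K∈
      ... | K∈′ , S , nm = ∈-filter⁺ withMax? (subst (λ j → ins v K ∈ words j) (trans (Back-length b) (cong suc (words-length m K∈′))) (∈-words (ins v K)))
          ((Std-ins v K S , NoMax-lift vs≢ b nm) , K , b) , removeBack-≡ b
        where
        b : Back v (ins v K) K
        b = Back-ins v K
      weight-removed : ∀ {w} → w ∈ filter withMax? (words (suc m)) → weight w ≈ y v * weight (removeBack v w)
      weight-removed {w} w∈ with ∈-filter⁻ withMax? {xs = words (suc m)} w∈
      ... | _ , _ , K , b rewrite removeBack-≡ b = weight-Back b

  private
    module S = CommutativeRing seriesRing

  -- The sum of `(-t)^|S|` times the weights over the stable sets `S` of letters in `vs` marked by
  -- `B`, by deletion: either `v` is left out, or it is taken and its neighbours are excluded.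
  J : List (Fin n) → (Fin n → Bool) → Series
  J [] B = one
  J (v ∷ vs) B = if B v then (λ m → J vs B m - (mono (y v) 1 ⊛ J vs (avoid v B)) m) else J vs B

  -- Deletion recursion: forbidding v as a maximal letter removes the heaps K ∘ v, where K has no
  -- maximal letter of vs independent of v.
  M≈J⊛H : ∀ vs B → Unique vs → M vs B ≋ J vs B ⊛ H
  M≈J⊛H [] B _ m = ≈-trans (∑-filter-⇔ (M? [] B) Std? (words m) weight (λ _ → proj₁) (λ _ S → S , [])) (≈-sym (⊛-identityˡ H m))
  M≈J⊛H (v ∷ vs) B (v≢ ∷ u) m = by-allowance (B v) refl
    where
    open SetoidReasoning (CommutativeRing.setoid R)
    X : Series
    X = mono (y v) 1 ⊛ M vs (avoid v B)
    by-allowance : ∀ b → B v ≡ b →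
      M (v ∷ vs) B m ≈ ((if b then (λ i → J vs B i - (mono (y v) 1 ⊛ J vs (avoid v B)) i) else J vs B) ⊛ H) m
    by-allowance false Bv = ≈-trans (∑-filter-⇔ (M? (v ∷ vs) B) (M? vs B) (words m) weight
      (λ { _ (S , _ ∷ nm) → S , nm }) (λ { _ (S , nm) → S , (λ Bv′ → case trans (sym Bv) Bv′ of λ ()) ∷ nm })) (M≈J⊛H vs B u m)
    by-allowance true Bv = begin
      M (v ∷ vs) B m
        ≈⟨ RingProps.//-rightDividesʳ ring (X m) (M (v ∷ vs) B m) ⟨
      M (v ∷ vs) B m + X m - X m
        ≈⟨ +-congʳ (M-step v vs B v≢ Bv m) ⟨
      M vs B m - X m
        ≈⟨ +-cong (M≈J⊛H vs B u m) (-‿cong (≈-trans (⊛-cong (λ _ → ≈-refl) (M≈J⊛H vs (avoid v B) u) m)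
             (≈-sym (⊛-assoc (mono (y v) 1) (J vs (avoid v B)) H m)))) ⟩
      (J vs B ⊛ H) m - ((mono (y v) 1 ⊛ J vs (avoid v B)) ⊛ H) m
        ≈⟨ RingProps.[y-z]x≈yx-zx S.ring H (J vs B) (mono (y v) 1 ⊛ J vs (avoid v B)) m ⟨
      ((λ i → J vs B i - (mono (y v) 1 ⊛ J vs (avoid v B)) i) ⊛ H) m ∎

  -- Every nonempty heap has a maximal piece, so forbidding all letters leaves the empty heap.
  M-all : M (allFin n) (λ _ → true) ≋ one
  M-all zero = ≈-trans (∑-filter-⇔ (M? (allFin n) (λ _ → true)) (_≟ʷ []) (words 0) weight
    (λ { (here refl) _ → refl }) (λ { (here refl) _ → tt , All.tabulate λ _ _ () })) (+-identityʳ _)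
  M-all (suc m) = ∑-0 (filter (M? (allFin n) (λ _ → true)) (words (suc m))) (λ w∈ → ⊥-elim (none w∈))
    where
    none : ∀ {w} → ¬ (w ∈ filter (M? (allFin n) (λ _ → true)) (words (suc m)))
    none {w} w∈ with ∈-filter⁻ (M? (allFin n) (λ _ → true)) {xs = words (suc m)} w∈
    none {[]} w∈ | w∈′ , _ = case words-length (suc m) w∈′ of λ ()
    none {x ∷ w} w∈ | _ , _ , nm with last-Back x w
    ... | v , b = All.lookup nm (∈-allFin v) refl b

  cartier-foata : J (allFin n) (λ _ → true) ⊛ H ≋ one
  cartier-foata m = ≈-trans (≈-sym (M≈J⊛H (allFin n) (λ _ → true) (Uniqueₚ.allFin⁺ n) m)) (M-all m)

-- Factorization of standard words into Lyndon words.

module LyndonFactorization {n : ℕ} (G : SimpleGraph n) (R : CommutativeRing 0ℓ 0ℓ) (y : Fin n → CommutativeRing.Carrier R) where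
  open HeapWords G
  open LyndonHeaps G
  open WordLists G
  open CommutativeRing R renaming (refl to ≈-refl; sym to ≈-sym; trans to ≈-trans)
  open Sums R
  open PowerSeries R
  open MultiSeries R using (truncRing; exact⇒trunc)
  open WordSeries G R y

  -- The standard words all of whose Lyndon factors are at least some word of vs.
  Above : List (Word n) → Word n → Set
  Above vs w = Std w × AllSuf (λ s → Any (_⊑ s) vs) w

  Above? : ∀ vs → Decidable (Above vs)
  Above? vs w = Std? w ×-dec AllSuf? (λ s → any? (_⊑? s) vs) w

  -- Shared by all tails of the sorted list of Lyndon words; it ensures that the least suffix of a
  -- word in `Above vs` lies in `vs`, as long as its length is at most `N`.
  UpClosed : ℕ → List (Word n) → Set
  UpClosed N vs = ∀ {u s} → u ∈ vs → LW s → length s ≤ℕ N → u ⊑ s → s ∈ vs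

  Above⇒AllSuf : ∀ {v vs} → All (λ u → v ⊑ u × v ≢ u) vs → ∀ {w} → Above (v ∷ vs) w → AllSuf (v ⊑_) w
  Above⇒AllSuf vs> {w} (_ , p) = AllSuf-map bound w p
    where
    bound : ∀ {s} → Any (_⊑ s) (_ ∷ _) → _ ⊑ s
    bound (here q) = q
    bound (there a) with find a
    ... | u , u∈ , q = ⊑-trans (proj₁ (All.lookup vs> u∈)) q

  AllSuf⇒Above : ∀ {v vs w} → v ∈ vs → Std w → AllSuf (v ⊑_) w → Above vs w
  AllSuf⇒Above {w = w} v∈ S p = S , AllSuf-map (lose v∈) w p

  Above-++⁺ : ∀ {v vs w} → LW v → All (λ u → v ⊑ u × v ≢ u) vs → Above (v ∷ vs) w → Above (v ∷ vs) (w ++ v)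
  Above-++⁺ {[]} (v≢[] , _) _ _ = ⊥-elim (v≢[] refl)
  Above-++⁺ {a ∷ v} {w = w} L@(_ , S , P) vs> A = AllSuf⇒Above (here refl)
    (Std-++⁺ w (a ∷ v) (proj₁ A) S (LW-OneMin L) (AllSuf⇒≥head w p)) (AllSuf-++⁺ w p P)
    where
    p : AllSuf ((a ∷ v) ⊑_) w
    p = Above⇒AllSuf vs> A

  Above-++⁻ : ∀ {v vs} w → LW v → All (λ u → v ⊑ u × v ≢ u) vs → Above (v ∷ vs) (w ++ v) → Above (v ∷ vs) w
  Above-++⁻ {v} w L vs> A = AllSuf⇒Above (here refl) (Std-++⁻ˡ w v (proj₁ A)) (AllSuf-++ˡ w (proj₁ L) (Above⇒AllSuf vs> A))

  ¬Above-++ : ∀ {v vs} w → LW v → All (λ u → v ⊑ u × v ≢ u) vs → ¬ Above vs (w ++ v)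
  ¬Above-++ {v} w L vs> (_ , p) with find (AllSuf-lookup w v (proj₁ L) p)
  ... | u , u∈ , u⊑v with All.lookup vs> u∈
  ...   | v⊑u , v≢u = v≢u (⊑-antisym v⊑u u⊑v)

  strip : Word n → Word n → Word n
  strip v w = take (length w ∸ length v) w

  strip-++ : ∀ w v → strip v (w ++ v) ≡ w
  strip-++ w v rewrite Listₚ.length-++ w {v} | ℕₚ.m+n∸n≡m (length w) (length v) = take-length w
    where
    take-length : ∀ w → take (length w) (w ++ v) ≡ w
    take-length [] = refl
    take-length (x ∷ w) = cong (x ∷_) (take-length w)

  -- By the last Lyndon factor, which is the least suffix: either it is `v`, and can be removed, or
  -- it belongs to `vs`, and then the whole word is `Above vs`.
  Above-step : ∀ N v vs → LW v → All (λ u → v ⊑ u × v ≢ u) vs → UpClosed N (v ∷ vs) → ∀ m → m ≤ℕ N →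
    gf (Above? (v ∷ vs)) m ≈ gf (Above? vs) m + (mono (weight v) (length v) ⊛ gf (Above? (v ∷ vs))) m
  Above-step N v vs L vs> up m m≤N = ≈-trans
    (∑-filter-split (Above? (v ∷ vs)) (Above? vs) ending? (words m) weight split (λ _ → disjoint) (λ _ → proj₁))
    (+-congˡ last-factor)
    where
    ending? : Decidable (λ w → Above (v ∷ vs) w × w ≡ strip v w ++ v)
    ending? w = Above? (v ∷ vs) w ×-dec (w ≟ʷ (strip v w ++ v))
    split : ∀ {w} → w ∈ words m → Above (v ∷ vs) w → Above vs w ⊎ (Above (v ∷ vs) w × w ≡ strip v w ++ v)
    split {[]} _ _ = inj₁ (tt , tt)
    split {x ∷ w} w∈ A with min-suffix x w
    ... | u , s , e , s≢[] , min with up (here refl) Ls s≤N (AllSuf-lookup u s s≢[] (subst (AllSuf (v ⊑_)) e (Above⇒AllSuf vs> A)))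
      where
      Ls : LW s
      Ls = suffix-LW u s s≢[] (subst Std e (proj₁ A)) (subst (AllSuf (s ⊑_)) e min)
      s≤N : length s ≤ℕ N
      s≤N = ℕₚ.≤-trans (subst (length s ≤ℕ_) (trans (sym (trans (cong length e) (Listₚ.length-++ u))) (words-length m w∈)) (ℕₚ.m≤n+m _ _)) m≤N
    ...   | here refl = inj₂ (A , trans e (cong (_++ s) (sym (trans (cong (strip s) e) (strip-++ u s)))))
    ...   | there s∈ = inj₁ (AllSuf⇒Above s∈ (proj₁ A) min)
    disjoint : ∀ {w} → Above vs w → Above (v ∷ vs) w × ¬ (Above (v ∷ vs) w × w ≡ strip v w ++ v)
    disjoint {w} A@(S , p) = (S , AllSuf-map there w p) , λ { (_ , e) → ¬Above-++ (strip v w) L vs> (subst (Above vs) e A) }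
    last-factor : ∑ (filter ending? (words m)) weight ≈ (mono (weight v) (length v) ⊛ gf (Above? (v ∷ vs))) m
    last-factor with length v ≤ℕ? m
    ... | no v≰m = ≈-trans (∑-0 (filter ending? (words m)) (λ w∈ → ⊥-elim (none w∈)))
        (≈-sym (mono-⊛-< (weight v) (length v) _ m (ℕₚ.≰⇒> v≰m)))
      where
      none : ∀ {w} → ¬ (w ∈ filter ending? (words m))
      none {w} w∈ with ∈-filter⁻ ending? {xs = words m} w∈
      ... | w∈′ , _ , e = v≰m (subst (length v ≤ℕ_) (trans (sym (trans (cong length e) (Listₚ.length-++ (strip v w)))) (words-length m w∈′)) (ℕₚ.m≤n+m _ _))
    ... | yes v≤m = subst (λ i → ∑ (filter ending? (words i)) weight ≈ (mono (weight v) (length v) ⊛ gf (Above? (v ∷ vs))) i) (ℕₚ.m+[n∸m]≡n v≤m)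
      (≈-trans (∑-bij (strip v) (_++ v) (Uniqueₚ.filter⁺ ending? (words-unique (length v +ℕ i))) (Uniqueₚ.filter⁺ (Above? (v ∷ vs)) (words-unique i))
        to from weight-split)
      (≈-trans (≈-sym (∑-*ˡ (weight v) (filter (Above? (v ∷ vs)) (words i)) weight)) (≈-sym (mono-⊛-≥ (weight v) (length v) _ i))))
      where
      i : ℕ
      i = m ∸ length v
      to : ∀ {w} → w ∈ filter ending? (words (length v +ℕ i)) → strip v w ∈ filter (Above? (v ∷ vs)) (words i) × strip v w ++ v ≡ w
      to {w} w∈ with ∈-filter⁻ ending? {xs = words (length v +ℕ i)} w∈
      ... | w∈′ , A , e = ∈-filter⁺ (Above? (v ∷ vs)) (subst (λ j → strip v w ∈ words j) len (∈-words (strip v w)))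
          (Above-++⁻ (strip v w) L vs> (subst (Above (v ∷ vs)) e A)) , sym e
        where
        len : length (strip v w) ≡ i
        len = ℕₚ.+-cancelʳ-≡ (length v) _ _ (trans (sym (Listₚ.length-++ (strip v w))) (trans (cong length (sym e))
          (trans (words-length (length v +ℕ i) w∈′) (ℕₚ.+-comm (length v) i))))
      from : ∀ {w} → w ∈ filter (Above? (v ∷ vs)) (words i) → w ++ v ∈ filter ending? (words (length v +ℕ i)) × strip v (w ++ v) ≡ w
      from {w} w∈ with ∈-filter⁻ (Above? (v ∷ vs)) {xs = words i} w∈
      ... | w∈′ , A = ∈-filter⁺ ending?
          (subst (λ j → w ++ v ∈ words j) (trans (Listₚ.length-++ w) (trans (cong (_+ℕ length v) (words-length i w∈′)) (ℕₚ.+-comm i (length v)))) (∈-words (w ++ v)))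
          (Above-++⁺ L vs> A , cong (_++ v) (sym (strip-++ w v))) , strip-++ w v
      weight-split : ∀ {w} → w ∈ filter ending? (words (length v +ℕ i)) → weight w ≈ weight v * weight (strip v w)
      weight-split {w} w∈ with ∈-filter⁻ ending? {xs = words (length v +ℕ i)} w∈
      ... | _ , _ , e = ≈-trans (reflexive (cong weight e)) (≈-trans (∏-++ (strip v w) v y) (*-comm _ _))

  module _ (N : ℕ) where
    private
      module S = CommutativeRing seriesRing
      module 𝕋 = CommutativeRing (truncRing 1 N)

    pointwise⇒trunc : ∀ {f g} → (∀ m → m ≤ℕ N → f m ≈ g m) → f 𝕋.≈ g
    pointwise⇒trunc p i l = ≈-trans (+-congʳ (p i (ℕₚ.≤-pred (ℕₚ.m∸n≢0⇒n<m λ e → ℕₚ.<⇒≢ l (sym e))))) (-‿inverseʳ _)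

    trunc⇒pointwise : ∀ {f g} → f 𝕋.≈ g → ∀ m → m ≤ℕ N → f m ≈ g m
    trunc⇒pointwise p m m≤N = RingProps.x∙y⁻¹≈ε⇒x≈y ring _ _ (p m (ℕₚ.m<n⇒0<n∸m (s≤s m≤N)))

    factor : Word n → Series
    factor v = one S.- mono (weight v) (length v)

    -- Each factor `1 - weight v · t^|v|` removes `v` from the admissible Lyndon factors; at the end
    -- only the empty word is left.
    factors-Above : ∀ vs → All LW vs → AllPairs (λ u v → u ⊑ v × u ≢ v) vs → UpClosed N vs →
      Sums.∏ (truncRing 1 N) vs factor 𝕋.* gf (Above? vs) 𝕋.≈ 𝕋.1#
    factors-Above [] [] [] up = 𝕋.trans (𝕋.*-identityˡ _) (pointwise⇒trunc {gf (Above? [])} {one} empty)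
      where
      empty : ∀ m → m ≤ℕ N → gf (Above? []) m ≈ one m
      empty zero _ = +-identityʳ _
      empty (suc m) _ = ∑-0 (filter (Above? []) (words (suc m))) (λ w∈ → ⊥-elim (none w∈))
        where
        none : ∀ {w} → ¬ (w ∈ filter (Above? []) (words (suc m)))
        none {w} w∈ with ∈-filter⁻ (Above? []) {xs = words (suc m)} w∈
        none {[]} w∈ | w∈′ , _ = case words-length (suc m) w∈′ of λ ()
        none {x ∷ w} w∈ | _ , _ , () , _
    factors-Above (v ∷ vs) (L ∷ Ls) (v< ∷ sorted) up =
      𝕋.trans (𝕋.*-congʳ (𝕋.*-comm (factor v) P))
        (𝕋.trans (𝕋.*-assoc P (factor v) Hv) (𝕋.trans (𝕋.*-congˡ {P} remove) (factors-Above vs Ls sorted up′)))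
      where
      P Hv : Series
      P = Sums.∏ (truncRing 1 N) vs factor
      Hv = gf (Above? (v ∷ vs))
      up′ : UpClosed N vs
      up′ u∈ Ls l u⊑s with up (there u∈) Ls l u⊑s
      ... | there s∈ = s∈
      ... | here refl with All.lookup v< u∈
      ...   | v⊑u , v≢u = ⊥-elim (v≢u (⊑-antisym v⊑u u⊑s))
      remove : factor v 𝕋.* Hv 𝕋.≈ gf (Above? vs)
      remove = pointwise⇒trunc {factor v S.* Hv} {gf (Above? vs)} λ m m≤N → ≈-trans
        (RingProps.[y-z]x≈yx-zx S.ring Hv one (mono (weight v) (length v)) m)
        (≈-trans (+-congʳ (≈-trans (⊛-identityˡ Hv m) (Above-step N v vs L v< up m m≤N))) (RingProps.//-rightDividesʳ ring _ _))

    -- Every standard word is a product of standard Lyndon words, so both sides are inverse to H.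
    J≈∏factors : J (allFin n) (λ _ → true) 𝕋.≈ Sums.∏ (truncRing 1 N) (lyndonWords N) factor
    J≈∏factors = 𝕋.trans (𝕋.sym (𝕋.*-identityʳ J₁)) (𝕋.trans (𝕋.*-congˡ {J₁} (𝕋.sym product)) (𝕋.trans
      (𝕋.*-congˡ {J₁} (𝕋.*-comm P H)) (𝕋.trans (𝕋.sym (𝕋.*-assoc J₁ H P)) (𝕋.trans (𝕋.*-congʳ {P}
        (exact⇒trunc 1 N {J₁ S.* H} {one} cartier-foata)) (𝕋.*-identityˡ P)))))
      where
      J₁ P : Series
      J₁ = J (allFin n) (λ _ → true)
      P = Sums.∏ (truncRing 1 N) (lyndonWords N) factor
      full : ∀ {m w} → m ≤ℕ N → w ∈ words m → Std w → Above (lyndonWords N) w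
      full {m} {[]} _ _ S = tt , tt
      full {m} {x ∷ w} m≤N w∈ S with min-suffix x w
      ... | u , s , e , s≢[] , min = AllSuf⇒Above (∈-lyndonWords⁺ N
          (suffix-LW u s s≢[] (subst Std e S) (subst (AllSuf (s ⊑_)) e min))
          (ℕₚ.≤-trans (subst (length s ≤ℕ_) (trans (sym (trans (cong length e) (Listₚ.length-++ u))) (words-length m w∈)) (ℕₚ.m≤n+m _ _)) m≤N)) S min
      product : P 𝕋.* H 𝕋.≈ 𝕋.1#
      product = 𝕋.trans (𝕋.*-congˡ {P} (pointwise⇒trunc {H} {gf (Above? (lyndonWords N))} λ m m≤N →
          ∑-filter-⇔ Std? (Above? (lyndonWords N)) (words m) weight (λ w∈ → full m≤N w∈) (λ _ → proj₁)))
        (factors-Above (lyndonWords N) (All.tabulate λ w∈ → proj₁ (∈-lyndonWords⁻ N w∈)) (lyndonWords-sorted N)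
          (λ _ Ls l _ → ∈-lyndonWords⁺ N Ls l))

-- Multisets with bounded multiplicities, and products of finite geometric sums.

-- Finite multisets over a duplicate-free list of items, as lists of consecutive copies, with
-- multiplicities bounded by b.
module Multisets {I : Set} (_≟_ : (i j : I) → Dec (i ≡ j)) (b : I → ℕ) where

  copies-of : I → ℕ × List I → List I
  copies-of i (m , ms) = replicate m i ++ ms

  msets : List I → List (List I)
  msets [] = [] ∷ []
  msets (i ∷ is) = map (copies-of i) (cartesianProduct (upTo (suc (b i))) (msets is))

  count : I → List I → ℕ
  count i ms = length (filter (i ≟_) ms)

  msets⁻ : ∀ {i} is {ms} → ms ∈ msets (i ∷ is) → ∃[ m ] ∃[ ms′ ] (m ≤ℕ b i × ms′ ∈ msets is × ms ≡ replicate m i ++ ms′)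
  msets⁻ {i} is ms∈ with ∈-map⁻ (copies-of i) ms∈
  ... | (m , ms′) , p , e with ∈-cartesianProduct⁻ (upTo (suc (b i))) (msets is) p
  ...   | m∈ , ms′∈ = m , ms′ , ℕₚ.≤-pred (∈-upTo⁻ m∈) , ms′∈ , e

  msets⁺ : ∀ {i} is {m ms} → m ≤ℕ b i → ms ∈ msets is → replicate m i ++ ms ∈ msets (i ∷ is)
  msets⁺ {i} is m≤ ms∈ = ∈-map⁺ (copies-of i) (∈-cartesianProduct⁺ (∈-upTo⁺ (s≤s m≤)) ms∈)

  msets-⊆ : ∀ is {ms} → ms ∈ msets is → All (_∈ is) ms
  msets-⊆ [] (here refl) = []
  msets-⊆ (i ∷ is) ms∈ with msets⁻ is ms∈
  ... | m , ms′ , _ , ms′∈ , refl = Allₚ.++⁺ (Allₚ.replicate⁺ m (here refl)) (All.map there (msets-⊆ is ms′∈))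

  count-absent : ∀ {i} ms → i ∉ ms → count i ms ≡ 0
  count-absent {i} ms i∉ = cong length (Listₚ.filter-none (i ≟_) (All.tabulate λ j∈ e → i∉ (subst (_∈ ms) (sym e) j∈)))

  count-replicate : ∀ i m ms → count i (replicate m i ++ ms) ≡ m +ℕ count i ms
  count-replicate i zero ms = refl
  count-replicate i (suc m) ms with i ≟ i
  ... | yes _ = cong suc (count-replicate i m ms)
  ... | no i≢i = ⊥-elim (i≢i refl)

  count-replicate-≢ : ∀ i j m ms → i ≢ j → count i (replicate m j ++ ms) ≡ count i ms
  count-replicate-≢ i j zero ms _ = refl
  count-replicate-≢ i j (suc m) ms i≢j with i ≟ j
  ... | yes i≡j = ⊥-elim (i≢j i≡j)
  ... | no _ = count-replicate-≢ i j m ms i≢j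

  count-head : ∀ {i} is {m ms} → All (i ≢_) is → ms ∈ msets is → count i (replicate m i ++ ms) ≡ m
  count-head {i} is {m} {ms} i≢ ms∈ = trans (count-replicate i m ms) (trans (cong (m +ℕ_)
    (count-absent ms λ i∈ → All.lookup i≢ (All.lookup (msets-⊆ is ms∈) i∈) refl)) (ℕₚ.+-identityʳ m))

  msets-count : ∀ is {ms} → Unique is → ms ∈ msets is → ∀ i → count i ms ≤ℕ b i
  msets-count [] _ (here refl) i = z≤n
  msets-count (j ∷ is) (j≢ ∷ u) ms∈ i with msets⁻ is ms∈
  ... | m , ms′ , m≤ , ms′∈ , refl with i ≟ j
  ...   | yes refl = subst (_≤ℕ b i) (sym (count-head is {m = m} j≢ ms′∈)) m≤
  ...   | no i≢j = subst (_≤ℕ b i) (sym (count-replicate-≢ i j m ms′ i≢j)) (msets-count is u ms′∈ i)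

  -- Copies follow the fixed order of the items, so the multiplicities determine the list.
  msets-canonical : ∀ is {ms ms′} → Unique is → ms ∈ msets is → ms′ ∈ msets is → (∀ i → count i ms ≡ count i ms′) → ms ≡ ms′
  msets-canonical [] _ (here refl) (here refl) _ = refl
  msets-canonical (i ∷ is) (i≢ ∷ u) ms∈ ms′∈ h with msets⁻ is ms∈ | msets⁻ is ms′∈
  ... | m , r , _ , r∈ , refl | m′ , r′ , _ , r′∈ , refl
    with refl ← trans (sym (count-head is {m = m} i≢ r∈)) (trans (h i) (count-head is {m = m′} i≢ r′∈)) =
      cong (replicate m i ++_) (msets-canonical is u r∈ r′∈ tails)
    where
    tails : ∀ j → count j r ≡ count j r′
    tails j with j ≟ i
    ... | no j≢i = trans (sym (count-replicate-≢ j i m r j≢i)) (trans (h j) (count-replicate-≢ j i m r′ j≢i))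
    ... | yes refl = ℕₚ.+-cancelˡ-≡ m _ _ (trans (sym (count-replicate i m r)) (trans (h i) (count-replicate i m r′)))

  msets-unique : ∀ is → Unique is → Unique (msets is)
  msets-unique [] _ = [] ∷ []
  msets-unique (i ∷ is) (i≢ ∷ u) = BigOperator.map-unique ℕₚ.+-0-commutativeMonoid (copies-of i) injective
    (Uniqueₚ.cartesianProduct⁺ (Uniqueₚ.upTo⁺ (suc (b i))) (msets-unique is u))
    where
    injective : ∀ {p q} → p ∈ cartesianProduct (upTo (suc (b i))) (msets is) → q ∈ cartesianProduct (upTo (suc (b i))) (msets is) →
      replicate (proj₁ p) i ++ proj₂ p ≡ replicate (proj₁ q) i ++ proj₂ q → p ≡ q
    injective {m , r} {m′ , r′} p∈ q∈ e with ∈-cartesianProduct⁻ (upTo (suc (b i))) (msets is) p∈ | ∈-cartesianProduct⁻ (upTo (suc (b i))) (msets is) q∈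
    ... | _ , r∈ | _ , r′∈ with refl ← trans (sym (count-head is {m = m} i≢ r∈)) (trans (cong (count i) e) (count-head is {m = m′} i≢ r′∈)) =
      cong (m ,_) (Listₚ.++-cancelˡ (replicate m i) r r′ e)

  msets-AllPairs : ∀ {_≼_ : I → I → Set} → (∀ {i} → i ≼ i) → ∀ is {ms} → AllPairs _≼_ is → ms ∈ msets is → AllPairs _≼_ ms
  msets-AllPairs ≼-refl [] [] (here refl) = []
  msets-AllPairs {_≼_} ≼-refl (i ∷ is) (p ∷ ps) ms∈ with msets⁻ is ms∈
  ... | m , r , _ , r∈ , refl = copies m
    where
    below : All (i ≼_) r
    below = All.map (All.lookup p) (msets-⊆ is r∈)
    copies : ∀ m → AllPairs _≼_ (replicate m i ++ r)
    copies zero = msets-AllPairs ≼-refl is ps r∈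
    copies (suc m) = Allₚ.++⁺ (Allₚ.replicate⁺ m ≼-refl) below ∷ copies m

  others : I → List I → List I
  others i [] = []
  others i (j ∷ ms) with i ≟ j
  ... | yes _ = others i ms
  ... | no _ = j ∷ others i ms

  gather : ∀ i ms → ms ↭ replicate (count i ms) i ++ others i ms
  gather i [] = ↭-refl
  gather i (j ∷ ms) with i ≟ j
  ... | yes refl = prep i (gather i ms)
  ... | no _ = ↭-trans (prep j (gather i ms)) (↭-sym (Permₚ.shift j (replicate (count i ms) i) (others i ms)))

  others-All : ∀ {P : I → Set} i ms → (∀ {j} → j ∈ ms → i ≢ j → P j) → All P (others i ms)
  others-All i [] h = []
  others-All i (j ∷ ms) h with i ≟ j
  ... | yes _ = others-All i ms (h ∘ there)
  ... | no i≢j = h (here refl) i≢j ∷ others-All i ms (h ∘ there)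

  count-others : ∀ i j ms → count j (others i ms) ≤ℕ count j ms
  count-others i j [] = z≤n
  count-others i j (k ∷ ms) with i ≟ k
  ... | yes _ with j ≟ k
  ...   | yes _ = ℕₚ.m≤n⇒m≤1+n (count-others i j ms)
  ...   | no _ = count-others i j ms
  count-others i j (k ∷ ms) | no _ with j ≟ k
  ...   | yes _ = s≤s (count-others i j ms)
  ...   | no _ = count-others i j ms

  -- The copies of each item are brought together in the order of `is`; the bounds on `count` are
  -- what membership asks for.
  msets-complete : ∀ is P → All (_∈ is) P → (∀ i → count i P ≤ℕ b i) → ∃[ ms ] (ms ∈ msets is × ms ↭ P)
  msets-complete [] [] _ _ = [] , here refl , ↭-refl
  msets-complete [] (p ∷ P) (() ∷ _) _
  msets-complete (i ∷ is) P P⊆ h with msets-complete is (others i P)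
      (others-All i P λ j∈ i≢j → tail-∈ i≢j (All.lookup P⊆ j∈)) (λ j → ℕₚ.≤-trans (count-others i j P) (h j))
    where
    tail-∈ : ∀ {j} → i ≢ j → j ∈ i ∷ is → j ∈ is
    tail-∈ i≢j (here refl) = ⊥-elim (i≢j refl)
    tail-∈ _ (there j∈) = j∈
  ... | r , r∈ , p = replicate (count i P) i ++ r , msets⁺ is (h i) r∈
      , ↭-trans (Permₚ.++⁺ˡ (replicate (count i P) i) p) (↭-sym (gather i P))

  module _ (R : CommutativeRing 0ℓ 0ℓ) where
    open CommutativeRing R renaming (refl to ≈-refl; sym to ≈-sym; trans to ≈-trans)
    open Sums R

    ∏-replicate : ∀ m i ms (x : I → Carrier) → ∏ (replicate m i ++ ms) x ≈ x i ^ m * ∏ ms x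
    ∏-replicate zero i ms x = ≈-sym (*-identityˡ _)
    ∏-replicate (suc m) i ms x = ≈-trans (*-congˡ (∏-replicate m i ms x)) (≈-sym (*-assoc _ _ _))

    ∑-cartesianProduct : ∀ {X Y : Set} (xs : List X) (ys : List Y) (f : X × Y → Carrier) →
      ∑ (cartesianProduct xs ys) f ≈ ∑ xs (λ x → ∑ ys (λ y → f (x , y)))
    ∑-cartesianProduct [] ys f = ≈-refl
    ∑-cartesianProduct (x ∷ xs) ys f = ≈-trans (∑-++ (map (x ,_) ys) _ f)
      (+-cong (∑-map (x ,_) ys f) (∑-cartesianProduct xs ys f))

    -- Distributivity: choosing a power of each `x i` is choosing a multiplicity for each item.
    ∑-msets : ∀ is (x : I → Carrier) → ∑ (msets is) (λ ms → ∏ ms x) ≈ ∏ is (λ i → ∑ (upTo (suc (b i))) (λ m → x i ^ m))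
    ∑-msets [] x = +-identityʳ _
    ∑-msets (i ∷ is) x = begin
      ∑ (msets (i ∷ is)) (λ ms → ∏ ms x)
        ≈⟨ ∑-map (copies-of i) (cartesianProduct (upTo (suc (b i))) (msets is)) _ ⟩
      ∑ (cartesianProduct (upTo (suc (b i))) (msets is)) (λ p → ∏ (copies-of i p) x)
        ≈⟨ ∑-cartesianProduct (upTo (suc (b i))) (msets is) _ ⟩
      ∑ (upTo (suc (b i))) (λ m → ∑ (msets is) (λ ms → ∏ (replicate m i ++ ms) x))
        ≈⟨ ∑-cong (upTo (suc (b i))) (λ {m} _ → ≈-trans (∑-cong (msets is) (λ {ms} _ → ∏-replicate m i ms x))
             (≈-sym (∑-*ˡ (x i ^ m) (msets is) _))) ⟩
      ∑ (upTo (suc (b i))) (λ m → x i ^ m * ∑ (msets is) (λ ms → ∏ ms x))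
        ≈⟨ ∑-*ʳ _ (upTo (suc (b i))) _ ⟨
      ∑ (upTo (suc (b i))) (λ m → x i ^ m) * ∑ (msets is) (λ ms → ∏ ms x)
        ≈⟨ *-congˡ (∑-msets is x) ⟩
      ∏ (i ∷ is) (λ i → ∑ (upTo (suc (b i))) (λ m → x i ^ m)) ∎
      where open SetoidReasoning setoid

-- Pairs of a part and a Lyndon word, and their contributions to the product.

isOdd : ℕ → Bool
isOdd zero = false
isOdd (suc m) = not (isOdd m)

isOdd-+ : ∀ a → isOdd (a +ℕ a) ≡ false
isOdd-+ zero = refl
isOdd-+ (suc a) = trans (cong (not ∘ isOdd) (ℕₚ.+-suc a a)) (trans (Boolₚ.not-involutive (isOdd (a +ℕ a))) (isOdd-+ a))

-- Admissible pairs (part, Lyndon word) with Lyndon words of length at most d; the largest part comes first.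
module Items {n : ℕ} (G : SimpleGraph n) (d : ℕ) where
  open HeapWords G
  open LyndonHeaps G
  open WordLists G

  Item : Set
  Item = ℕ × Word n

  _≟ⁱ_ : (i j : Item) → Dec (i ≡ j)
  (j , L) ≟ⁱ (j′ , L′) with j ℕₚ.≟ j′ | L ≟ʷ L′
  ... | yes refl | yes refl = yes refl
  ... | no p | _ = no λ { refl → p refl }
  ... | yes _ | no p = no λ { refl → p refl }

  -- Condition (ii), with the decidable `isOdd` in place of `Odd`.
  Admissible : Item → Set
  Admissible (j , L) = j ≡ length L ⊎ (isOdd (length L) ≡ true × j ≡ length L +ℕ length L)

  admissible? : Decidable Admissible
  admissible? (j , L) = (j ℕₚ.≟ length L) ⊎-dec ((isOdd (length L) Boolₚ.≟ true) ×-dec (j ℕₚ.≟ (length L +ℕ length L)))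

  -- A word of odd length may carry twice its length, hence parts up to `d + d`. Parts are the outer
  -- index in decreasing order, so that every multiset lists its parts as a partition.
  candidates : List Item
  candidates = cartesianProduct (downFrom (suc (d +ℕ d))) (lyndonWords d)

  items : List Item
  items = filter admissible? candidates

  items-unique : Unique items
  items-unique = Uniqueₚ.filter⁺ admissible? (Uniqueₚ.cartesianProduct⁺ (Uniqueₚ.downFrom⁺ (suc (d +ℕ d))) (lyndonWords-unique d))

  ∈-items⁺ : ∀ {j L} → LW L → length L ≤ℕ d → Admissible (j , L) → (j , L) ∈ items
  ∈-items⁺ {j} {L} lw l a = ∈-filter⁺ admissible? (∈-cartesianProduct⁺ (∈-downFrom⁺ (s≤s (small a))) (∈-lyndonWords⁺ d lw l)) a
    where
    small : Admissible (j , L) → j ≤ℕ d +ℕ d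
    small (inj₁ refl) = ℕₚ.≤-trans l (ℕₚ.m≤m+n d d)
    small (inj₂ (_ , refl)) = ℕₚ.+-mono-≤ l l

  ∈-items⁻ : ∀ {j L} → (j , L) ∈ items → LW L × length L ≤ℕ d × Admissible (j , L)
  ∈-items⁻ {j} {L} i∈ with ∈-filter⁻ admissible? {xs = candidates} i∈
  ... | p , a with ∈-lyndonWords⁻ d (proj₂ (∈-cartesianProduct⁻ (downFrom (suc (d +ℕ d))) (lyndonWords d) p))
  ...   | lw , l = lw , l , a

  item-positive : ∀ {j L} → (j , L) ∈ items → 1 ≤ℕ j
  item-positive {j} {[]} i∈ = ⊥-elim (proj₁ (proj₁ (∈-items⁻ i∈)) refl)
  item-positive {j} {x ∷ L} i∈ with proj₂ (proj₂ (∈-items⁻ i∈))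
  ... | inj₁ refl = s≤s z≤n
  ... | inj₂ (_ , refl) = s≤s z≤n

  items-sorted : AllPairs (λ i j → proj₁ j ≤ℕ proj₁ i) items
  items-sorted = AllPairsₚ.filter⁺ admissible? (product (downFrom (suc (d +ℕ d))) (descending (suc (d +ℕ d))))
    where
    descending : ∀ m → AllPairs (λ i j → j ≤ℕ i) (downFrom m)
    descending m = AllPairsₚ.applyDownFrom⁺₁ id m (λ j<i _ → ℕₚ.<⇒≤ j<i)
    product : ∀ js → AllPairs (λ i j → j ≤ℕ i) js → AllPairs (λ i j → proj₁ j ≤ℕ proj₁ i) (cartesianProduct js (lyndonWords d))
    product [] [] = []
    product (j ∷ js) (p ∷ ps) = AllPairsₚ.++⁺ (AllPairsₚ.map⁺ (same (lyndonWords d))) (product js ps)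
      (Allₚ.map⁺ (All.tabulate λ _ → All.tabulate λ q∈ → All.lookup p (proj₁ (∈-cartesianProduct⁻ js (lyndonWords d) q∈))))
      where
      same : (Ls : List (Word n)) → AllPairs (λ _ _ → j ≤ℕ j) Ls
      same [] = []
      same (_ ∷ Ls) = All.tabulate (λ _ → ℕₚ.≤-refl) ∷ same Ls

  -- An odd part takes a word at most once by condition (iii). For even parts `d` is large enough:
  -- the power `d + 1` of `p̄'_j` vanishes in degree at most `d`, and a partition of `d` has at most
  -- `d` parts.
  bound : Item → ℕ
  bound (j , _) = if isOdd j then 1 else d

  open Multisets _≟ⁱ_ bound public

module GeometricSeries (R : CommutativeRing 0ℓ 0ℓ) where
  open CommutativeRing R renaming (refl to ≈-refl; sym to ≈-sym; trans to ≈-trans)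
  open Sums R
  open RingProps ring

  geometric-sum : ∀ x d → (1# - x) * ∑ (upTo (suc d)) (x ^_) ≈ 1# - x ^ suc d
  geometric-sum x d = ≈-trans ([y-z]x≈yx-zx _ 1# x) (≈-trans (+-cong (*-identityˡ _) (-‿cong (∑-*ˡ x (upTo (suc d)) (x ^_)))) (telescope d))
    where
    upTo-suc : ∀ (f : ℕ → Carrier) m → ∑ (upTo (suc m)) f ≈ ∑ (upTo m) f + f m
    upTo-suc f m = ≈-trans (reflexive (cong (λ l → ∑ l f) (sym (Listₚ.upTo-∷ʳ m))))
      (≈-trans (∑-++ (upTo m) (m ∷ []) f) (+-congˡ (+-identityʳ _)))
    telescope : ∀ m → ∑ (upTo (suc m)) (x ^_) - ∑ (upTo (suc m)) (λ i → x * x ^ i) ≈ 1# - x ^ suc m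
    telescope m = ≈-trans (+-cong shift (-‿cong (upTo-suc (λ i → x * x ^ i) m)))
      (≈-trans (+-congˡ (≈-sym (-‿+-comm _ _))) (≈-trans (≈-sym (+-assoc _ _ _)) (+-congʳ (//-rightDividesʳ _ _))))
      where
      shift : ∑ (upTo (suc m)) (x ^_) ≈ 1# + ∑ (upTo m) (λ i → x * x ^ i)
      shift = +-congˡ (≈-trans (reflexive (cong (λ l → ∑ l (x ^_)) (sym (Listₚ.map-upTo suc m)))) (∑-map suc (upTo m) (x ^_)))

  inverse-unique : ∀ {z u s} → z * u ≈ 1# → u * s ≈ 1# → z ≈ s
  inverse-unique {z} {u} {s} p q = ≈-trans (≈-sym (*-identityʳ z)) (≈-trans (*-congˡ (≈-sym q))
    (≈-trans (≈-sym (*-assoc z u s)) (≈-trans (*-congʳ p) (*-identityˡ s))))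

  ^-cong : ∀ {x y} m → x ≈ y → x ^ m ≈ y ^ m
  ^-cong zero p = ≈-refl
  ^-cong (suc m) p = *-cong p (^-cong m p)

  powers-of-0 : ∀ {x} d → x ≈ 0# → ∑ (upTo (suc d)) (x ^_) ≈ 1#
  powers-of-0 {x} d p = ≈-trans (+-congˡ (∑-0 (applyUpTo suc d) (λ i∈ → positive (∈-applyUpTo⁻ suc i∈)))) (+-identityʳ 1#)
    where
    positive : ∀ {i} → ∃[ j ] (j <ℕ d × i ≡ suc j) → x ^ i ≈ 0#
    positive (j , _ , refl) = ≈-trans (*-congʳ p) (zeroˡ _)

module Factors {n : ℕ} (G : SimpleGraph n) (R : CommutativeRing 0ℓ 0ℓ) (k d : ℕ) where
  private
    module R = CommutativeRing R
    module Rk = CommutativeRing (MultiSeries.Ring R k)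
    module S = CommutativeRing (PowerSeries.seriesRing R)
    module 𝕋 = CommutativeRing (MultiSeries.truncRing R k d)
    module 𝕋₁ = CommutativeRing (MultiSeries.truncRing R 1 d)
    module 𝕋∑ = Sums (MultiSeries.truncRing R k d)
  open HeapWords G
  open LyndonHeaps G
  open WordLists G
  open Items G d
  open Sums R
  open PowerSeries R
  open MultiSeries R

  tm : ℕ → Series
  tm l = mono R.1# l

  private
    exact : ∀ {x y} → x Rk.≈ y → x 𝕋.≈ y
    exact {x} {y} = exact⇒trunc k d {x} {y}

  tm-geo : ∀ l → (one S.- tm (suc l)) S.* geo (suc l) S.≈ one
  tm-geo l m = R.trans (RingProps.[y-z]x≈yx-zx S.ring (geo (suc l)) one (tm (suc l)) m)
    (R.trans (R.+-congʳ (⊛-identityˡ (geo (suc l)) m)) (cases (suc l ≤ℕ? m)))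
    where
    cases : Dec (suc l ≤ℕ m) → geo (suc l) m R.- (tm (suc l) ⊛ geo (suc l)) m R.≈ one m
    cases (yes l≤m) = subst (λ i → geo (suc l) i R.- (tm (suc l) ⊛ geo (suc l)) i R.≈ one i) (ℕₚ.m+[n∸m]≡n l≤m)
      (R.trans (R.+-cong (R.reflexive period) (R.-‿cong (R.trans (mono-⊛-≥ R.1# (suc l) (geo (suc l)) (m ∸ suc l)) (R.*-identityˡ _)))) (R.-‿inverseʳ _))
      where
      period : geo (suc l) (suc l +ℕ (m ∸ suc l)) ≡ geo (suc l) (m ∸ suc l)
      period = cong ⟦_⟧ (does-⇔ (mk⇔ (λ p → Divₚ.∣m+n∣m⇒∣n p Divₚ.∣-refl) (Divₚ.∣m∣n⇒∣m+n Divₚ.∣-refl))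
        (suc l ∣? (suc l +ℕ (m ∸ suc l))) (suc l ∣? (m ∸ suc l)))
    cases (no l≰m) = R.trans (R.+-congˡ (R.trans (R.-‿cong (mono-⊛-< R.1# (suc l) (geo (suc l)) m (ℕₚ.≰⇒> l≰m))) (RingProps.-0#≈0# R.ring)))
      (R.trans (R.+-identityʳ _) (R.reflexive (below m (ℕₚ.≰⇒> l≰m))))
      where
      below : ∀ m → m <ℕ suc l → geo (suc l) m ≡ one m
      below zero _ = cong ⟦_⟧ (dec-true (suc l ∣? 0) (suc l Divₚ.∣0))
      below (suc m) m< = cong ⟦_⟧ (dec-false (suc l ∣? suc m) λ p → ℕₚ.<⇒≱ m< (Divₚ.∣⇒≤ p))

  tm-tm : ∀ l → tm l ⊛ tm l S.≈ tm (l +ℕ l)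
  tm-tm l m with l ≤ℕ? m
  ... | yes l≤m = subst (λ i → (tm l ⊛ tm l) i R.≈ tm (l +ℕ l) i) (ℕₚ.m+[n∸m]≡n l≤m)
      (R.trans (mono-⊛-≥ R.1# l (tm l) (m ∸ l)) (R.trans (R.*-identityˡ _) (R.reflexive (sym (shift l (m ∸ l))))))
    where
    shift : ∀ j i → tm (j +ℕ l) (j +ℕ i) ≡ tm l i
    shift zero i = refl
    shift (suc j) i = shift j i
  ... | no l≰m = R.trans (mono-⊛-< R.1# l (tm l) m (ℕₚ.≰⇒> l≰m)) (R.reflexive (sym (small (l +ℕ l) m (ℕₚ.<-≤-trans (ℕₚ.≰⇒> l≰m) (ℕₚ.m≤m+n l l)))))
    where
    small : ∀ L m → m <ℕ L → tm L m ≡ R.0#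
    small (suc L) zero _ = refl
    small (suc L) (suc m) (s≤s q) = small L m q

  -- `1 - t²ˡ = (1 - tˡ)(1 + tˡ)`, and `geo` cancels the first factor.
  one+tm : ∀ l → one S.+ tm (suc l) S.≈ geo (suc l) S.* (one S.- tm (suc l +ℕ suc l))
  one+tm l = S.sym (S.trans (S.*-congˡ {g} (S.trans (S.+-congˡ {one} (S.-‿cong (S.sym (tm-tm (suc l))))) (S.sym difference-of-squares)))
    (S.trans (S.sym (S.*-assoc g (one S.- t) (one S.+ t))) (S.trans (S.*-congʳ {one S.+ t} (S.trans (S.*-comm g (one S.- t)) (tm-geo l)))
      (S.*-identityˡ (one S.+ t)))))
    where
    g t : Series
    g = geo (suc l)
    t = tm (suc l)
    difference-of-squares : (one S.- t) S.* (one S.+ t) S.≈ one S.- t S.* t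
    difference-of-squares = S.trans (RingProps.[y-z]x≈yx-zx S.ring (one S.+ t) one t)
      (S.trans (S.+-cong (S.*-identityˡ (one S.+ t)) (S.-‿cong (S.trans (S.distribˡ t one t) (S.+-congʳ {t S.* t} (S.*-identityʳ t)))))
        (S.trans (S.+-congˡ {one S.+ t} (S.sym (RingProps.-‿+-comm S.ring t (t S.* t))))
          (S.trans (S.sym (S.+-assoc (one S.+ t) (S.- t) (S.- (t S.* t)))) (S.+-congʳ {S.- (t S.* t)} (RingProps.//-rightDividesʳ S.ring t one)))))

  Ord≥-pbar : ∀ j f → f 0 R.≈ R.1# → Ord≥ j 1 (CommutativeRing._-_ (Ring j) (ev j f) (CommutativeRing.1# (Ring j)))
  Ord≥-pbar zero f p l = R.-‿inverseʳ R.1#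
  Ord≥-pbar (suc j) f p zero = Ord≥-resp j (CommutativeRing.+-congʳ (Ring j)
    (CommutativeRing.trans (Ring j) (CommutativeRing.sym (Ring j) (•-1 j (ev j f))) (•-cong j (R.sym p) (CommutativeRing.refl (Ring j))))) (Ord≥-pbar j f p)
  Ord≥-pbar (suc j) f p (suc i) = subst (λ e → Ord≥ j e difference) (sym (ℕₚ.0∸n≡0 i)) (Ord≥0 j difference)
    where
    difference : ⟨ j ⟩
    difference = CommutativeRing._-_ (Ring (suc j)) (ev (suc j) f) (CommutativeRing.1# (Ring (suc j))) (suc i)

  geo-0 : ∀ l → geo l 0 R.≈ R.1#
  geo-0 l = R.reflexive (cong ⟦_⟧ (dec-true (l ∣? 0) (l Divₚ.∣0)))

  power-vanishes : ∀ x → Ord≥ k 1 x → x 𝕋∑.^ suc d 𝕋.≈ 𝕋.0#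
  power-vanishes x o = Ord≥-resp k (Rk.sym (Rk.trans (Rk.+-congˡ (RingProps.-0#≈0# Rk.ring)) (Rk.+-identityʳ _))) (order (suc d))
    where
    order : ∀ m → Ord≥ k m (x 𝕋∑.^ m)
    order zero = Ord≥0 k _
    order (suc m) = Ord≥-* k 1 m o (order m)

  -- Both sides invert `1 + p̄'_l`: the left by `tm-geo` in each variable, the right as a geometric
  -- sum whose remainder has order above `d`.
  ev-one-tm : ∀ l → ev k (one S.- tm (suc l)) 𝕋.≈ 𝕋∑.∑ (upTo (suc d)) ((𝕋.- pbar k (suc l)) 𝕋∑.^_)
  ev-one-tm l = GeometricSeries.inverse-unique (truncRing k d) {ev k (one S.- tm (suc l))} {U} {Σ}
    (exact (Rk.trans (Rk.sym (ev-* k (one S.- tm (suc l)) (geo (suc l)))) (Rk.trans (ev-cong k {(one S.- tm (suc l)) S.* geo (suc l)} {one} (tm-geo l)) (ev-1 k))))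
    (𝕋.trans (𝕋.*-congʳ {Σ} (exact 1-x)) (𝕋.trans (GeometricSeries.geometric-sum (truncRing k d) x d)
      (𝕋.trans (𝕋.+-congˡ {𝕋.1#} (𝕋.-‿cong (power-vanishes x (Ord≥-neg k (Ord≥-pbar k (geo (suc l)) (geo-0 (suc l)))))))
        (exact (Rk.trans (Rk.+-congˡ (RingProps.-0#≈0# Rk.ring)) (Rk.+-identityʳ Rk.1#))))))
    where
    U x Σ : ⟨ k ⟩
    U = ev k (geo (suc l))
    x = 𝕋.- pbar k (suc l)
    Σ = 𝕋∑.∑ (upTo (suc d)) (x 𝕋∑.^_)
    1-x : U Rk.≈ Rk.1# Rk.- x
    1-x = Rk.sym (Rk.trans (Rk.+-congˡ (RingProps.-‿involutive Rk.ring (pbar k (suc l))))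
      (Rk.trans (Rk.+-comm Rk.1# (pbar k (suc l))) (RingProps.//-rightDividesˡ Rk.ring Rk.1# U)))

  partSign : ℕ → R.Carrier
  partSign j = if isOdd j then R.1# else R.- R.1#

  module _ (B : Fin n → Bool) where

    inside : Word n → Bool
    inside L = all B L

    y : Fin n → R.Carrier
    y v = R.- ⟦ B v ⟧

    open WordSeries G R y using (weight; J)
    open LyndonFactorization G R y using (factor; J≈∏factors; trunc⇒pointwise)

    coefficient : Item → R.Carrier
    coefficient (j , L) = partSign j R.* ⟦ inside L ⟧

    x : Item → ⟨ k ⟩
    x i = _•_ {k} (coefficient i) (pbar k (proj₁ i))

    weight-inside : ∀ L → weight L R.≈ (if isOdd (length L) then R.- ⟦ inside L ⟧ else ⟦ inside L ⟧)
    weight-inside [] = R.refl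
    weight-inside (v ∷ L) = R.trans (R.*-congˡ (weight-inside L)) (step (isOdd (length L)) (B v) (inside L))
      where
      open RingProps R.ring
      step : ∀ o a c → (R.- ⟦ a ⟧) R.* (if o then R.- ⟦ c ⟧ else ⟦ c ⟧) R.≈ (if not o then R.- ⟦ a ∧ c ⟧ else ⟦ a ∧ c ⟧)
      step true a c = R.trans (R.sym (-‿distribˡ-* _ _)) (R.trans (R.-‿cong (R.sym (-‿distribʳ-* _ _))) (R.trans (-‿involutive _) (R.sym (⟦⟧-∧ a c))))
      step false a c = R.trans (R.sym (-‿distribˡ-* _ _)) (R.-‿cong (R.sym (⟦⟧-∧ a c)))

    -- For an odd part `1 + p̄'_j`, for an even part the geometric sum of `1/(1 + p̄'_j)`, and `1`
    -- for a word that leaves `B`.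
    itemFactor : Item → ⟨ k ⟩
    itemFactor i = 𝕋∑.∑ (upTo (suc (bound i))) (x i 𝕋∑.^_)

    parts-of : Word n → List ℕ
    parts-of L = if isOdd (length L) then (length L +ℕ length L) ∷ length L ∷ [] else length L ∷ []

    mono-cong : ∀ {c c′} L m → c R.≈ c′ → mono c L m R.≈ mono c′ L m
    mono-cong zero zero p = p
    mono-cong zero (suc m) p = R.refl
    mono-cong (suc L) zero p = R.refl
    mono-cong (suc L) (suc m) p = mono-cong L m p

    mono-0 : ∀ L m → mono R.0# L m R.≈ R.0#
    mono-0 zero zero = R.refl
    mono-0 zero (suc m) = R.refl
    mono-0 (suc L) zero = R.refl
    mono-0 (suc L) (suc m) = mono-0 L m

    mono-neg : ∀ L m → mono (R.- R.1#) L m R.≈ R.- tm L m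
    mono-neg zero zero = R.refl
    mono-neg zero (suc m) = R.sym (RingProps.-0#≈0# R.ring)
    mono-neg (suc L) zero = R.sym (RingProps.-0#≈0# R.ring)
    mono-neg (suc L) (suc m) = mono-neg L m

    outside-item : ∀ j L → inside L ≡ false → itemFactor (j , L) 𝕋.≈ 𝕋.1#
    outside-item j L e = GeometricSeries.powers-of-0 (truncRing k d) {x (j , L)} (bound (j , L))
      (exact (Rk.trans (•-cong k (R.trans (R.*-congˡ (R.reflexive (cong ⟦_⟧ e))) (R.zeroʳ (partSign j))) Rk.refl) (•-0 k _)))

    odd-item : ∀ j L → inside L ≡ true → isOdd j ≡ true → itemFactor (j , L) 𝕋.≈ ev k (geo j)
    odd-item j L e o = exact-sum (isOdd j) o
      where
      x≈ : x (j , L) Rk.≈ pbar k j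
      x≈ = Rk.trans (•-cong k (R.trans (R.*-cong (R.reflexive (cong (if_then R.1# else R.- R.1#) o)) (R.reflexive (cong ⟦_⟧ e))) (R.*-identityˡ R.1#)) Rk.refl) (•-1 k _)
      exact-sum : ∀ b → b ≡ true → 𝕋∑.∑ (upTo (suc (if b then 1 else d))) (x (j , L) 𝕋∑.^_) 𝕋.≈ ev k (geo j)
      exact-sum true _ = exact (Rk.trans (Rk.+-congˡ (Rk.trans (Rk.+-identityʳ _) (Rk.trans (Rk.*-identityʳ _) x≈)))
        (Rk.trans (Rk.+-comm Rk.1# (pbar k j)) (RingProps.//-rightDividesˡ Rk.ring Rk.1# (ev k (geo j)))))

    even-item : ∀ l L → inside L ≡ true → isOdd (suc l) ≡ false → itemFactor (suc l , L) 𝕋.≈ ev k (one S.- tm (suc l))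
    even-item l L e o = 𝕋.sym (𝕋.trans (ev-one-tm l) (𝕋.trans (𝕋∑.∑-cong (upTo (suc d))
        (λ {m} _ → GeometricSeries.^-cong (truncRing k d) {𝕋.- pbar k (suc l)} {x (suc l , L)} m (exact (Rk.sym x≈))))
      (𝕋.reflexive (cong (λ b → 𝕋∑.∑ (upTo (suc (if b then 1 else d))) (x (suc l , L) 𝕋∑.^_)) (sym o)))))
      where
      neg-• : ∀ k F → CommutativeRing._≈_ (Ring k) (_•_ {k} (R.- R.1#) F) (CommutativeRing.-_ (Ring k) F)
      neg-• zero F = R.trans (R.sym (RingProps.-‿distribˡ-* R.ring R.1# F)) (R.-‿cong (R.*-identityˡ F))
      neg-• (suc k) F i = neg-• k (F i)
      x≈ : x (suc l , L) Rk.≈ Rk.- pbar k (suc l)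
      x≈ = Rk.trans (•-cong k (R.trans (R.*-cong (R.reflexive (cong (if_then R.1# else R.- R.1#) o)) (R.reflexive (cong ⟦_⟧ e))) (R.*-identityʳ (R.- R.1#))) Rk.refl)
        (neg-• k (pbar k (suc l)))

    factor-outside : ∀ L → inside L ≡ false → ev k (factor d L) 𝕋.≈ 𝕋.1#
    factor-outside L e = exact {ev k (factor d L)} {Rk.1#} (Rk.trans (ev-cong k {factor d L} {one} λ m → R.trans (R.+-congˡ (R.trans (R.-‿cong
        (R.trans (mono-cong (length L) m (R.trans (weight-inside L) (vanish (isOdd (length L)) (inside L) e))) (mono-0 (length L) m))) (RingProps.-0#≈0# R.ring)))
        (R.+-identityʳ _)) (ev-1 k))
      where
      vanish : ∀ o c → c ≡ false → (if o then R.- ⟦ c ⟧ else ⟦ c ⟧) R.≈ R.0#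
      vanish true false _ = RingProps.-0#≈0# R.ring
      vanish false false _ = R.refl

    factor-even : ∀ L → inside L ≡ true → isOdd (length L) ≡ false → ev k (factor d L) 𝕋.≈ ev k (one S.- tm (length L))
    factor-even L e o = exact {ev k (factor d L)} {ev k (one S.- tm (length L))} (ev-cong k {factor d L} {one S.- tm (length L)} λ m → R.+-congˡ (R.-‿cong (mono-cong (length L) m (R.trans (weight-inside L) (value (isOdd (length L)) (inside L) o e)))))
      where
      value : ∀ o c → o ≡ false → c ≡ true → (if o then R.- ⟦ c ⟧ else ⟦ c ⟧) R.≈ R.1#
      value false true _ _ = R.refl

    factor-odd : ∀ L → inside L ≡ true → isOdd (length L) ≡ true → ev k (factor d L) 𝕋.≈ ev k (one S.+ tm (length L))
    factor-odd L e o = exact {ev k (factor d L)} {ev k (one S.+ tm (length L))} (ev-cong k {factor d L} {one S.+ tm (length L)} λ m → R.+-congˡ (R.trans (R.-‿cong (R.trans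
        (mono-cong (length L) m (R.trans (weight-inside L) (value (isOdd (length L)) (inside L) o e))) (mono-neg (length L) m))) (RingProps.-‿involutive R.ring _)))
      where
      value : ∀ o c → o ≡ true → c ≡ true → (if o then R.- ⟦ c ⟧ else ⟦ c ⟧) R.≈ R.- R.1#
      value true true _ _ = R.refl

    factor≈items : ∀ L → L ≢ [] → ev k (factor d L) 𝕋.≈ 𝕋∑.∏ (parts-of L) (λ j → itemFactor (j , L))
    factor≈items [] L≢[] = ⊥-elim (L≢[] refl)
    factor≈items L@(v ∷ L′) _ = by (inside L) (isOdd (length L)) refl refl
      where
      by : ∀ b o → inside L ≡ b → isOdd (length L) ≡ o →
        ev k (factor d L) 𝕋.≈ 𝕋∑.∏ (if o then (length L +ℕ length L) ∷ length L ∷ [] else length L ∷ []) (λ j → itemFactor (j , L))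
      by false true e o = 𝕋.trans (factor-outside L e) (𝕋.sym (𝕋∑.∏-1 ((length L +ℕ length L) ∷ length L ∷ []) {λ j → itemFactor (j , L)} (λ {j} _ → outside-item j L e)))
      by false false e o = 𝕋.trans (factor-outside L e) (𝕋.sym (𝕋∑.∏-1 (length L ∷ []) {λ j → itemFactor (j , L)} (λ {j} _ → outside-item j L e)))
      by true false e o = 𝕋.trans (factor-even L e o) (𝕋.sym (𝕋.trans (𝕋.*-identityʳ (itemFactor (length L , L))) (even-item (length L′) L e o)))
      by true true e o = 𝕋.trans (factor-odd L e o) (𝕋.trans (exact (Rk.trans (ev-cong k {one S.+ tm (length L)} {geo (length L) S.* T2} (one+tm (length L′))) (ev-* k (geo (length L)) T2)))
        (𝕋.trans (𝕋.*-comm (ev k (geo (length L))) (ev k T2)) (𝕋.*-cong (𝕋.sym (even-item (length L′ +ℕ length L) L e (isOdd-+ (length L))))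
          (𝕋.sym (𝕋.trans (𝕋.*-identityʳ (itemFactor (length L , L))) (odd-item (length L) L e o))))))
        where
        T2 : Series
        T2 = one S.- tm (length L +ℕ length L)

    ev-∏ : ∀ (vs : List (Word n)) → ev k (Sums.∏ (truncRing 1 d) vs (factor d)) 𝕋.≈ 𝕋∑.∏ vs (λ L → ev k (factor d L))
    ev-∏ [] = exact {ev k one} {Rk.1#} (ev-1 k)
    ev-∏ (v ∷ vs) = 𝕋.trans (exact (ev-* k (factor d v) (Sums.∏ (truncRing 1 d) vs (factor d)))) (𝕋.*-congˡ {ev k (factor d v)} (ev-∏ vs))

    ∏-filter : ∀ {X : Set} {P : X → Set} (P? : Decidable P) xs (f : X → ⟨ k ⟩) →
      𝕋∑.∏ (filter P? xs) f 𝕋.≈ 𝕋∑.∏ xs (λ i → if does (P? i) then f i else 𝕋.1#)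
    ∏-filter P? [] f = 𝕋.refl {𝕋.1#}
    ∏-filter P? (i ∷ xs) f with P? i
    ... | yes _ = 𝕋.*-congˡ {f i} (∏-filter P? xs f)
    ... | no _ = 𝕋.trans (∏-filter P? xs f) (𝕋.sym (𝕋.*-identityˡ _))

    ∏-cartesianProduct : ∀ {X Y : Set} (xs : List X) (ys : List Y) (f : X × Y → ⟨ k ⟩) →
      𝕋∑.∏ (cartesianProduct xs ys) f 𝕋.≈ 𝕋∑.∏ xs (λ a → 𝕋∑.∏ ys (λ c → f (a , c)))
    ∏-cartesianProduct [] ys f = 𝕋.refl {𝕋.1#}
    ∏-cartesianProduct (a ∷ xs) ys f = 𝕋.trans (𝕋∑.∏-++ (map (a ,_) ys) _ f)
      (𝕋.*-cong (𝕋∑.∏-map (a ,_) ys f) (∏-cartesianProduct xs ys f))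

    parts-of-admissible : ∀ L → L ≢ [] → length L ≤ℕ d → 𝕋∑.∏ (filter (λ j → admissible? (j , L)) (downFrom (suc (d +ℕ d)))) (λ j → itemFactor (j , L))
      𝕋.≈ 𝕋∑.∏ (parts-of L) (λ j → itemFactor (j , L))
    parts-of-admissible L L≢[] l = BigOperator.big-bij 𝕋.*-commutativeMonoid id id
      (Uniqueₚ.filter⁺ (λ j → admissible? (j , L)) (Uniqueₚ.downFrom⁺ (suc (d +ℕ d))))
      (distinct (isOdd (length L))) (λ j∈ → to j∈ , refl) (λ j∈ → from j∈ , refl) (λ {j} _ → 𝕋.refl {itemFactor (j , L)})
      where
      distinct : ∀ o → Unique (if o then (length L +ℕ length L) ∷ length L ∷ [] else length L ∷ [])
      distinct false = [] ∷ []
      distinct true = ((λ e → L≢[] (empty L (ℕₚ.+-cancelˡ-≡ (length L) _ _ (trans e (sym (ℕₚ.+-identityʳ (length L))))))) ∷ []) ∷ [] ∷ []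
        where
        empty : ∀ (L : Word n) → length L ≡ 0 → L ≡ []
        empty [] _ = refl
      to : ∀ {j} → j ∈ filter (λ j → admissible? (j , L)) (downFrom (suc (d +ℕ d))) → j ∈ parts-of L
      to {j} j∈ with isOdd (length L) | proj₂ (∈-filter⁻ (λ j → admissible? (j , L)) {xs = downFrom (suc (d +ℕ d))} j∈)
      ... | true | inj₁ refl = there (here refl)
      ... | true | inj₂ (_ , refl) = here refl
      ... | false | inj₁ refl = here refl
      ... | false | inj₂ (() , _)
      from : ∀ {j} → j ∈ parts-of L → j ∈ filter (λ j → admissible? (j , L)) (downFrom (suc (d +ℕ d)))
      from {j} j∈ = ∈-filter⁺ (λ j → admissible? (j , L)) (∈-downFrom⁺ (s≤s (small (admissible j∈)))) (admissible j∈)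
        where
        admissible : j ∈ parts-of L → Admissible (j , L)
        admissible j∈ with isOdd (length L)
        admissible (here refl) | true = inj₂ (refl , refl)
        admissible (there (here refl)) | true = inj₁ refl
        admissible (here refl) | false = inj₁ refl
        small : Admissible (j , L) → j ≤ℕ d +ℕ d
        small (inj₁ refl) = ℕₚ.≤-trans l (ℕₚ.m≤m+n d d)
        small (inj₂ (_ , refl)) = ℕₚ.+-mono-≤ l l

    -- Items are grouped by part, for the sake of their order, whereas the Lyndon product is grouped
    -- by word; the two products are exchanged.
    ∏-items : 𝕋∑.∏ items itemFactor 𝕋.≈ 𝕋∑.∏ (lyndonWords d) (λ L → ev k (factor d L))
    ∏-items = 𝕋.trans (∏-filter admissible? candidates itemFactor)
      (𝕋.trans (∏-cartesianProduct (downFrom (suc (d +ℕ d))) (lyndonWords d) _)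
      (𝕋.trans (𝕋∑.∏-swap (downFrom (suc (d +ℕ d))) (lyndonWords d) _)
      (𝕋∑.∏-cong (lyndonWords d) λ {L} L∈ → 𝕋.trans (𝕋.sym (∏-filter (λ j → admissible? (j , L)) (downFrom (suc (d +ℕ d))) (λ j → itemFactor (j , L))))
        (𝕋.trans (parts-of-admissible L (proj₁ (proj₁ (∈-lyndonWords⁻ d L∈))) (proj₂ (∈-lyndonWords⁻ d L∈)))
          (𝕋.sym (factor≈items L (proj₁ (proj₁ (∈-lyndonWords⁻ d L∈)))))))))

    ev-J : ev k (J (allFin n) (λ _ → true)) 𝕋.≈ 𝕋∑.∑ (msets items) (λ ms → 𝕋∑.∏ ms x)
    ev-J = 𝕋.trans (ev-trunc k d (trunc⇒pointwise d (J≈∏factors d)))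
      (𝕋.trans (ev-∏ (lyndonWords d)) (𝕋.trans (𝕋.sym ∏-items) (𝕋.sym (∑-msets (truncRing k d) items x))))

    ∏-x : ∀ ms → 𝕋∑.∏ ms x Rk.≈ _•_ {k} (∏ ms coefficient) (pbars k (map proj₁ ms))
    ∏-x [] = Rk.sym (•-1 k Rk.1#)
    ∏-x (i ∷ ms) = Rk.trans (Rk.*-congˡ (∏-x ms)) (•-* k (coefficient i) (∏ ms coefficient) (pbar k (proj₁ i)) (pbars k (map proj₁ ms)))

    -- `truncRing` changes only the equality, hence its sums are literally those of `Ring k`.
    ∑-same : ∀ {X : Set} (xs : List X) (f : X → ⟨ k ⟩) → 𝕋∑.∑ xs f ≡ Sums.∑ (Ring k) xs f
    ∑-same [] f = refl
    ∑-same (i ∷ xs) f = cong (f i Rk.+_) (∑-same xs f)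

    parts-positive : ∀ {ms} → ms ∈ msets items → All (1 ≤ℕ_) (map proj₁ ms)
    parts-positive ms∈ = Allₚ.map⁺ (All.map item-positive (msets-⊆ items ms∈))

    -- Coefficients are extracted from `ev-J`: on the left a product over the variables, which `ev`
    -- separates, on the right the coefficients of products of `p̄'`.
    ∏-J : ∀ α → length α ≡ k → sum α ≤ℕ d →
      ∏ α (J (allFin n) (λ _ → true)) R.≈ ∑ (msets items) (λ ms → ∏ ms coefficient R.* natR (coefP (map proj₁ ms) α))
    ∏-J α len small = R.trans (R.sym (coeff-ev k (J (allFin n) (λ _ → true)) α len))
      (R.trans (coeff-trunc k {d} {ev k (J (allFin n) (λ _ → true))} {𝕋∑.∑ (msets items) (λ ms → 𝕋∑.∏ ms x)} α ev-J small) (R.trans (R.trans (R.reflexive (cong (λ F → coeff k F α) (∑-same (msets items) (λ ms → 𝕋∑.∏ ms x)))) (coeff-∑ k (msets items) (λ ms → 𝕋∑.∏ ms x) α))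
        (∑-cong (msets items) λ {ms} ms∈ → R.trans (coeff-cong k α (∏-x ms)) (R.trans (coeff-• k _ _ α)
          (R.*-congˡ (coeff-pbars k (map proj₁ ms) (parts-positive ms∈) α len))))))

-- Colourings by colour classes, and inclusion-exclusion over vertex sets.

bools : List Bool
bools = true ∷ false ∷ []

module Subsets (R : CommutativeRing 0ℓ 0ℓ) where
  open CommutativeRing R renaming (refl to ≈-refl; sym to ≈-sym; trans to ≈-trans) hiding (zero)
  open Sums R
  open SetoidReasoning setoid

  ∏-allFin-suc : ∀ k (h : Fin (suc k) → Carrier) → ∏ (allFin (suc k)) h ≈ h zero * ∏ (allFin k) (h ∘ suc)
  ∏-allFin-suc k h = *-congˡ (≈-trans (reflexive (cong (λ l → ∏ l h) (sym (Listₚ.map-tabulate id suc)))) (∏-map suc (allFin k) h))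

  ⟦all⟧ : ∀ {X : Set} (p : X → Bool) xs → ⟦ all p xs ⟧ ≈ ∏ xs (λ x → ⟦ p x ⟧)
  ⟦all⟧ p [] = ≈-refl
  ⟦all⟧ p (x ∷ xs) = ≈-trans (⟦⟧-∧ (p x) (all p xs)) (*-congˡ (⟦all⟧ p xs))

  ∑-allVecs-suc : ∀ {X : Set} (xs : List X) m (F : Vec X (suc m) → Carrier) →
    ∑ (allVecs xs (suc m)) F ≈ ∑ xs (λ x → ∑ (allVecs xs m) (λ v → F (x v∷ v)))
  ∑-allVecs-suc xs m F = ≈-trans (∑-concatMap (λ x → map (x v∷_) (allVecs xs m)) xs F)
    (∑-cong xs λ {x} _ → ∑-map (x v∷_) (allVecs xs m) F)

  ∏-expand : ∀ n (a b : Fin n → Carrier) → ∏ (allFin n) (λ v → a v + b v)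
    ≈ ∑ (allVecs bools n) (λ W → ∏ (allFin n) (λ v → if vlookup W v then a v else b v))
  ∏-expand zero a b = ≈-sym (+-identityʳ _)
  ∏-expand (suc n) a b = begin
    ∏ (allFin (suc n)) (λ v → a v + b v)
      ≈⟨ ∏-allFin-suc n _ ⟩
    (a zero + b zero) * ∏ (allFin n) (λ v → a (suc v) + b (suc v))
      ≈⟨ *-congˡ (∏-expand n (a ∘ suc) (b ∘ suc)) ⟩
    (a zero + b zero) * T
      ≈⟨ distribʳ T _ _ ⟩
    a zero * T + b zero * T
      ≈⟨ +-cong (summand true) (≈-trans (summand false) (≈-sym (+-identityʳ _))) ⟩
    ∑ bools (λ c → ∑ (allVecs bools n) (λ W → ∏ (allFin (suc n)) (λ v → if vlookup (c v∷ W) v then a v else b v)))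
      ≈⟨ ∑-allVecs-suc bools n _ ⟨
    ∑ (allVecs bools (suc n)) (λ W → ∏ (allFin (suc n)) (λ v → if vlookup W v then a v else b v)) ∎
    where
    T : Carrier
    T = ∑ (allVecs bools n) (λ W → ∏ (allFin n) (λ v → if vlookup W v then a (suc v) else b (suc v)))
    summand : ∀ c → (if c then a zero else b zero) * T
      ≈ ∑ (allVecs bools n) (λ W → ∏ (allFin (suc n)) (λ v → if vlookup (c v∷ W) v then a v else b v))
    summand c = ≈-trans (∑-*ˡ _ (allVecs bools n) _) (∑-cong (allVecs bools n) λ _ → ≈-sym (∏-allFin-suc n _))

  sg : ∀ {n} → Vec Bool n → Carrier
  sg {n} W = ∏ (allFin n) (λ v → if vlookup W v then 1# else - 1#)

  -- Expand `∏ (1 - ⟦ not (e v) ⟧)`: outside `W` the second term is chosen.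
  inclusion-exclusion : ∀ {n} (e : Fin n → Bool) → ⟦ all e (allFin n) ⟧
    ≈ ∑ (allVecs bools n) (λ W → sg W * ⟦ all (λ v → vlookup W v ∨ not (e v)) (allFin n) ⟧)
  inclusion-exclusion {n} e = begin
    ⟦ all e (allFin n) ⟧
      ≈⟨ ⟦all⟧ e (allFin n) ⟩
    ∏ (allFin n) (λ v → ⟦ e v ⟧)
      ≈⟨ ∏-cong (allFin n) (λ {v} _ → complement (e v)) ⟩
    ∏ (allFin n) (λ v → 1# + - 1# * ⟦ not (e v) ⟧)
      ≈⟨ ∏-expand n (λ _ → 1#) (λ v → - 1# * ⟦ not (e v) ⟧) ⟩
    ∑ (allVecs bools n) (λ W → ∏ (allFin n) (λ v → if vlookup W v then 1# else - 1# * ⟦ not (e v) ⟧))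
      ≈⟨ ∑-cong (allVecs bools n) (λ {W} _ → ≈-trans (∏-cong (allFin n) (λ {v} _ → factor (vlookup W v) (e v)))
           (≈-trans (∏-* (allFin n) _ _) (*-congˡ (≈-sym (⟦all⟧ _ (allFin n)))))) ⟩
    ∑ (allVecs bools n) (λ W → sg W * ⟦ all (λ v → vlookup W v ∨ not (e v)) (allFin n) ⟧) ∎
    where
    complement : ∀ b → ⟦ b ⟧ ≈ 1# + - 1# * ⟦ not b ⟧
    complement true = ≈-sym (≈-trans (+-congˡ (zeroʳ _)) (+-identityʳ _))
    complement false = ≈-sym (≈-trans (+-congˡ (*-identityʳ _)) (-‿inverseʳ 1#))
    factor : ∀ w b → (if w then 1# else - 1# * ⟦ not b ⟧) ≈ (if w then 1# else - 1#) * ⟦ w ∨ not b ⟧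
    factor true b = ≈-sym (*-identityˡ 1#)
    factor false b = ≈-refl

  column : ∀ {k n} → Fin k → Vec (Vec Bool k) n → Vec Bool n
  column i κ = vmap (λ r → vlookup r i) κ

  -- Colourings are stored vertex by vertex; the first colour class is extracted from all of them,
  -- so that sums can be factored by colours.
  ∑-first-column : ∀ k n (F : Vec (Vec Bool (suc k)) n → Carrier) → ∑ (allVecs (allVecs bools (suc k)) n) F
    ≈ ∑ (allVecs bools n) (λ c → ∑ (allVecs (allVecs bools k) n) (λ κ → F (vzipWith _v∷_ c κ)))
  ∑-first-column k zero F = ≈-sym (+-identityʳ _)
  ∑-first-column k (suc n) F = begin
    ∑ (allVecs (allVecs bools (suc k)) (suc n)) F
      ≈⟨ ∑-allVecs-suc (allVecs bools (suc k)) n F ⟩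
    ∑ (allVecs bools (suc k)) (λ r → ∑ (allVecs (allVecs bools (suc k)) n) (λ κ → F (r v∷ κ)))
      ≈⟨ ∑-allVecs-suc bools k _ ⟩
    ∑ bools (λ b → ∑ (allVecs bools k) (λ r → ∑ (allVecs (allVecs bools (suc k)) n) (λ κ → F ((b v∷ r) v∷ κ))))
      ≈⟨ ∑-cong bools (λ {b} _ → ≈-trans
           (∑-cong (allVecs bools k) (λ {r} _ → ∑-first-column k n (λ κ → F ((b v∷ r) v∷ κ))))
           (≈-trans (∑-swap (allVecs bools k) (allVecs bools n) _)
             (∑-cong (allVecs bools n) (λ {c} _ → ≈-sym (∑-allVecs-suc (allVecs bools k) n (λ κ → F (vzipWith _v∷_ (b v∷ c) κ))))))) ⟩
    ∑ bools (λ b → ∑ (allVecs bools n) (λ c → ∑ (allVecs (allVecs bools k) (suc n)) (λ κ → F (vzipWith _v∷_ (b v∷ c) κ))))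
      ≈⟨ ∑-allVecs-suc bools n _ ⟨
    ∑ (allVecs bools (suc n)) (λ c → ∑ (allVecs (allVecs bools k) (suc n)) (λ κ → F (vzipWith _v∷_ c κ))) ∎

  column-zero : ∀ {k n} (c : Vec Bool n) (κ : Vec (Vec Bool k) n) → column zero (vzipWith _v∷_ c κ) ≡ c
  column-zero v[] v[] = refl
  column-zero (b v∷ c) (r v∷ κ) = cong (b v∷_) (column-zero c κ)

  column-suc : ∀ {k n} i (c : Vec Bool n) (κ : Vec (Vec Bool k) n) → column (suc i) (vzipWith _v∷_ c κ) ≡ column i κ
  column-suc i v[] v[] = refl
  column-suc i (b v∷ c) (r v∷ κ) = cong (vlookup r i v∷_) (column-suc i c κ)

  ∑-by-columns : ∀ k n (g : Fin k → Vec Bool n → Carrier) →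
    ∑ (allVecs (allVecs bools k) n) (λ κ → ∏ (allFin k) (λ i → g i (column i κ))) ≈ ∏ (allFin k) (λ i → ∑ (allVecs bools n) (g i))
  ∑-by-columns zero n g = only-one n
    where
    only-one : ∀ n → ∑ (allVecs (allVecs bools 0) n) (λ _ → 1#) ≈ 1#
    only-one zero = +-identityʳ _
    only-one (suc n) = ≈-trans (∑-allVecs-suc (allVecs bools 0) n _) (≈-trans (+-identityʳ _) (only-one n))
  ∑-by-columns (suc k) n g = begin
    ∑ (allVecs (allVecs bools (suc k)) n) (λ κ → ∏ (allFin (suc k)) (λ i → g i (column i κ)))
      ≈⟨ ∑-first-column k n _ ⟩
    ∑ (allVecs bools n) (λ c → ∑ (allVecs (allVecs bools k) n) (λ κ → ∏ (allFin (suc k)) (λ i → g i (column i (vzipWith _v∷_ c κ)))))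
      ≈⟨ ∑-cong (allVecs bools n) (λ {c} _ → ≈-trans (∑-cong (allVecs (allVecs bools k) n) (λ {κ} _ → ≈-trans (∏-allFin-suc k _)
           (*-cong (reflexive (cong (g zero) (column-zero c κ))) (∏-cong (allFin k) λ {i} _ → reflexive (cong (g (suc i)) (column-suc i c κ))))))
           (≈-sym (∑-*ˡ (g zero c) (allVecs (allVecs bools k) n) _))) ⟩
    ∑ (allVecs bools n) (λ c → g zero c * ∑ (allVecs (allVecs bools k) n) (λ κ → ∏ (allFin k) (λ i → g (suc i) (column i κ))))
      ≈⟨ ∑-*ʳ _ (allVecs bools n) (g zero) ⟨
    ∑ (allVecs bools n) (g zero) * ∑ (allVecs (allVecs bools k) n) (λ κ → ∏ (allFin k) (λ i → g (suc i) (column i κ)))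
      ≈⟨ *-congˡ (∑-by-columns k n (g ∘ suc)) ⟩
    ∑ (allVecs bools n) (g zero) * ∏ (allFin k) (λ i → ∑ (allVecs bools n) (g (suc i)))
      ≈⟨ ∏-allFin-suc k _ ⟨
    ∏ (allFin (suc k)) (λ i → ∑ (allVecs bools n) (g i)) ∎

  ∏-vlookup : ∀ α (h : ℕ → Carrier) → ∏ (allFin (length α)) (λ i → h (vlookup (fromList α) i)) ≈ ∏ α h
  ∏-vlookup [] h = ≈-refl
  ∏-vlookup (a ∷ α) h = ≈-trans (∏-allFin-suc (length α) _) (*-congˡ (∏-vlookup α h))

module StableSets {n : ℕ} (G : SimpleGraph n) where
  open HeapWords G
  open WordLists G using (avoid)

  size : ∀ {k} → Vec Bool k → ℕ
  size v[] = 0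
  size (true v∷ c) = suc (size c)
  size (false v∷ c) = size c

  -- Follows the deletion recursion of `J` instead of testing pairs, so that the two agree by
  -- induction; `f` names the vertices still to be decided.
  stable : ∀ {k} → (Fin k → Fin n) → (Fin n → Bool) → Vec Bool k → Bool
  stable f A v[] = true
  stable f A (true v∷ c) = A (f zero) ∧ stable (f ∘ suc) (avoid (f zero) A) c
  stable f A (false v∷ c) = stable (f ∘ suc) A c

  within : ∀ {k} → (Fin k → Bool) → Vec Bool k → Bool
  within B c = all (λ v → B v ∨ not (vlookup c v)) (allFin _)

  stable⁻ : ∀ {k} (f : Fin k → Fin n) A c → stable f A c ≡ true →
    (∀ i → vlookup c i ≡ true → A (f i) ≡ true) × (∀ i j → i <ᶠ j → vlookup c i ≡ true → vlookup c j ≡ true → conn G (f j) (f i) ≡ false)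
  stable⁻ f A v[] e = (λ ()) , λ ()
  stable⁻ f A (false v∷ c) e with stable⁻ (f ∘ suc) A c e
  ... | p , q = (λ { (suc i) → p i }) , λ { (suc i) (suc j) (s≤s l) → q i j l }
  stable⁻ f A (true v∷ c) e with ∧⁻ {A (f zero)} e
  ... | a , e′ with stable⁻ (f ∘ suc) (avoid (f zero) A) c e′
  ...   | p , q = (λ { zero _ → a ; (suc i) ci → proj₁ (∧⁻ (p i ci)) })
      , λ { zero (suc j) _ _ cj → disconnected (proj₂ (∧⁻ {A (f (suc j))} (p j cj))) ; (suc i) (suc j) (s≤s l) → q i j l }
    where
    disconnected : ∀ {b} → not b ≡ true → b ≡ false
    disconnected {false} _ = refl

  stable⁺ : ∀ {k} (f : Fin k → Fin n) A c → (∀ i → vlookup c i ≡ true → A (f i) ≡ true) →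
    (∀ i j → i <ᶠ j → vlookup c i ≡ true → vlookup c j ≡ true → conn G (f j) (f i) ≡ false) → stable f A c ≡ true
  stable⁺ f A v[] p q = refl
  stable⁺ f A (false v∷ c) p q = stable⁺ (f ∘ suc) A c (p ∘ suc) (λ i j l → q (suc i) (suc j) (s≤s l))
  stable⁺ f A (true v∷ c) p q = ∧⁺ (p zero refl) (stable⁺ (f ∘ suc) (avoid (f zero) A) c
    (λ i ci → ∧⁺ (p (suc i) ci) (cong not (q zero (suc i) (s≤s z≤n) refl ci))) (λ i j l → q (suc i) (suc j) (s≤s l)))

  everywhere : Fin n → Bool
  everywhere _ = true

  stable⇒¬adj : ∀ c → stable id everywhere c ≡ true → ∀ u v → vlookup c u ≡ true → vlookup c v ≡ true → adj G u v ≡ false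
  stable⇒¬adj c e u v cu cv with Finₚ.<-cmp u v
  ... | tri< u<v _ _ = ∥⇒¬adj (∥-sym (proj₂ (stable⁻ id everywhere c e) u v u<v cu cv))
  ... | tri≈ _ refl _ = SimpleGraph.irrefl G u
  ... | tri> _ _ v<u = ∥⇒¬adj (proj₂ (stable⁻ id everywhere c e) v u v<u cv cu)

  ¬adj⇒stable : ∀ c → (∀ u v → vlookup c u ≡ true → vlookup c v ≡ true → adj G u v ≡ false) → stable id everywhere c ≡ true
  ¬adj⇒stable c h = stable⁺ id everywhere c (λ _ _ → refl) λ i j i<j ci cj → ¬adj⇒∥ (λ j≡i → Finₚ.<-irrefl (sym j≡i) i<j) (h j i cj ci)

  countB-tabulate : ∀ {k} {X : Set} (p : X → Bool) (f : Fin k → X) (c : Vec Bool k) → (∀ i → p (f i) ≡ vlookup c i) →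
    countB p (tabulate f) ≡ size c
  countB-tabulate p f v[] h = refl
  countB-tabulate p f (b v∷ c) h with p (f zero) | h zero
  ... | true | refl = cong suc (countB-tabulate p (f ∘ suc) c (h ∘ suc))
  ... | false | refl = countB-tabulate p (f ∘ suc) c (h ∘ suc)

module StableSetSeries {n : ℕ} (G : SimpleGraph n) (R : CommutativeRing 0ℓ 0ℓ) (B : Fin n → Bool) where
  open CommutativeRing R renaming (refl to ≈-refl; sym to ≈-sym; trans to ≈-trans) hiding (zero)
  open Sums R
  open Subsets R
  open PowerSeries R
  open StableSets G
  open WordLists G using (avoid)
  open WordSeries G R (λ v → - ⟦ B v ⟧) using (J)

  stableSets : ∀ {k} → (Fin k → Fin n) → (Fin n → Bool) → ℕ → Carrier
  stableSets {k} f A m = ∑ (allVecs bools k) (λ c → ⟦ stable f A c ∧ (size c ≡ᵇ m) ⟧ * ⟦ within (B ∘ f) c ⟧)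

  within-∷ : ∀ {k} (f : Fin (suc k) → Bool) b c → ⟦ within f (b v∷ c) ⟧ ≈ ⟦ f zero ∨ not b ⟧ * ⟦ within (f ∘ suc) c ⟧
  within-∷ {k} f b c = ≈-trans (⟦all⟧ (λ v → f v ∨ not (vlookup (b v∷ c) v)) (allFin (suc k)))
    (≈-trans (∏-allFin-suc k _) (*-congˡ (≈-sym (⟦all⟧ (λ v → f (suc v) ∨ not (vlookup c v)) (allFin k)))))

  -- The first entry of the vector decides between the two terms of the deletion recursion. The sign
  -- in `J` cancels against the negative weight, which leaves the coefficients of `I_W(t)`.
  J≈stableSets : ∀ {k} (f : Fin k → Fin n) A m → J (tabulate f) A m ≈ stableSets f A m
  J≈stableSets {zero} f A zero = ≈-sym (≈-trans (+-identityʳ _) (*-identityˡ _))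
  J≈stableSets {zero} f A (suc m) = ≈-sym (≈-trans (+-identityʳ _) (zeroˡ _))
  J≈stableSets {suc k} f A m = ≈-sym (≈-trans (∑-allVecs-suc bools k _)
    (≈-trans (+-cong (with-first (A (f zero)) m) (≈-trans (+-identityʳ _) without-first)) (≈-trans (+-comm _ _) (combine (A (f zero)) m))))
    where
    A′ : Fin n → Bool
    A′ = avoid (f zero) A
    without-first : ∑ (allVecs bools k) (λ c → ⟦ stable f A (false v∷ c) ∧ (size (false v∷ c) ≡ᵇ m) ⟧ * ⟦ within (B ∘ f) (false v∷ c) ⟧)
      ≈ J (tabulate (f ∘ suc)) A m
    without-first = ≈-trans (∑-cong (allVecs bools k) λ {c} _ → *-congˡ (≈-trans (within-∷ (B ∘ f) false c)
      (≈-trans (*-congʳ (reflexive (cong ⟦_⟧ (Boolₚ.∨-zeroʳ (B (f zero)))))) (*-identityˡ _)))) (≈-sym (J≈stableSets (f ∘ suc) A m))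
    first : Bool → ℕ → Carrier
    first a zero = 0#
    first a (suc m) = ⟦ a ⟧ * (⟦ B (f zero) ⟧ * J (tabulate (f ∘ suc)) A′ m)
    with-first : ∀ a m → ∑ (allVecs bools k) (λ c → ⟦ (a ∧ stable (f ∘ suc) A′ c) ∧ (suc (size c) ≡ᵇ m) ⟧ * ⟦ within (B ∘ f) (true v∷ c) ⟧)
      ≈ first a m
    with-first a zero = ∑-0 (allVecs bools k) λ {c} _ → ≈-trans (*-congʳ (reflexive (cong ⟦_⟧ (Boolₚ.∧-zeroʳ (a ∧ stable (f ∘ suc) A′ c))))) (zeroˡ _)
    with-first a (suc m) = ≈-trans (∑-cong (allVecs bools k) λ {c} _ → rearrange c)
      (≈-trans (≈-sym (∑-*ˡ (⟦ a ⟧) (allVecs bools k) _)) (*-congˡ (≈-trans (≈-sym (∑-*ˡ (⟦ B (f zero) ⟧) (allVecs bools k) _))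
        (*-congˡ (≈-sym (J≈stableSets (f ∘ suc) A′ m))))))
      where
      rearrange : ∀ c → ⟦ (a ∧ stable (f ∘ suc) A′ c) ∧ (size c ≡ᵇ m) ⟧ * ⟦ within (B ∘ f) (true v∷ c) ⟧
        ≈ ⟦ a ⟧ * (⟦ B (f zero) ⟧ * (⟦ stable (f ∘ suc) A′ c ∧ (size c ≡ᵇ m) ⟧ * ⟦ within (B ∘ f ∘ suc) c ⟧))
      rearrange c = ≈-trans (*-cong (≈-trans (reflexive (cong ⟦_⟧ (Boolₚ.∧-assoc a _ _))) (⟦⟧-∧ a _))
          (≈-trans (within-∷ (B ∘ f) true c) (*-congʳ (reflexive (cong ⟦_⟧ (Boolₚ.∨-identityʳ (B (f zero))))))))
        (≈-trans (*-assoc _ _ _) (*-congˡ (CSProps.x∙yz≈y∙xz *-commutativeSemigroup _ _ _)))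
    combine : ∀ a m → J (tabulate (f ∘ suc)) A m + first a m
      ≈ (if a then (λ i → J (tabulate (f ∘ suc)) A i - (mono (- ⟦ B (f zero) ⟧) 1 ⊛ J (tabulate (f ∘ suc)) A′) i) else J (tabulate (f ∘ suc)) A) m
    combine true zero = +-congˡ (≈-sym (≈-trans (-‿cong (zeroˡ _)) (RingProps.-0#≈0# ring)))
    combine true (suc m) = +-congˡ (≈-trans (*-identityˡ _) (≈-sym (≈-trans (-‿cong (≈-trans (mono-⊛-≥ _ 1 _ m) (≈-sym (RingProps.-‿distribˡ-* ring _ _))))
      (RingProps.-‿involutive ring _))))
    combine false zero = +-identityʳ _
    combine false (suc m) = ≈-trans (+-congˡ (zeroˡ _)) (+-identityʳ _)

module KromaticCoefficients {n : ℕ} (G : SimpleGraph n) (R : CommutativeRing 0ℓ 0ℓ) (d : ℕ) where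
  open CommutativeRing R renaming (refl to ≈-refl; sym to ≈-sym; trans to ≈-trans) hiding (zero)
  open Sums R
  open Subsets R
  open StableSets G
  open Items G d
  open SetoidReasoning setoid

  uses? : ∀ v (ms : List Item) → Dec (Any (λ i → v ∈ proj₂ i) ms)
  uses? v = any? (λ i → mem? _≟ᶠ_ v (proj₂ i))

  covers : List Item → Bool
  covers ms = all (λ v → does (uses? v ms)) (allFin n)

  partSign : ℕ → Carrier
  partSign j = if isOdd j then 1# else - 1#

  J : (Fin n → Bool) → ℕ → Carrier
  J B = WordSeries.J G R (λ v → - ⟦ B v ⟧) (allFin n) everywhere

  module _ (α : List ℕ) where
    private
      k : ℕ
      k = length α

    colorings : List (Vec (Vec Bool k) n)
    colorings = allVecs (allVecs bools k) n

    inhabited : Vec (Vec Bool k) n → Fin n → Bool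
    inhabited κ v = any (vlookup (vlookup κ v)) (allFin k)

    proper : Vec (Vec Bool k) n → Bool
    proper κ = all (λ u → all (λ v → not (adj G u v) ∨ all (λ i → not (vlookup (vlookup κ u) i ∧ vlookup (vlookup κ v) i)) (allFin k)) (allFin n)) (allFin n)

    counted : Vec (Vec Bool k) n → Bool
    counted κ = all (λ i → countB (λ v → vlookup (vlookup κ v) i) (allFin n) ≡ᵇ vlookup (fromList α) i) (allFin k)

    goodColumn : Fin k → Vec Bool n → Bool
    goodColumn i c = stable id everywhere c ∧ (size c ≡ᵇ vlookup (fromList α) i)

    column-lookup : ∀ (κ : Vec (Vec Bool k) n) i v → vlookup (column i κ) v ≡ vlookup (vlookup κ v) i
    column-lookup κ i v = Vecₚ.lookup-map v (λ r → vlookup r i) κ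

    column-size : ∀ κ i → countB (λ v → vlookup (vlookup κ v) i) (allFin n) ≡ size (column i κ)
    column-size κ i = countB-tabulate _ id (column i κ) (λ v → sym (column-lookup κ i v))

    -- Properness and the exponent of a colour both concern single colour classes: each is stable
    -- and has the prescribed size.
    by-columns : ∀ κ → proper κ ∧ counted κ ≡ all (λ i → goodColumn i (column i κ)) (allFin k)
    by-columns κ = ⇔⇒≡ to from
      where
      to : proper κ ∧ counted κ ≡ true → all (λ i → goodColumn i (column i κ)) (allFin k) ≡ true
      to e with ∧⁻ {proper κ} e
      ... | p , q = allFin⁺ _ λ i → ∧⁺ (¬adj⇒stable (column i κ) (λ u v cu cv → no-edge u v i
            (trans (sym (column-lookup κ i u)) cu) (trans (sym (column-lookup κ i v)) cv)))
          (trans (cong (_≡ᵇ vlookup (fromList α) i) (sym (column-size κ i))) (allFin⁻ _ q i))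
        where
        no-edge : ∀ u v i → vlookup (vlookup κ u) i ≡ true → vlookup (vlookup κ v) i ≡ true → adj G u v ≡ false
        no-edge u v i cu cv with adj G u v | allFin⁻ (λ v → not (adj G u v) ∨ all (λ i → not (vlookup (vlookup κ u) i ∧ vlookup (vlookup κ v) i)) (allFin k)) (allFin⁻ _ p u) v
        ... | false | _ = refl
        ... | true | h = ⊥-elim (not⁻ (allFin⁻ _ h i) (∧⁺ cu cv))
      from : all (λ i → goodColumn i (column i κ)) (allFin k) ≡ true → proper κ ∧ counted κ ≡ true
      from e = ∧⁺ (allFin⁺ _ λ u → allFin⁺ _ λ v → not-∨⁺ λ edge → allFin⁺ _ λ i → not⁺ λ both → conflict u v i edge (∧⁻ both))
          (allFin⁺ _ λ i → trans (cong (_≡ᵇ vlookup (fromList α) i) (column-size κ i)) (proj₂ (∧⁻ {stable id everywhere (column i κ)} (allFin⁻ _ e i))))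
        where
        conflict : ∀ u v i → adj G u v ≡ true → vlookup (vlookup κ u) i ≡ true × vlookup (vlookup κ v) i ≡ true → ⊥
        conflict u v i edge (cu , cv) = case trans (sym edge) (stable⇒¬adj (column i κ) (proj₁ (∧⁻ (allFin⁻ _ e i))) u v
          (trans (column-lookup κ i u) cu) (trans (column-lookup κ i v) cv)) of λ ()

    within-columns : ∀ (B : Fin n → Bool) κ → all (λ v → B v ∨ not (inhabited κ v)) (allFin n) ≡ all (λ i → within B (column i κ)) (allFin k)
    within-columns B κ = ⇔⇒≡
      (λ e → allFin⁺ _ λ i → allFin⁺ _ λ v → ∨-not⁺ λ cv → ∨-not⁻ (allFin⁻ _ e v) (any⁺ (vlookup (vlookup κ v)) (∈-allFin i) (trans (sym (column-lookup κ i v)) cv)))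
      (λ e → allFin⁺ _ λ v → ∨-not⁺ λ used → from e v (any⁻ (vlookup (vlookup κ v)) (allFin k) used))
      where
      from : all (λ i → within B (column i κ)) (allFin k) ≡ true → ∀ v → ∃[ i ] (i ∈ allFin k × vlookup (vlookup κ v) i ≡ true) → B v ≡ true
      from e v (i , _ , cv) = ∨-not⁻ (allFin⁻ _ (allFin⁻ _ e i) v) (trans (column-lookup κ i v) cv)

    -- For fixed `W`, the colourings that colour no vertex outside `W`, with empty colour sets
    -- allowed, factor over the colours; each colour contributes a coefficient of `I_W`.
    coefX≈∑J : natR (coefX G α) ≈ ∑ (allVecs bools n) (λ W → sg W * ∏ α (J (vlookup W)))
    coefX≈∑J = begin
      natR (coefX G α)
        ≈⟨ natR-length (filterᵇ valid colorings) ⟩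
      ∑ (filterᵇ valid colorings) (λ _ → 1#)
        ≈⟨ ≈-trans (∑-filterᵇ valid colorings _) (∑-cong colorings λ {κ} _ → *-identityʳ _) ⟩
      ∑ colorings (λ κ → ⟦ all (inhabited κ) (allFin n) ∧ (proper κ ∧ counted κ) ⟧)
        ≈⟨ ∑-cong colorings (λ {κ} _ → expand κ) ⟩
      ∑ colorings (λ κ → ∑ (allVecs bools n) (λ W → sg W * ∏ (allFin k) (λ i → term W i (column i κ))))
        ≈⟨ ∑-swap colorings (allVecs bools n) _ ⟩
      ∑ (allVecs bools n) (λ W → ∑ colorings (λ κ → sg W * ∏ (allFin k) (λ i → term W i (column i κ))))
        ≈⟨ ∑-cong (allVecs bools n) (λ {W} _ → ≈-trans (≈-sym (∑-*ˡ (sg W) colorings _)) (*-congˡ (≈-trans (∑-by-columns k n (term W))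
             (≈-trans (∏-cong (allFin k) (λ {i} _ → ≈-sym (StableSetSeries.J≈stableSets G R (vlookup W) id everywhere (vlookup (fromList α) i))))
               (∏-vlookup α (J (vlookup W))))))) ⟩
      ∑ (allVecs bools n) (λ W → sg W * ∏ α (J (vlookup W))) ∎
      where
      valid : Vec (Vec Bool k) n → Bool
      valid κ = all (inhabited κ) (allFin n) ∧ (proper κ ∧ counted κ)
      term : Vec Bool n → Fin k → Vec Bool n → Carrier
      term W i c = ⟦ goodColumn i c ⟧ * ⟦ within (vlookup W) c ⟧
      expand : ∀ κ → ⟦ valid κ ⟧ ≈ ∑ (allVecs bools n) (λ W → sg W * ∏ (allFin k) (λ i → term W i (column i κ)))
      expand κ = begin
        ⟦ valid κ ⟧
          ≈⟨ ⟦⟧-∧ (all (inhabited κ) (allFin n)) _ ⟩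
        ⟦ all (inhabited κ) (allFin n) ⟧ * ⟦ proper κ ∧ counted κ ⟧
          ≈⟨ *-cong (inclusion-exclusion (inhabited κ)) (≈-trans (reflexive (cong ⟦_⟧ (by-columns κ))) (⟦all⟧ _ (allFin k))) ⟩
        ∑ (allVecs bools n) (λ W → sg W * ⟦ all (λ v → vlookup W v ∨ not (inhabited κ v)) (allFin n) ⟧) * good
          ≈⟨ ∑-*ʳ _ (allVecs bools n) _ ⟩
        ∑ (allVecs bools n) (λ W → sg W * ⟦ all (λ v → vlookup W v ∨ not (inhabited κ v)) (allFin n) ⟧ * good)
          ≈⟨ ∑-cong (allVecs bools n) (λ {W} _ → ≈-trans (*-assoc _ _ _) (*-congˡ (≈-trans
               (*-congʳ (≈-trans (reflexive (cong ⟦_⟧ (within-columns (vlookup W) κ))) (⟦all⟧ _ (allFin k))))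
               (≈-trans (*-comm _ _) (≈-sym (∏-* (allFin k) _ _)))))) ⟩
        ∑ (allVecs bools n) (λ W → sg W * ∏ (allFin k) (λ i → term W i (column i κ))) ∎
        where
        good : Carrier
        good = ∏ (allFin k) (λ i → ⟦ goodColumn i (column i κ) ⟧)

    -- Brings the condition that all words live on `B` into the form of `inclusion-exclusion`.
    inside-covers : ∀ (B : Fin n → Bool) (ms : List Item) → all (λ i → all B (proj₂ i)) ms ≡ all (λ v → B v ∨ not (does (uses? v ms))) (allFin n)
    inside-covers B ms = ⇔⇒≡
      (λ e → allFin⁺ _ λ v → ∨-not⁺ λ u → found e (find (does⁻ (uses? v ms) u)))
      (λ e → all⁺ _ ms λ {i} i∈ → all⁺ B (proj₂ i) λ {v} v∈ → ∨-not⁻ (allFin⁻ _ e v) (does⁺ (uses? v ms) (lose i∈ v∈)))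
      where
      found : ∀ {v} → all (λ i → all B (proj₂ i)) ms ≡ true → ∃[ i ] (i ∈ ms × v ∈ proj₂ i) → B v ≡ true
      found e (i , i∈ , v∈) = all⁻ B (all⁻ (λ i → all B (proj₂ i)) e i∈) v∈

    kromatic-coefficient : sum α ≤ℕ d → natR (coefX G α)
      ≈ ∑ (msets items) (λ ms → ∏ ms (partSign ∘ proj₁) * ⟦ covers ms ⟧ * natR (coefP (map proj₁ ms) α))
    kromatic-coefficient small = begin
      natR (coefX G α)
        ≈⟨ coefX≈∑J ⟩
      ∑ (allVecs bools n) (λ W → sg W * ∏ α (J (vlookup W)))
        ≈⟨ ∑-cong (allVecs bools n) (λ {W} _ → *-congˡ (≈-trans (Factors.∏-J G R k d (vlookup W) α refl small)
             (∑-cong (msets items) λ {ms} _ → *-congʳ (≈-trans (∏-* ms _ _) (*-congˡ (≈-sym (⟦all⟧ _ ms))))))) ⟩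
      ∑ (allVecs bools n) (λ W → sg W * ∑ (msets items) (λ ms → signs ms * inside W ms * P ms))
        ≈⟨ ≈-trans (∑-cong (allVecs bools n) (λ {W} _ → ∑-*ˡ (sg W) (msets items) _)) (∑-swap (allVecs bools n) (msets items) _) ⟩
      ∑ (msets items) (λ ms → ∑ (allVecs bools n) (λ W → sg W * (signs ms * inside W ms * P ms)))
        ≈⟨ ∑-cong (msets items) (λ {ms} _ → ≈-trans (∑-cong (allVecs bools n) (λ {W} _ → rearrange (sg W) (signs ms) (inside W ms) (P ms)))
             (≈-trans (≈-sym (∑-*ʳ (P ms) (allVecs bools n) _)) (*-congʳ (≈-trans (≈-sym (∑-*ˡ (signs ms) (allVecs bools n) _)) (*-congˡ (collect ms)))))) ⟩
      ∑ (msets items) (λ ms → signs ms * ⟦ covers ms ⟧ * P ms) ∎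
      where
      signs : List Item → Carrier
      signs ms = ∏ ms (partSign ∘ proj₁)
      P : List Item → Carrier
      P ms = natR (coefP (map proj₁ ms) α)
      inside : Vec Bool n → List Item → Carrier
      inside W ms = ⟦ all (λ i → all (vlookup W) (proj₂ i)) ms ⟧
      rearrange : ∀ w s i p → w * (s * i * p) ≈ s * (w * i) * p
      rearrange w s i p = ≈-trans (≈-sym (*-assoc w (s * i) p)) (*-congʳ (CSProps.x∙yz≈y∙xz *-commutativeSemigroup w s i))
      -- Inclusion-exclusion read backwards: the sum over `W` keeps the multisets that use every
      -- vertex.
      collect : ∀ ms → ∑ (allVecs bools n) (λ W → sg W * inside W ms) ≈ ⟦ covers ms ⟧
      collect ms = ≈-trans (∑-cong (allVecs bools n) (λ {W} _ → *-congˡ (reflexive (cong ⟦_⟧ (inside-covers (vlookup W) ms)))))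
        (≈-sym (inclusion-exclusion (λ v → does (uses? v ms))))

-- Partitions, and triangularity of the coefficients of products of p̄'.

module Partitions where

  _≟ᵖ_ : (μ ν : List ℕ) → Dec (μ ≡ ν)
  _≟ᵖ_ = Listₚ.≡-dec ℕₚ._≟_

  concatMap-unique : ∀ {X Y : Set} (h : X → List Y) {xs} → Unique xs → (∀ x → Unique (h x)) →
    (∀ {x x′ y} → y ∈ h x → y ∈ h x′ → x ≡ x′) → Unique (concatMap h xs)
  concatMap-unique h [] u d = []
  concatMap-unique h {x ∷ xs} (x≢ ∷ uxs) u d = Uniqueₚ.++⁺ (u x) (concatMap-unique h uxs u d)
    λ { (y∈ , y∈′) → clash y∈ (find (∈-concatMap⁻ h {xs = xs} y∈′)) }
    where
    clash : ∀ {y} → y ∈ h x → ∃[ x′ ] (x′ ∈ xs × y ∈ h x′) → ⊥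
    clash y∈ (x′ , x′∈ , y∈′) = All.lookup x≢ x′∈ (d y∈ y∈′)

  -- The local function of `partsF` under a name, equal to it by computation.
  partsF-step : ℕ → ℕ → ℕ → ℕ → List (List ℕ)
  partsF-step f d m k = if (suc k ≤ᵇ m) then map (suc k ∷_) (partsF f (d ∸ k) (suc k)) else []

  partsF-step⁻ : ∀ {f d m k μ} → μ ∈ partsF-step f d m k → suc k ≤ℕ m × ∃[ ν ] (ν ∈ partsF f (d ∸ k) (suc k) × μ ≡ suc k ∷ ν)
  partsF-step⁻ {f} {d} {m} {k} μ∈ with suc k ≤ᵇ m in e
  ... | true = ℕₚ.≤ᵇ⇒≤ (suc k) m (subst Bool.T (sym e) _) , ∈-map⁻ (suc k ∷_) μ∈

  IsPartitionOf : ℕ → ℕ → List ℕ → Set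
  IsPartitionOf e m μ = IsPartition μ × sum μ ≡ e × All (_≤ℕ m) μ

  partsF-sound : ∀ f e m {μ} → e ≤ℕ f → μ ∈ partsF f e m → IsPartitionOf e m μ
  partsF-sound f zero m _ (here refl) = ([] , []) , refl , []
  partsF-sound (suc f) (suc e) m (s≤s e≤f) μ∈ with find (∈-concatMap⁻ (partsF-step f e m) {xs = upTo (suc e)} μ∈)
  ... | k , k∈ , μ∈k with partsF-step⁻ {f} {e} {m} {k} μ∈k
  ...   | k<m , ν , ν∈ , refl with partsF-sound f (e ∸ k) (suc k) (ℕₚ.≤-trans (ℕₚ.m∸n≤m e k) e≤f) ν∈
  ...     | (pos , desc) , s , small = (s≤s z≤n ∷ pos , link small desc)
            , cong suc (trans (cong (k +ℕ_) s) (ℕₚ.m+[n∸m]≡n (ℕₚ.≤-pred (∈-upTo⁻ k∈))))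
            , k<m ∷ All.map (λ p → ℕₚ.≤-trans p k<m) small
    where
    link : ∀ {ν} → All (_≤ℕ suc k) ν → Linked (λ a b → b ≤ℕ a) ν → Linked (λ a b → b ≤ℕ a) (suc k ∷ ν)
    link [] [] = [-]
    link (p ∷ _) l = p ∷ l

  partsF-complete : ∀ f e m {μ} → e ≤ℕ f → IsPartitionOf e m μ → μ ∈ partsF f e m
  partsF-complete f zero m {[]} _ _ = here refl
  partsF-complete f zero m {zero ∷ μ} _ ((() ∷ _ , _) , _)
  partsF-complete zero (suc e) m () _
  partsF-complete (suc f) (suc e) m {[]} _ (_ , () , _)
  partsF-complete (suc f) (suc e) m {zero ∷ μ} _ ((() ∷ _ , _) , _)
  partsF-complete (suc f) (suc e) m {suc k ∷ μ} (s≤s e≤f) ((_ ∷ pos , desc) , s , k<m ∷ small) =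
    ∈-concatMap⁺ (partsF-step f e m) (lose (∈-upTo⁺ (s≤s k≤e)) member)
    where
    k≤e : k ≤ℕ e
    k≤e = ℕₚ.m+n≤o⇒m≤o k (ℕₚ.≤-reflexive (ℕₚ.suc-injective s))
    rest : sum μ ≡ e ∸ k
    rest = sym (trans (cong (_∸ k) (sym (ℕₚ.suc-injective s))) (ℕₚ.m+n∸m≡n k (sum μ)))
    bounded : ∀ {μ} → Linked (λ a b → b ≤ℕ a) (suc k ∷ μ) → Linked (λ a b → b ≤ℕ a) μ × All (_≤ℕ suc k) μ
    bounded l with Linked⇒AllPairs (λ p q → ℕₚ.≤-trans q p) l
    ... | a ∷ as = AllPairs⇒Linked as , a
    member : suc k ∷ μ ∈ partsF-step f e m k
    member with suc k ≤ᵇ m in q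
    ... | true = ∈-map⁺ (suc k ∷_) (partsF-complete f (e ∸ k) (suc k) (ℕₚ.≤-trans (ℕₚ.m∸n≤m e k) e≤f)
          ((pos , proj₁ (bounded desc)) , rest , proj₂ (bounded desc)))
    ... | false = ⊥-elim (subst Bool.T q (ℕₚ.≤⇒≤ᵇ k<m))

  partsF-unique : ∀ f e m → Unique (partsF f e m)
  partsF-unique f zero m = [] ∷ []
  partsF-unique zero (suc e) m = []
  partsF-unique (suc f) (suc e) m = concatMap-unique (partsF-step f e m) (Uniqueₚ.upTo⁺ (suc e)) each same
    where
    each : ∀ k → Unique (partsF-step f e m k)
    each k with suc k ≤ᵇ m
    ... | true = Uniqueₚ.map⁺ (λ p → Listₚ.∷-injectiveʳ p) (partsF-unique f (e ∸ k) (suc k))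
    ... | false = []
    same : ∀ {k k′ μ} → μ ∈ partsF-step f e m k → μ ∈ partsF-step f e m k′ → k ≡ k′
    same {k} {k′} p q with partsF-step⁻ {f} {e} {m} {k} p | partsF-step⁻ {f} {e} {m} {k′} q
    ... | _ , _ , _ , refl | _ , _ , _ , refl = refl

  partitions-sound : ∀ d {μ} → μ ∈ partitionsUpTo d → IsPartition μ × sum μ ≤ℕ d
  partitions-sound d μ∈ with find (∈-concatMap⁻ partitionsOf {xs = upTo (suc d)} μ∈)
  ... | e , e∈ , μ∈e with partsF-sound e e e ℕₚ.≤-refl μ∈e
  ...   | P , refl , _ = P , ℕₚ.≤-pred (∈-upTo⁻ e∈)

  parts≤sum : ∀ μ → All (_≤ℕ sum μ) μ
  parts≤sum [] = []
  parts≤sum (l ∷ μ) = ℕₚ.m≤m+n l (sum μ) ∷ All.map (λ p → ℕₚ.≤-trans p (ℕₚ.m≤n+m (sum μ) l)) (parts≤sum μ)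

  partitions-complete : ∀ d {μ} → IsPartition μ → sum μ ≤ℕ d → μ ∈ partitionsUpTo d
  partitions-complete d {μ} P s = ∈-concatMap⁺ partitionsOf (lose (∈-upTo⁺ (s≤s s))
    (partsF-complete (sum μ) (sum μ) (sum μ) ℕₚ.≤-refl (P , refl , parts≤sum μ)))

  partitions-unique : ∀ d → Unique (partitionsUpTo d)
  partitions-unique d = concatMap-unique partitionsOf (Uniqueₚ.upTo⁺ (suc d)) (λ e → partsF-unique e e e)
    λ {e} {e′} p q → trans (sym (proj₁ (proj₂ (partsF-sound e e e ℕₚ.≤-refl p)))) (proj₁ (proj₂ (partsF-sound e′ e′ e′ ℕₚ.≤-refl q)))

  descending-↭⇒≡ : ∀ {μ ν : List ℕ} → Linked (λ a b → b ≤ℕ a) μ → Linked (λ a b → b ≤ℕ a) ν → μ ↭ ν → μ ≡ ν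
  descending-↭⇒≡ p q e = Pointwise.Pointwise-≡⇒≡ (Sortedₚ.↗↭↗⇒≋ (flipOrder ℕₚ.≤-totalOrder) p q (↭⇒↭ₛ e))

module CoefficientSupport where
  open Partitions

  open ExponentVectors

  data Box : List ℕ → List ℕ → Set where
    []  : Box [] []
    _∷_ : ∀ {b a β α} → b ≤ℕ a → Box β α → Box (b ∷ β) (a ∷ α)

  boxes⁻ : ∀ α {β} → β ∈ boxes α → Box β α
  boxes⁻ [] (here refl) = []
  boxes⁻ (a ∷ α) β∈ with find (∈-concatMap⁻ (λ b → map (b ∷_) (boxes α)) {xs = upTo (suc a)} β∈)
  ... | b , b∈ , β∈b with ∈-map⁻ (b ∷_) β∈b
  ...   | β′ , β′∈ , refl = ℕₚ.≤-pred (∈-upTo⁻ b∈) ∷ boxes⁻ α β′∈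

  boxes⁺ : ∀ {α β} → Box β α → β ∈ boxes α
  boxes⁺ [] = here refl
  boxes⁺ {a ∷ α} {b ∷ β} (p ∷ B) = ∈-concatMap⁺ (λ b → map (b ∷_) (boxes α)) (lose (∈-upTo⁺ (s≤s p)) (∈-map⁺ (b ∷_) (boxes⁺ B)))

  coefP-support : ∀ l μ α → coefP (l ∷ μ) α ≢ 0 → ∃[ β ] (Box β α × nonzero β ≡ true × fits l α β ≡ true × coefP μ (α ∸⟨ l ⟩ β) ≢ 0)
  coefP-support l μ α c≢0 with summand (filterᵇ (λ β → nonzero β ∧ fits l α β) (boxes α)) c≢0
    where
    summand : ∀ βs → sum (map (λ β → coefP μ (α ∸⟨ l ⟩ β)) βs) ≢ 0 → ∃[ β ] (β ∈ βs × coefP μ (α ∸⟨ l ⟩ β) ≢ 0)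
    summand [] s≢0 = ⊥-elim (s≢0 refl)
    summand (β ∷ βs) s≢0 with coefP μ (α ∸⟨ l ⟩ β) in e
    ... | suc _ = β , here refl , λ z → case trans (sym e) z of λ ()
    ... | zero with summand βs s≢0
    ...   | γ , γ∈ , q = γ , there γ∈ , q
  ... | β , β∈ , q with ∈-filter⁻ (λ β → Boolₚ.T? (nonzero β ∧ fits l α β)) {xs = boxes α} β∈
  ...   | β∈boxes , t with ∧⁻ {nonzero β} (Boolₚ.T-≡ .Equivalence.to t)
  ...     | nz , ft = β , boxes⁻ α β∈boxes , nz , ft , q

  coefP-positive-step : ∀ l μ α β → Box β α → nonzero β ≡ true → fits l α β ≡ true → 1 ≤ℕ coefP μ (α ∸⟨ l ⟩ β) → 1 ≤ℕ coefP (l ∷ μ) α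
  coefP-positive-step l μ α β B nz ft p = bigger (∈-filter⁺ (λ β → Boolₚ.T? (nonzero β ∧ fits l α β)) (boxes⁺ B)
      (Boolₚ.T-≡ .Equivalence.from (∧⁺ nz ft)))
    where
    bigger : ∀ {βs} → β ∈ βs → 1 ≤ℕ sum (map (λ β → coefP μ (α ∸⟨ l ⟩ β)) βs)
    bigger (here refl) = ℕₚ.≤-trans p (ℕₚ.m≤m+n _ _)
    bigger (there β∈) = ℕₚ.≤-trans (bigger β∈) (ℕₚ.m≤n+m _ _)

  ≤ᵇ⁻ : ∀ {a b} → (a ≤ᵇ b) ≡ true → a ≤ℕ b
  ≤ᵇ⁻ {a} {b} e = ℕₚ.≤ᵇ⇒≤ a b (subst Bool.T (sym e) _)

  ≤ᵇ⁺ : ∀ {a b} → a ≤ℕ b → (a ≤ᵇ b) ≡ true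
  ≤ᵇ⁺ p = Boolₚ.T-≡ .Equivalence.to (ℕₚ.≤⇒≤ᵇ p)

  sum-fits : ∀ l {α β} → Box β α → fits l α β ≡ true → l *ℕ sum β +ℕ sum (α ∸⟨ l ⟩ β) ≡ sum α
  sum-fits l [] _ = trans (ℕₚ.+-identityʳ _) (ℕₚ.*-zeroʳ l)
  sum-fits l {a ∷ α} {b ∷ β} (_ ∷ B) ft with ∧⁻ {(l *ℕ b) ≤ᵇ a} ft
  ... | p , ft′ = trans (cong (_+ℕ sum ((a ∷ α) ∸⟨ l ⟩ (b ∷ β))) (ℕₚ.*-distribˡ-+ l b (sum β)))
    (trans (CSProps.interchange ℕₚ.+-commutativeSemigroup (l *ℕ b) (l *ℕ sum β) (a ∸ l *ℕ b) (sum (α ∸⟨ l ⟩ β)))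
      (cong₂ _+ℕ_ (ℕₚ.m+[n∸m]≡n (≤ᵇ⁻ {l *ℕ b} {a} p)) (sum-fits l B ft′)))

  nonzero⇒positive : ∀ β → nonzero β ≡ true → 1 ≤ℕ sum β
  nonzero⇒positive (zero ∷ β) e = nonzero⇒positive β e
  nonzero⇒positive (suc b ∷ β) e = s≤s z≤n

  -- A nonzero `β` removes at least `l` from the total degree.
  coefP-sum : ∀ μ α → coefP μ α ≢ 0 → sum μ ≤ℕ sum α
  coefP-sum [] α _ = z≤n
  coefP-sum (l ∷ μ) α c≢0 with coefP-support l μ α c≢0
  ... | β , B , nz , ft , q = ℕₚ.≤-trans
    (ℕₚ.+-mono-≤ (ℕₚ.≤-trans (ℕₚ.≤-reflexive (sym (ℕₚ.*-identityʳ l))) (ℕₚ.*-monoʳ-≤ l (nonzero⇒positive β nz))) (coefP-sum μ (α ∸⟨ l ⟩ β) q))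
    (ℕₚ.≤-reflexive (sum-fits l B ft))

  -- Exponent lists acquire zeros as parts are subtracted; the comparison with partitions concerns
  -- the positive entries.
  support : List ℕ → List ℕ
  support [] = []
  support (zero ∷ α) = support α
  support (suc a ∷ α) = suc a ∷ support α

  support-positive : ∀ {μ} → All (1 ≤ℕ_) μ → support μ ≡ μ
  support-positive [] = refl
  support-positive (s≤s _ ∷ ps) = cong (_ ∷_) (support-positive ps)

  ∸⟨⟩-zero : ∀ l {α β} → Box β α → sum β ≡ 0 → α ∸⟨ l ⟩ β ≡ α
  ∸⟨⟩-zero l [] _ = refl
  ∸⟨⟩-zero l {a ∷ α} {zero ∷ β} (_ ∷ B) e = cong₂ _∷_ (cong (a ∸_) (ℕₚ.*-zeroʳ l)) (∸⟨⟩-zero l B e)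

  -- Exactly one entry is lowered by the part. It leaves the support if it equals the part;
  -- otherwise the number of positive entries does not change.
  support-unit : ∀ l {α β} → Box β α → fits (suc l) α β ≡ true → sum β ≡ 1 →
    length (support α) ≤ℕ suc (length (support (α ∸⟨ suc l ⟩ β)))
    × (length (support α) ≡ suc (length (support (α ∸⟨ suc l ⟩ β))) → support α ↭ suc l ∷ support (α ∸⟨ suc l ⟩ β))
  support-unit l {a ∷ α} {zero ∷ β} (_ ∷ B) ft e rewrite ℕₚ.*-zeroʳ l with a | support-unit l B ft e
  ... | zero | p = p
  ... | suc a | p , q = s≤s p , λ h → ↭-trans (prep (suc a) (q (ℕₚ.suc-injective h))) (swap (suc a) (suc l) ↭-refl)
  support-unit l {a ∷ α} {suc (suc b) ∷ β} _ _ ()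
  support-unit l {a ∷ α} {suc zero ∷ β} (_ ∷ B) ft e
    rewrite ∸⟨⟩-zero (suc l) B (ℕₚ.suc-injective e) | ℕₚ.*-identityʳ l with a | ≤ᵇ⁻ {suc l} {a} (proj₁ (∧⁻ {suc l ≤ᵇ a} ft))
  ... | suc a | s≤s l≤a with a ∸ l in d
  ...   | zero = ℕₚ.≤-refl , λ _ → ↭-reflexive (cong (λ z → suc z ∷ support α) (ℕₚ.≤-antisym (ℕₚ.m∸n≡0⇒m≤n d) l≤a))
  ...   | suc _ = s≤s (ℕₚ.n≤1+n _) , λ h → ⊥-elim (ℕₚ.1+n≢n (sym (ℕₚ.suc-injective h)))

  -- Equal degrees force every `β` to be a unit vector, so each part goes into a single entry. The
  -- entries arise by merging parts, and as many entries as parts means that nothing was merged.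
  coefP-length : ∀ μ α → All (1 ≤ℕ_) μ → sum μ ≡ sum α → coefP μ α ≢ 0 →
    length (support α) ≤ℕ length μ × (length μ ≡ length (support α) → support α ↭ μ)
  coefP-length [] α [] s c≢0 = ℕₚ.≤-reflexive (cong length (vanish α s)) , λ _ → ↭-reflexive (vanish α s)
    where
    vanish : ∀ α → 0 ≡ sum α → support α ≡ []
    vanish [] _ = refl
    vanish (zero ∷ α) e = vanish α e
  coefP-length (suc l ∷ μ) α (_ ∷ pos) s c≢0 with coefP-support (suc l) μ α c≢0
  ... | β , B , nz , ft , q = bound , perm
    where
    α′ : List ℕ
    α′ = α ∸⟨ suc l ⟩ β
    β≤1 : sum β ≤ℕ 1
    β≤1 = ℕₚ.*-cancelˡ-≤ (suc l) (ℕₚ.+-cancelʳ-≤ (sum α′) _ _ (ℕₚ.≤-trans (ℕₚ.≤-reflexive (trans (sum-fits (suc l) B ft) (sym s)))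
      (ℕₚ.+-mono-≤ (ℕₚ.≤-reflexive (sym (ℕₚ.*-identityʳ (suc l)))) (coefP-sum μ α′ q))))
    β≡1 : sum β ≡ 1
    β≡1 = ℕₚ.≤-antisym β≤1 (nonzero⇒positive β nz)
    s′ : sum μ ≡ sum α′
    s′ = ℕₚ.+-cancelˡ-≡ (suc l) _ _ (trans s (trans (sym (sum-fits (suc l) B ft))
      (cong (_+ℕ sum α′) (trans (cong (suc l *ℕ_) β≡1) (ℕₚ.*-identityʳ (suc l))))))
    unit : length (support α) ≤ℕ suc (length (support α′)) × (length (support α) ≡ suc (length (support α′)) → support α ↭ suc l ∷ support α′)
    unit = support-unit l B ft β≡1
    ih : length (support α′) ≤ℕ length μ × (length μ ≡ length (support α′) → support α′ ↭ μ)
    ih = coefP-length μ α′ pos s′ q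
    bound : length (support α) ≤ℕ suc (length μ)
    bound = ℕₚ.≤-trans (proj₁ unit) (s≤s (proj₁ ih))
    perm : suc (length μ) ≡ length (support α) → support α ↭ suc l ∷ μ
    perm e = ↭-trans (proj₂ unit (ℕₚ.≤-antisym (proj₁ unit) (ℕₚ.≤-trans (s≤s (proj₁ ih)) (ℕₚ.≤-reflexive e))))
      (prep (suc l) (proj₂ ih (ℕₚ.≤-antisym (ℕₚ.≤-pred (ℕₚ.≤-trans (ℕₚ.≤-reflexive e) (proj₁ unit))) (proj₁ ih))))

  -- Each part is taken from its own entry, in order; the `z` leading zeros are the entries already
  -- used up.
  coefP-diagonal : ∀ z μ → All (1 ≤ℕ_) μ → 1 ≤ℕ coefP μ (replicate z 0 ++ μ)
  coefP-diagonal zero [] [] = s≤s z≤n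
  coefP-diagonal (suc z) [] [] = coefP-diagonal z [] []
  coefP-diagonal z (suc l ∷ μ) (_ ∷ pos) = coefP-positive-step (suc l) μ (replicate z 0 ++ suc l ∷ μ) β (box z) (nz z) (ft z)
    (subst (λ α → 1 ≤ℕ coefP μ α) (sym (rest z)) (coefP-diagonal (suc z) μ pos))
    where
    zeros : List ℕ → List ℕ
    zeros μ = replicate (length μ) 0
    unitAt : ℕ → List ℕ
    unitAt z = replicate z 0 ++ 1 ∷ zeros μ
    β : List ℕ
    β = unitAt z
    zeroBox : ∀ μ → Box (zeros μ) μ
    zeroBox [] = []
    zeroBox (m ∷ μ) = z≤n ∷ zeroBox μ
    box : ∀ z → Box (unitAt z) (replicate z 0 ++ suc l ∷ μ)
    box zero = s≤s z≤n ∷ zeroBox μ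
    box (suc z) = z≤n ∷ box z
    nz : ∀ z → nonzero (unitAt z) ≡ true
    nz zero = refl
    nz (suc z) = nz z
    zeroFits : ∀ μ → fits (suc l) μ (zeros μ) ≡ true
    zeroFits [] = refl
    zeroFits (m ∷ μ) rewrite ℕₚ.*-zeroʳ l = zeroFits μ
    ft : ∀ z → fits (suc l) (replicate z 0 ++ suc l ∷ μ) (unitAt z) ≡ true
    ft zero = ∧⁺ (≤ᵇ⁺ (ℕₚ.≤-reflexive (ℕₚ.*-identityʳ (suc l)))) (zeroFits μ)
    ft (suc z) rewrite ℕₚ.*-zeroʳ l = ft z
    zeroRest : ∀ μ → μ ∸⟨ suc l ⟩ zeros μ ≡ μ
    zeroRest μ = ∸⟨⟩-zero (suc l) (zeroBox μ) (sum-zeros μ)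
      where
      sum-zeros : ∀ μ → sum (zeros μ) ≡ 0
      sum-zeros [] = refl
      sum-zeros (_ ∷ μ) = sum-zeros μ
    rest : ∀ z → (replicate z 0 ++ suc l ∷ μ) ∸⟨ suc l ⟩ unitAt z ≡ replicate (suc z) 0 ++ μ
    rest zero = cong₂ _∷_ (trans (cong (suc l ∸_) (ℕₚ.*-identityʳ (suc l))) (ℕₚ.n∸n≡0 (suc l))) (zeroRest μ)
    rest (suc z) rewrite ℕₚ.*-zeroʳ l = cong (0 ∷_) (rest z)

  length≤sum : ∀ {μ} → All (1 ≤ℕ_) μ → length μ ≤ℕ sum μ
  length≤sum [] = z≤n
  length≤sum (p ∷ ps) = ℕₚ.+-mono-≤ p (length≤sum ps)

  coefP-triangular : ∀ {μ ν} → IsPartition μ → IsPartition ν → coefP ν μ ≢ 0 →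
    ν ≡ μ ⊎ sum ν <ℕ sum μ ⊎ (sum ν ≡ sum μ × length μ <ℕ length ν)
  coefP-triangular {μ} {ν} (posμ , descμ) (posν , descν) c≢0 with sum ν ℕₚ.≟ sum μ
  ... | no s≢ = inj₂ (inj₁ (ℕₚ.≤∧≢⇒< (coefP-sum ν μ c≢0) s≢))
  ... | yes s≡ with coefP-length ν μ posν s≡ c≢0
  ...   | bound , perm rewrite support-positive posμ with length ν ℕₚ.≟ length μ
  ...     | yes l≡ = inj₁ (sym (descending-↭⇒≡ descμ descν (perm l≡)))
  ...     | no l≢ = inj₂ (inj₂ (s≡ , ℕₚ.≤∧≢⇒< bound (l≢ ∘ sym)))

-- Uniqueness of the expansion.

module ExpansionUniqueness (R : CommutativeRing 0ℓ 0ℓ)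
  (cancel : ∀ m x → 1 ≤ℕ m → CommutativeRing._≈_ R (CommutativeRing._*_ R x (Sums.natR R m)) (CommutativeRing.0# R) →
    CommutativeRing._≈_ R x (CommutativeRing.0# R)) where
  open CommutativeRing R renaming (refl to ≈-refl; sym to ≈-sym; trans to ≈-trans) hiding (zero)
  open Sums R
  open Partitions
  open CoefficientSupport

  -- Induction along the triangular order. At the exponent vector `μ`, every other `ν` with
  -- `coefP ν μ` nonzero has smaller rank, so its term vanishes; what remains is `D μ` times a
  -- positive integer, which `cancel` removes.
  coefficients-vanish : ∀ d (D : List ℕ → Carrier) →
    (∀ α → sum α ≤ℕ d → ∑ (partitionsUpTo (sum α)) (λ ν → D ν * natR (coefP ν α)) ≈ 0#) →
    ∀ μ → IsPartition μ → sum μ ≤ℕ d → D μ ≈ 0#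
  coefficients-vanish d D h μ = by-rank (suc (rank μ)) μ ℕₚ.≤-refl
    where
    -- Smaller degree first, and among equal degrees more parts first; the factor `suc d` leaves
    -- room for `d ∸ length μ`.
    rank : List ℕ → ℕ
    rank μ = sum μ *ℕ suc d +ℕ (d ∸ length μ)

    smaller : ∀ {μ ν} → IsPartition ν → sum μ ≤ℕ d → sum ν <ℕ sum μ ⊎ (sum ν ≡ sum μ × length μ <ℕ length ν) → rank ν <ℕ rank μ
    smaller {μ} {ν} P s (inj₁ q) = ℕₚ.<-≤-trans (ℕₚ.+-monoʳ-< (sum ν *ℕ suc d) (s≤s (ℕₚ.m∸n≤m d (length ν))))
      (ℕₚ.≤-trans (ℕₚ.≤-reflexive (ℕₚ.+-comm (sum ν *ℕ suc d) (suc d))) (ℕₚ.≤-trans (ℕₚ.*-monoˡ-≤ (suc d) q) (ℕₚ.m≤m+n _ _)))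
    smaller {μ} {ν} P s (inj₂ (e , q)) rewrite e = ℕₚ.+-monoʳ-< (sum μ *ℕ suc d)
      (ℕₚ.∸-monoʳ-< q (ℕₚ.≤-trans (length≤sum (proj₁ P)) (ℕₚ.≤-trans (ℕₚ.≤-reflexive e) s)))

    by-rank : ∀ r μ → rank μ <ℕ r → IsPartition μ → sum μ ≤ℕ d → D μ ≈ 0#
    by-rank (suc r) μ (s≤s rank≤) P s = cancel (coefP μ μ) (D μ) (coefP-diagonal 0 μ (proj₁ P)) (≈-trans (≈-sym diagonal) (h μ s))
      where
      term : List ℕ → Carrier
      term ν = D ν * natR (coefP ν μ)
      diagonal : ∑ (partitionsUpTo (sum μ)) term ≈ term μ
      diagonal = ≈-trans (∑-cong (partitionsUpTo (sum μ)) only-μ)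
        (∑-delta _≟ᵖ_ (partitions-unique (sum μ)) (partitions-complete (sum μ) P ℕₚ.≤-refl) term)
        where
        only-μ : ∀ {ν} → ν ∈ partitionsUpTo (sum μ) → term ν ≈ ⟦ does (ν ≟ᵖ μ) ⟧ * term ν
        only-μ {ν} ν∈ with ν ≟ᵖ μ
        ... | yes _ = ≈-sym (*-identityˡ _)
        ... | no ν≢μ = ≈-trans off-diagonal (≈-sym (zeroˡ _))
          where
          Pν : IsPartition ν
          Pν = proj₁ (partitions-sound (sum μ) ν∈)
          off-diagonal : term ν ≈ 0#
          off-diagonal with coefP ν μ ℕₚ.≟ 0
          ... | yes c≡0 = ≈-trans (*-congˡ (reflexive (cong natR c≡0))) (zeroʳ _)
          ... | no c≢0 with coefP-triangular P Pν c≢0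
          ...   | inj₁ ν≡μ = ⊥-elim (ν≢μ ν≡μ)
          ...   | inj₂ q = ≈-trans (*-congʳ (by-rank r ν (ℕₚ.<-≤-trans (smaller {μ} {ν} Pν s q) rank≤) Pν
                    (ℕₚ.≤-trans (proj₂ (partitions-sound (sum μ) ν∈)) s))) (zeroˡ _)

-- The expansion of X̄_G with signed counts as coefficients.

module KromaticExpansion {n : ℕ} (G : SimpleGraph n) (R : CommutativeRing 0ℓ 0ℓ) (d : ℕ) where
  open CommutativeRing R renaming (refl to ≈-refl; sym to ≈-sym; trans to ≈-trans) hiding (zero)
  open Sums R
  open Items G d
  open KromaticCoefficients G R d using (covers; partSign; kromatic-coefficient)
  open Partitions
  open CoefficientSupport
  open SetoidReasoning setoid

  parts : List Item → List ℕ
  parts = map proj₁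

  contributes? : ∀ μ (ms : List Item) → Dec (parts ms ≡ μ × covers ms ≡ true)
  contributes? μ ms with parts ms ≟ᵖ μ | covers ms Boolₚ.≟ true
  ... | yes p | yes q = yes (p , q)
  ... | no ¬p | _ = no (¬p ∘ proj₁)
  ... | yes _ | no ¬q = no (¬q ∘ proj₂)

  multisets : List ℕ → List (List Item)
  multisets μ = filter (contributes? μ) (msets items)

  signedCount : List ℕ → Carrier
  signedCount μ = ∏ μ partSign * natR (length (multisets μ))

  parts-partition : ∀ {ms} → ms ∈ msets items → IsPartition (parts ms)
  parts-partition ms∈ = Allₚ.map⁺ (All.map item-positive (msets-⊆ items ms∈))
    , AllPairs⇒Linked (AllPairsₚ.map⁺ (msets-AllPairs ℕₚ.≤-refl items items-sorted ms∈))

  -- The multisets are grouped by their list of parts. The sign depends on the parts alone, so each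
  -- group contributes a signed cardinality.
  kromatic-expansion : ∀ α → sum α ≤ℕ d →
    natR (coefX G α) ≈ ∑ (partitionsUpTo (sum α)) (λ ν → signedCount ν * natR (coefP ν α))
  kromatic-expansion α small = begin
    natR (coefX G α)
      ≈⟨ kromatic-coefficient α small ⟩
    ∑ (msets items) (λ ms → ∏ ms (partSign ∘ proj₁) * ⟦ covers ms ⟧ * natR (coefP (parts ms) α))
      ≈⟨ ∑-cong (msets items) (λ ms∈ → by-partition ms∈) ⟩
    ∑ (msets items) (λ ms → ∑ Λ (λ ν → ⟦ does (contributes? ν ms) ⟧ * P ν))
      ≈⟨ ∑-swap (msets items) Λ _ ⟩
    ∑ Λ (λ ν → ∑ (msets items) (λ ms → ⟦ does (contributes? ν ms) ⟧ * P ν))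
      ≈⟨ ∑-cong Λ (λ {ν} _ → ≈-trans (≈-sym (∑-filter (contributes? ν) (msets items) (λ _ → P ν))) (tally ν)) ⟩
    ∑ Λ (λ ν → signedCount ν * natR (coefP ν α)) ∎
    where
    Λ : List (List ℕ)
    Λ = partitionsUpTo (sum α)
    P : List ℕ → Carrier
    P ν = ∏ ν partSign * natR (coefP ν α)
    tally : ∀ ν → ∑ (multisets ν) (λ _ → P ν) ≈ signedCount ν * natR (coefP ν α)
    tally ν = ≈-trans (∑-cong (multisets ν) (λ _ → ≈-sym (*-identityˡ _))) (≈-trans (≈-sym (∑-*ʳ (P ν) (multisets ν) (λ _ → 1#)))
      (≈-trans (*-congʳ (≈-sym (natR-length (multisets ν)))) (≈-trans (CSProps.x∙yz≈y∙xz *-commutativeSemigroup _ _ _) (≈-sym (*-assoc _ _ _)))))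
    indicator : ∀ ν ms → ⟦ does (contributes? ν ms) ⟧ ≈ ⟦ does (ν ≟ᵖ parts ms) ⟧ * ⟦ covers ms ⟧
    indicator ν ms with parts ms ≟ᵖ ν | ν ≟ᵖ parts ms | covers ms Boolₚ.≟ true
    ... | yes _ | yes _ | yes q = ≈-sym (≈-trans (*-identityˡ _) (reflexive (cong ⟦_⟧ q)))
    ... | yes _ | yes _ | no ¬q = ≈-sym (≈-trans (*-identityˡ _) (reflexive (cong ⟦_⟧ (Boolₚ.¬-not ¬q))))
    ... | no _ | no _ | _ = ≈-sym (zeroˡ _)
    ... | yes p | no ¬p | _ = ⊥-elim (¬p (sym p))
    ... | no ¬p | yes p | _ = ⊥-elim (¬p (sym p))
    by-partition : ∀ {ms} → ms ∈ msets items → ∏ ms (partSign ∘ proj₁) * ⟦ covers ms ⟧ * natR (coefP (parts ms) α)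
      ≈ ∑ Λ (λ ν → ⟦ does (contributes? ν ms) ⟧ * P ν)
    by-partition {ms} ms∈ = ≈-trans (≈-trans (*-congʳ (≈-trans (*-congʳ (≈-sym (∏-map proj₁ ms partSign))) (*-comm _ _))) (*-assoc _ _ _))
      (≈-trans (*-congˡ (≈-sym delta)) (≈-trans (∑-*ˡ ⟦ covers ms ⟧ Λ _)
        (∑-cong Λ λ {ν} _ → ≈-trans (≈-sym (*-assoc _ _ _)) (*-congʳ (≈-trans (*-comm _ _) (≈-sym (indicator ν ms)))))))
      where
      delta : ∑ Λ (λ ν → ⟦ does (ν ≟ᵖ parts ms) ⟧ * P ν) ≈ P (parts ms)
      delta with sum (parts ms) ≤ℕ? sum α
      ... | yes s = ∑-delta _≟ᵖ_ (partitions-unique (sum α)) (partitions-complete (sum α) (parts-partition ms∈) s) P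
      -- Parts of total size above that of `α` lie outside the range of summation, but then `coefP`
      -- vanishes as well.
      ... | no s≰ = ≈-trans (∑-0 Λ absent) (≈-sym (≈-trans (*-congˡ (reflexive (cong natR vanishes))) (zeroʳ _)))
        where
        vanishes : coefP (parts ms) α ≡ 0
        vanishes with coefP (parts ms) α ℕₚ.≟ 0
        ... | yes e = e
        ... | no c≢0 = ⊥-elim (s≰ (coefP-sum (parts ms) α c≢0))
        absent : ∀ {ν} → ν ∈ Λ → ⟦ does (ν ≟ᵖ parts ms) ⟧ * P ν ≈ 0#
        absent {ν} ν∈ with ν ≟ᵖ parts ms
        ... | no _ = zeroˡ _
        ... | yes refl = ⊥-elim (s≰ (proj₂ (partitions-sound (sum α) ν∈)))

-- Rational numbers and signs.

module RationalFacts where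
  ℚ-ring : CommutativeRing 0ℓ 0ℓ
  ℚ-ring = ℚₚ.+-*-commutativeRing

  open Sums ℚ-ring

  -- Checked on unnormalised fractions, where it becomes an identity of integers.
  ℕtoℚ-suc : ∀ m → ℕtoℚ (suc m) ≡ 1ℚ +ℚ ℕtoℚ m
  ℕtoℚ-suc m = ℚₚ.toℚᵘ-injective (ℚᵘₚ.≃-trans (ℚₚ.toℚᵘ-fromℚᵘ (mkℚᵘ (+ suc m) 0))
    (ℚᵘₚ.≃-trans (*≡* (trans (ℤₚ.*-identityʳ (+ suc m)) (sym (trans (ℤₚ.*-identityʳ _) (cong (λ z → + 1 ℤ+ z) (ℤₚ.*-identityʳ (+ m)))))))
      (ℚᵘₚ.≃-sym (ℚᵘₚ.≃-trans (ℚₚ.toℚᵘ-homo-+ 1ℚ (ℕtoℚ m)) (ℚᵘₚ.+-congʳ (toℚᵘ 1ℚ) (ℚₚ.toℚᵘ-fromℚᵘ (mkℚᵘ (+ m) 0)))))))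

  ℕtoℚ≡natR : ∀ m → ℕtoℚ m ≡ natR m
  ℕtoℚ≡natR zero = refl
  ℕtoℚ≡natR (suc m) = trans (ℕtoℚ-suc m) (cong (1ℚ +ℚ_) (ℕtoℚ≡natR m))

  natR-cancel : ∀ m x → 1 ≤ℕ m → x *ℚ natR m ≡ 0ℚ → x ≡ 0ℚ
  natR-cancel (suc m) x _ e = trans (sym (ℚₚ.*-identityʳ x)) (trans (cong (x *ℚ_) (sym (ℚₚ.*-inverseʳ p)))
    (trans (sym (ℚₚ.*-assoc x p (1/ p))) (trans (cong (_*ℚ 1/ p) e) (ℚₚ.*-zeroˡ (1/ p)))))
    where
    p : ℚ
    p = natR (suc m)
    p≢0 : p ≢ 0ℚ
    p≢0 p≡0 with ℚₚ./-injective-≃ (mkℚᵘ (+ suc m) 0) (mkℚᵘ (+ 0) 0) (trans (ℕtoℚ≡natR (suc m)) p≡0)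
    ... | *≡* ()
    instance
      nonzero : NonZero p
      nonzero = ≢-nonZero p≢0

  sumℚ≡∑ : ∀ {X : Set} (f : X → ℚ) xs → sumℚ (map f xs) ≡ ∑ xs f
  sumℚ≡∑ f [] = refl
  sumℚ≡∑ f (x ∷ xs) = cong (f x +ℚ_) (sumℚ≡∑ f xs)

  sgn-+ : ∀ a b → sgn (a +ℕ b) ≡ sgn a *ℚ sgn b
  sgn-+ zero b = sym (ℚₚ.*-identityˡ (sgn b))
  sgn-+ (suc a) b = trans (cong -ℚ_ (sgn-+ a b)) (RingProps.-‿distribˡ-* (CommutativeRing.ring ℚ-ring) (sgn a) (sgn b))

  sgn-square : ∀ a → sgn a *ℚ sgn a ≡ 1ℚ
  sgn-square zero = refl
  sgn-square (suc a) = trans (sym (-‿distribˡ-* (sgn a) (-ℚ (sgn a)))) (trans (cong -ℚ_ (sym (-‿distribʳ-* (sgn a) (sgn a))))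
    (trans (-‿involutive (sgn a *ℚ sgn a)) (sgn-square a)))
    where open RingProps (CommutativeRing.ring ℚ-ring) using (-‿distribˡ-*; -‿distribʳ-*; -‿involutive)

  sgn-parity : ∀ m → sgn m ≡ (if not (isOdd m) then 1ℚ else -ℚ 1ℚ)
  sgn-parity zero = refl
  sgn-parity (suc m) = trans (cong -ℚ_ (sgn-parity m)) (flip (isOdd m))
    where
    flip : ∀ o → -ℚ (if not o then 1ℚ else -ℚ 1ℚ) ≡ (if not (not o) then 1ℚ else -ℚ 1ℚ)
    flip true = refl
    flip false = refl

-- The counted multisets represent the classes of good assignments.

module ClassCount {n : ℕ} (G : SimpleGraph n) (λ′ : List ℕ) (λ-partition : IsPartition λ′) where
  open HeapWords G
  open LyndonHeaps G
  open WordLists G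
  open Items G (sum λ′)
  open KromaticCoefficients G RationalFacts.ℚ-ring (sum λ′) using (covers; uses?)
  open KromaticExpansion G RationalFacts.ℚ-ring (sum λ′)
  open Partitions
  open CoefficientSupport using (length≤sum)

  ∈-count : ∀ {x ms} → x ∈ ms → 1 ≤ℕ count x ms
  ∈-count {x} {y ∷ ms} x∈ with x ≟ⁱ y | x∈
  ... | yes _ | _ = s≤s z≤n
  ... | no x≢y | here e = ⊥-elim (x≢y e)
  ... | no _ | there x∈′ = ∈-count x∈′

  count-∈ : ∀ x ms → 1 ≤ℕ count x ms → x ∈ ms
  count-∈ x (y ∷ ms) p with x ≟ⁱ y
  ... | yes e = here e
  ... | no _ = there (count-∈ x ms p)

  count-twice⁺ : ∀ {m} (f : Fin m → Item) {x i j} → i ≢ j → f i ≡ x → f j ≡ x → 2 ≤ℕ count x (tabulate f)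
  count-twice⁺ f {x} {zero} {zero} i≢j _ _ = ⊥-elim (i≢j refl)
  count-twice⁺ f {x} {zero} {suc j} _ e e′ with x ≟ⁱ f zero
  ... | yes _ = s≤s (∈-count (subst (_∈ tabulate (f ∘ suc)) e′ (∈-tabulate⁺ j)))
  ... | no ¬e = ⊥-elim (¬e (sym e))
  count-twice⁺ f {x} {suc i} {zero} _ e e′ with x ≟ⁱ f zero
  ... | yes _ = s≤s (∈-count (subst (_∈ tabulate (f ∘ suc)) e (∈-tabulate⁺ i)))
  ... | no ¬e = ⊥-elim (¬e (sym e′))
  count-twice⁺ f {x} {suc i} {suc j} i≢j e e′ with x ≟ⁱ f zero | count-twice⁺ (f ∘ suc) (i≢j ∘ cong suc) e e′
  ... | yes _ | p = ℕₚ.m≤n⇒m≤1+n p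
  ... | no _ | p = p

  count-twice⁻ : ∀ {m} (f : Fin m → Item) x → 2 ≤ℕ count x (tabulate f) → ∃[ i ] ∃[ j ] (i ≢ j × x ≡ f i × x ≡ f j)
  count-twice⁻ {suc m} f x p with x ≟ⁱ f zero
  ... | yes e with ∈-tabulate⁻ (count-∈ x (tabulate (f ∘ suc)) (ℕₚ.≤-pred p))
  ...   | j , e′ = zero , suc j , (λ ()) , e , e′
  count-twice⁻ {suc m} f x p | no _ with count-twice⁻ (f ∘ suc) x p
  ... | i , j , i≢j , e , e′ = suc i , suc j , i≢j ∘ Finₚ.suc-injective , e , e′

  -- A multiplicity is a sum of indicators over the index set, which a permutation leaves unchanged.
  count-permute : ∀ {m} (f g : Fin m → Item) (σ : Permutation′ m) → (∀ i → f i ≡ g (σ ⟨$⟩ʳ i)) → ∀ x → count x (tabulate f) ≡ count x (tabulate g)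
  count-permute f g σ e x = trans (as-sum f) (trans (sum-cong-≗ (λ i → cong (λ z → hit (x ≟ⁱ z)) (e i)))
    (trans (sym (sum-permute (λ i → hit (x ≟ⁱ g i)) σ)) (sym (as-sum g))))
    where
    open FinSum ℕₚ.+-0-commutativeMonoid using (sum-permute; sum-cong-≗) renaming (sum to ∑Fin)
    hit : ∀ {P : Set} → Dec P → ℕ
    hit (yes _) = 1
    hit (no _) = 0
    as-sum : ∀ {m} (f : Fin m → Item) → count x (tabulate f) ≡ ∑Fin (λ i → hit (x ≟ⁱ f i))
    as-sum {zero} f = refl
    as-sum {suc m} f with x ≟ⁱ f zero
    ... | yes _ = cong suc (as-sum (f ∘ suc))
    ... | no _ = as-sum (f ∘ suc)

  -- A permutation of lists carries a bijection of positions; the casts identify the positions of a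
  -- tabulated list with `Fin m`.
  tabulate-↭⇒permutation : ∀ {m} (f g : Fin m → Item) → tabulate f ↭ tabulate g → ∃[ σ ] (∀ i → f i ≡ g (σ ⟨$⟩ʳ i))
  tabulate-↭⇒permutation {m} f g p = σ , λ i → trans (sym (Listₚ.lookup-tabulate f i)) (trans (PermSetoidₚ.onIndices-lookup (≡.setoid Item) (↭⇒↭ₛ p) _)
      (at g (π ⟨$⟩ʳ cast (sym (Listₚ.length-tabulate f)) i)))
    where
    π : Permutation (length (tabulate f)) (length (tabulate g))
    π = PermSetoid.onIndices (↭⇒↭ₛ p)
    σ : Permutation′ m
    σ = cast-id (sym (Listₚ.length-tabulate f)) ∘ₚ (π ∘ₚ cast-id (Listₚ.length-tabulate g))
    at : ∀ (g : Fin m → Item) j → lookup (tabulate g) j ≡ g (cast (Listₚ.length-tabulate g) j)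
    at g j = trans (cong (lookup (tabulate g)) (sym (Finₚ.cast-involutive (sym (Listₚ.length-tabulate g)) (Listₚ.length-tabulate g) j)))
      (Listₚ.lookup-tabulate g (cast (Listₚ.length-tabulate g) j))

  pair : ∀ μ → (Fin (length μ) → Word n) → Fin (length μ) → Item
  pair μ L i = lookup μ i , L i

  -- The empty word is a filler for lists that are too short; it is not reached when the parts of
  -- the list are `μ`.
  assign : (μ : List ℕ) → List Item → Fin (length μ) → Word n
  assign (l ∷ μ) [] i = []
  assign (l ∷ μ) ((_ , L) ∷ ms) zero = L
  assign (l ∷ μ) (_ ∷ ms) (suc i) = assign μ ms i

  tabulate-assign : ∀ μ ms → parts ms ≡ μ → tabulate (pair μ (assign μ ms)) ≡ ms
  tabulate-assign _ ms refl = at-parts ms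
    where
    at-parts : ∀ ms → tabulate (pair (parts ms) (assign (parts ms) ms)) ≡ ms
    at-parts [] = refl
    at-parts (i ∷ ms) = cong (i ∷_) (at-parts ms)

  isOdd⇒Odd : ∀ m → isOdd m ≡ true → Odd m
  isOdd⇒Odd (suc zero) _ = 0 , refl
  isOdd⇒Odd (suc (suc m)) e with isOdd⇒Odd m (trans (sym (Boolₚ.not-involutive (isOdd m))) e)
  ... | j , refl = suc j , cong (λ m → suc (suc m)) (sym (ℕₚ.+-suc j (j +ℕ 0)))

  Odd⇒isOdd : ∀ m → Odd m → isOdd m ≡ true
  Odd⇒isOdd _ (j , refl) = cong not (trans (cong (isOdd ∘ (j +ℕ_)) (ℕₚ.+-identityʳ j)) (isOdd-+ j))

  covers⁻ : ∀ ms → covers ms ≡ true → ∀ v → ∃[ i ] (i ∈ ms × v ∈ proj₂ i)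
  covers⁻ ms e v = find (does⁻ (uses? v ms) (allFin⁻ _ e v))

  covers⁺ : ∀ ms → (∀ v → ∃[ i ] (i ∈ ms × v ∈ proj₂ i)) → covers ms ≡ true
  covers⁺ ms h = allFin⁺ _ λ v → does⁺ (uses? v ms) (lose (proj₁ (proj₂ (h v))) (proj₂ (proj₂ (h v))))

  good⁺ : ∀ {ms} → ms ∈ multisets λ′ → Good G λ′ (assign λ′ ms)
  good⁺ {ms} ms∈ with ∈-filter⁻ (contributes? λ′) {xs = msets items} ms∈
  ... | ms∈′ , parts≡ , cov = lyndon , covering , sizes , distinct
    where
    L : Fin (length λ′) → Word n
    L = assign λ′ ms
    tab : tabulate (pair λ′ L) ≡ ms
    tab = tabulate-assign λ′ ms parts≡
    item : ∀ i → pair λ′ L i ∈ items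
    item i = All.lookup (msets-⊆ items ms∈′) (subst (pair λ′ L i ∈_) tab (∈-tabulate⁺ i))
    lyndon : ∀ i → IsLyndon G (L i)
    lyndon i = LW⇒IsLyndon (proj₁ (∈-items⁻ (item i)))
    covering : ∀ v → ∃[ i ] v ∈ L i
    covering v with covers⁻ ms cov v
    ... | it , it∈ , v∈ with ∈-tabulate⁻ (subst (it ∈_) (sym tab) it∈)
    ...   | i , refl = i , v∈
    sizes : ∀ i → length (L i) ≡ lookup λ′ i ⊎ (Odd (length (L i)) × lookup λ′ i ≡ 2 *ℕ length (L i))
    sizes i with proj₂ (proj₂ (∈-items⁻ (item i)))
    ... | inj₁ e = inj₁ (sym e)
    ... | inj₂ (o , e) = inj₂ (isOdd⇒Odd _ o , trans e (cong (length (L i) +ℕ_) (sym (ℕₚ.+-identityʳ _))))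
    distinct : ∀ i i′ → i ≢ i′ → lookup λ′ i ≡ lookup λ′ i′ → Odd (lookup λ′ i) → ¬ (L i ≈ʰ L i′)
    -- A repetition would give an item of odd part multiplicity two, above its bound.
    distinct i i′ i≢i′ p o e = ℕₚ.<⇒≱ (count-twice⁺ (pair λ′ L) i≢i′ refl (sym (cong₂ _,_ p same)))
      (subst₂ _≤ℕ_ (cong (count (pair λ′ L i)) (sym tab)) (cong (λ b → if b then 1 else sum λ′) (Odd⇒isOdd _ o))
        (msets-count items items-unique ms∈′ (pair λ′ L i)))
      where
      same : L i ≡ L i′
      same = Std-unique (proj₁ (proj₂ (proj₁ (∈-items⁻ (item i))))) (proj₁ (proj₂ (proj₁ (∈-items⁻ (item i′))))) e

  lookup-injective : ∀ {X : Set} {xs : List X} → Unique xs → ∀ i j → lookup xs i ≡ lookup xs j → i ≡ j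
  lookup-injective (p ∷ u) zero zero e = refl
  lookup-injective (p ∷ u) zero (suc j) e = ⊥-elim (All.lookup p (∈-lookup j) e)
  lookup-injective (p ∷ u) (suc i) zero e = ⊥-elim (All.lookup p (∈-lookup i) (sym e))
  lookup-injective (p ∷ u) (suc i) (suc j) e = cong suc (lookup-injective u i j e)

  -- Equivalent standard words are equal, so equivalent assignments give each item the same
  -- multiplicity, and `msets-canonical` applies.
  same-multiset⇒≡ : ∀ {ms ms′} → ms ∈ multisets λ′ → ms′ ∈ multisets λ′ → SameMultiset G λ′ (assign λ′ ms) (assign λ′ ms′) → ms ≡ ms′
  same-multiset⇒≡ {ms} {ms′} ms∈ ms′∈ (σ , σ-parts , σ-words)
    with ∈-filter⁻ (contributes? λ′) {xs = msets items} ms∈ | ∈-filter⁻ (contributes? λ′) {xs = msets items} ms′∈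
  ... | m∈ , parts≡ , _ | m′∈ , parts≡′ , _ = msets-canonical items items-unique m∈ m′∈ λ x →
    trans (cong (count x) (sym tab)) (trans (count-permute (pair λ′ (assign λ′ ms)) (pair λ′ (assign λ′ ms′)) σ
      (λ i → cong₂ _,_ (sym (σ-parts i)) (Std-unique (std-word m∈ tab i) (std-word m′∈ tab′ (σ ⟨$⟩ʳ i)) (σ-words i))) x)
      (cong (count x) tab′))
    where
    tab : tabulate (pair λ′ (assign λ′ ms)) ≡ ms
    tab = tabulate-assign λ′ ms parts≡
    tab′ : tabulate (pair λ′ (assign λ′ ms′)) ≡ ms′
    tab′ = tabulate-assign λ′ ms′ parts≡′
    std-word : ∀ {ms} → ms ∈ msets items → tabulate (pair λ′ (assign λ′ ms)) ≡ ms → ∀ i → Std (assign λ′ ms i)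
    std-word {ms} m∈ tab i = proj₁ (proj₂ (proj₁ (∈-items⁻ (All.lookup (msets-⊆ items m∈)
      (subst (pair λ′ (assign λ′ ms) i ∈_) tab (∈-tabulate⁺ i))))))

  -- Each heap is replaced by its standard word, and the resulting items are arranged into the
  -- canonical list; the permutation involved witnesses the equivalence.
  representative : ∀ L → Good G λ′ L → ∃[ ms ] (ms ∈ multisets λ′ × SameMultiset G λ′ L (assign λ′ ms))
  representative L (lyndon , covering , sizes , distinct) = ms , ms∈multisets , σ , (λ i → cong proj₁ (sym (σ-pair i)))
      , λ i → ~-sym (std-≈ (L i)) ◅◅ ~-reflexive (cong proj₂ (σ-pair i))
    where
    L̂ : Fin (length λ′) → Word n
    L̂ i = std (L i)
    P : List Item
    P = tabulate (pair λ′ L̂)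
    len : ∀ i → length (L̂ i) ≡ length (L i)
    len i = ~-length (std-≈ (L i))
    item : ∀ i → pair λ′ L̂ i ∈ items
    item i = ∈-items⁺ (IsLyndon⇒LW (lyndon i)) (ℕₚ.≤-trans (short (sizes i)) (All.lookup (parts≤sum λ′) (∈-lookup i))) (admissible (sizes i))
      where
      short : length (L i) ≡ lookup λ′ i ⊎ (Odd (length (L i)) × lookup λ′ i ≡ 2 *ℕ length (L i)) → length (L̂ i) ≤ℕ lookup λ′ i
      short (inj₁ e) = ℕₚ.≤-reflexive (trans (len i) e)
      short (inj₂ (_ , e)) = ℕₚ.≤-trans (ℕₚ.≤-reflexive (len i)) (ℕₚ.≤-trans (ℕₚ.m≤m+n _ _) (ℕₚ.≤-reflexive (sym e)))
      admissible : length (L i) ≡ lookup λ′ i ⊎ (Odd (length (L i)) × lookup λ′ i ≡ 2 *ℕ length (L i)) → Admissible (pair λ′ L̂ i)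
      admissible (inj₁ e) = inj₁ (sym (trans (len i) e))
      admissible (inj₂ (o , e)) = inj₂ (trans (cong isOdd (len i)) (Odd⇒isOdd _ o)
        , trans e (trans (cong (length (L i) +ℕ_) (ℕₚ.+-identityʳ _)) (sym (cong₂ _+ℕ_ (len i) (len i)))))
    P⊆items : All (_∈ items) P
    P⊆items = Allₚ.tabulate⁺ item
    multiplicity : ∀ x → count x P ≤ℕ bound x
    multiplicity x@(j , w) with isOdd j in o
    -- For an even part the number of all parts, at most their sum, bounds the multiplicity.
    ... | false = ℕₚ.≤-trans (Listₚ.length-filter (x ≟ⁱ_) P) (ℕₚ.≤-trans (ℕₚ.≤-reflexive (Listₚ.length-tabulate (pair λ′ L̂))) (length≤sum (proj₁ λ-partition)))
    ... | true with count x P ≤ℕ? 1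
    ...   | yes p = p
    ...   | no ¬p with count-twice⁻ (pair λ′ L̂) x (ℕₚ.≰⇒> ¬p)
    ...     | i , i′ , i≢i′ , e , e′ = ⊥-elim (distinct i i′ i≢i′ (cong proj₁ (trans (sym e) e′))
              (isOdd⇒Odd _ (trans (cong (isOdd ∘ proj₁) (sym e)) o))
              (~-sym (std-≈ (L i)) ◅◅ (~-reflexive (cong proj₂ (trans (sym e) e′)) ◅◅ std-≈ (L i′))))
    complete : ∃[ ms ] (ms ∈ msets items × ms ↭ P)
    complete = msets-complete items P P⊆items multiplicity
    ms : List Item
    ms = proj₁ complete
    ms∈ : ms ∈ msets items
    ms∈ = proj₁ (proj₂ complete)
    ms↭P : ms ↭ P
    ms↭P = proj₂ (proj₂ complete)
    parts≡ : parts ms ≡ λ′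
    parts≡ = descending-↭⇒≡ (proj₂ (parts-partition ms∈)) (proj₂ λ-partition)
      (↭-trans (Permₚ.map⁺ proj₁ ms↭P) (↭-reflexive (trans (Listₚ.map-tabulate (pair λ′ L̂) proj₁) (Listₚ.tabulate-lookup λ′))))
    cov : covers ms ≡ true
    cov = covers⁺ ms λ v → pair λ′ L̂ (proj₁ (covering v)) , Permₚ.∈-resp-↭ (↭-sym ms↭P) (∈-tabulate⁺ (proj₁ (covering v)))
      , ~-∈ (~-sym (std-≈ (L (proj₁ (covering v))))) (proj₂ (covering v))
    ms∈multisets : ms ∈ multisets λ′
    ms∈multisets = ∈-filter⁺ (contributes? λ′) ms∈ (parts≡ , cov)
    permutation : ∃[ σ ] (∀ i → pair λ′ L̂ i ≡ pair λ′ (assign λ′ ms) (σ ⟨$⟩ʳ i))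
    permutation = tabulate-↭⇒permutation (pair λ′ L̂) (pair λ′ (assign λ′ ms))
      (↭-trans (↭-sym ms↭P) (↭-reflexive (sym (tabulate-assign λ′ ms parts≡))))
    σ : Permutation′ (length λ′)
    σ = proj₁ permutation
    σ-pair : ∀ i → pair λ′ L̂ i ≡ pair λ′ (assign λ′ ms) (σ ⟨$⟩ʳ i)
    σ-pair = proj₂ permutation

  class-count : HasClassCount (Assignment G λ′) (Good G λ′) (SameMultiset G λ′) (length (multisets λ′))
  class-count = (λ i → assign λ′ (lookup (multisets λ′) i)) , (λ i → good⁺ (∈-lookup i))
    , (λ i j same → lookup-injective (Uniqueₚ.filter⁺ (contributes? λ′) (msets-unique items items-unique)) i j
        (same-multiset⇒≡ (∈-lookup i) (∈-lookup j) same))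
    , λ L good → located (representative L good)
    where
    located : ∀ {L} → ∃[ ms ] (ms ∈ multisets λ′ × SameMultiset G λ′ L (assign λ′ ms)) →
      ∃[ i ] SameMultiset G λ′ L (assign λ′ (lookup (multisets λ′) i))
    located {L} (ms , ms∈ , same) = index ms∈ , subst (λ z → SameMultiset G λ′ L (assign λ′ z)) (Anyₚ.lookup-index ms∈) same

-- Comparison of the two expansions.

module Conclusion {n : ℕ} (G : SimpleGraph n) (λ′ : List ℕ) (λ-partition : IsPartition λ′)
  (c : List ℕ → ℚ) (expansion : IsPbarExpansion G c) where
  open RationalFacts
  open Sums ℚ-ring
  open KromaticExpansion G ℚ-ring (sum λ′)
  open KromaticCoefficients G ℚ-ring (sum λ′) using (partSign)
  open CommutativeRing ℚ-ring using (_-_)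
  open RingProps (CommutativeRing.ring ℚ-ring) using ([y-z]x≈yx-zx; x∙y⁻¹≈ε⇒x≈y)

  -- Subtracting the two expansions reduces the comparison to an expansion of zero.
  difference-vanishes : ∀ α → sum α ≤ℕ sum λ′ → ∑ (partitionsUpTo (sum α)) (λ ν → (c ν - signedCount ν) *ℚ natR (coefP ν α)) ≡ 0ℚ
  difference-vanishes α small = trans (∑-cong Λ λ {ν} _ → [y-z]x≈yx-zx (natR (coefP ν α)) (c ν) (signedCount ν))
    (trans (∑-+ Λ (λ ν → c ν *ℚ natR (coefP ν α)) _) (trans (cong₂ _+ℚ_ expansion′ negated) (ℚₚ.+-inverseʳ (natR (coefX G α)))))
    where
    Λ : List (List ℕ)
    Λ = partitionsUpTo (sum α)
    expansion′ : ∑ Λ (λ ν → c ν *ℚ natR (coefP ν α)) ≡ natR (coefX G α)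
    expansion′ = trans (∑-cong Λ λ {ν} _ → cong (c ν *ℚ_) (sym (ℕtoℚ≡natR (coefP ν α))))
      (trans (sym (sumℚ≡∑ (λ ν → c ν *ℚ ℕtoℚ (coefP ν α)) Λ)) (trans (sym (expansion α)) (ℕtoℚ≡natR (coefX G α))))
    negated : ∑ Λ (λ ν → -ℚ (signedCount ν *ℚ natR (coefP ν α))) ≡ -ℚ natR (coefX G α)
    negated = trans (sym (∑-neg Λ (λ ν → signedCount ν *ℚ natR (coefP ν α)))) (cong -ℚ_ (sym (kromatic-expansion α small)))
      where
      ∑-neg : ∀ xs (f : List ℕ → ℚ) → -ℚ ∑ xs f ≡ ∑ xs (λ ν → -ℚ f ν)
      ∑-neg [] f = refl
      ∑-neg (x ∷ xs) f = trans (ℚₚ.neg-distrib-+ (f x) (∑ xs f)) (cong (-ℚ f x +ℚ_) (∑-neg xs f))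

  coefficient : c λ′ ≡ signedCount λ′
  coefficient = x∙y⁻¹≈ε⇒x≈y _ _ (ExpansionUniqueness.coefficients-vanish ℚ-ring natR-cancel (sum λ′)
    (λ ν → c ν - signedCount ν) difference-vanishes λ′ λ-partition ℕₚ.≤-refl)

  -- A part `l + 1` has sign `(-1)^l`, and these exponents add up to the size minus the number of
  -- parts.
  ∏-partSign : ∀ {μ} → All (1 ≤ℕ_) μ → ∏ μ partSign ≡ sgn (sum μ ∸ length μ)
  ∏-partSign [] = refl
  ∏-partSign {suc l ∷ μ} (_ ∷ pos) = trans (cong₂ _*ℚ_ (sym (sgn-parity l)) (∏-partSign pos))
    (trans (sym (sgn-+ l (sum μ ∸ length μ))) (cong sgn (sym (ℕₚ.+-∸-assoc l (CoefficientSupport.length≤sum pos)))))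

  -- The sign of the coefficient meets the sign of the statement, and the square is one.
  signed-coefficient : sgn (sum λ′ ∸ length λ′) *ℚ c λ′ ≡ ℕtoℚ (length (multisets λ′))
  signed-coefficient = trans (cong (s *ℚ_) (trans coefficient (cong (_*ℚ natR N) (∏-partSign (proj₁ λ-partition)))))
    (trans (sym (ℚₚ.*-assoc s s (natR N))) (trans (cong (_*ℚ natR N) (sgn-square (sum λ′ ∸ length λ′)))
      (trans (ℚₚ.*-identityˡ (natR N)) (sym (ℕtoℚ≡natR N)))))
    where
    s : ℚ
    s = sgn (sum λ′ ∸ length λ′)
    N : ℕ
    N = length (multisets λ′)

theorem1p4 : ∀ {n : ℕ} (G : SimpleGraph n) (λ′ : List ℕ) → IsPartition λ′ →
    (c : List ℕ → ℚ) → IsPbarExpansion G c →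
    ∃[ N ] (HasClassCount (Assignment G λ′) (Good G λ′) (SameMultiset G λ′) N
    × sgn (sum λ′ ∸ length λ′) *ℚ c λ′ ≡ ℕtoℚ N)
theorem1p4 G λ′ P c e = _ , ClassCount.class-count G λ′ P , Conclusion.signed-coefficient G λ′ P c e
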